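{- For every integer $r\geq 3$ there exists $N\in\mathbb{N}$ such that for all integers $n\ge N$, $$\binom{r}{2}2^{n}-r^2+2r\leq g_r(\mathbb{Z}_n)\leq \binom{r}{2} 2^{n}+2^{ -\frac{n}{36\log_2n}}2^n,$$ and thus all but an $o(1)$ proportion (as $n\to\infty$, $r$ fixed) of the rainbow 3-AP-free $r$-colorings of $\mathbb{Z}_n$ are 2-colorings (i.e. use at most two of the $r$ colors). Moreover, for all $n\ge N$ and every proper subset $A\subsetneq \mathbb{Z}_n$, we have $g_r(A, \mathbb{Z}_n)< g_r(\mathbb{Z}_n)$.
   Context: $\mathbb{Z}_n$ is the cyclic group $\{0,1,\ldots,n-1\}$ under addition modulo $n$. A 3-AP in $\mathbb{Z}_n$ is a sequence $a,b,c$ of elements of $\mathbb{Z}_n$ with $a+c\equiv 2b \pmod n$. For $A\subseteq\mathbb{Z}_n$, an $r$-coloring of $A$ is any map $A\to[r]=\{1,\dots,r\}$ (not necessarily surjective); it is rainbow 3-AP-free if there is no 3-AP in $\mathbb{Z}_n$ all of whose terms lie in $A$ and whose three terms have pairwise distinct colors. $g_r(A,\mathbb{Z}_n)$ is the number of rainbow 3-AP-free $r$-colorings of $A$, and $g_r(\mathbb{Z}_n)=g_r(\mathbb{Z}_n,\mathbb{Z}_n)$. -}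

module Defs where

open import Data.Fin.Base using (Fin; toℕ)
import Data.Fin.Properties as Fin
open import Data.Fin.Subset using (Subset; inside; outside; _∈_; ⊤)
open import Data.Fin.Subset.Properties using (_∈?_)
open import Data.List.Base as List using (List; length; filter; allFin; cartesianProductWith; deduplicate)
open import Data.Nat.Base using (ℕ; NonZero; _+_; _*_; _^_; _∸_; _≤_; ∣_-_∣)
open import Data.Nat.Divisibility using (_∣_; _∣?_)
open import Data.Nat.Properties using (_≤?_)
open import Data.Product.Base using (_×_)
open import Data.Vec.Base using ([]; _∷_; _[_]=_; here; there)
open import Data.Vec.Properties.WithK using ([]=-irrelevant)
open import Relation.Binary.PropositionalEquality using (_≡_; _≢_; subst)
open import Relation.Nullary using (¬_; Dec; yes; no; ¬?; _×-dec_; _→-dec_)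
open import Relation.Nullary.Decidable using (map′)
open import Relation.Nullary.Negation using (contradiction)
open import Relation.Unary using (Decidable)

private
  variable
    n r : ℕ
    A : Subset n

-- The element i of ℤₙ is i : Fin n.

Is3AP : Fin n → Fin n → Fin n → Set
Is3AP {n} a b c = n ∣ ∣ toℕ a + toℕ c - 2 * toℕ b ∣

-- A map A → Fin r, stored as its table of values so that maps can be
-- enumerated without function extensionality; elements outside A get no value.

data Colouring (r : ℕ) : Subset n → Set where
  []    : Colouring r []
  _∷_   : Fin r → Colouring r A → Colouring r (inside ∷ A)
  skip  : Colouring r A → Colouring r (outside ∷ A)

colour : Colouring r A → ∀ {i} → i ∈ A → Fin r
colour (x ∷ χ)  here      = x
colour (x ∷ χ)  (there p) = colour χ p
colour (skip χ) (there p) = colour χ p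

-- Each colouring of A occurs exactly once in this list.

colourings : ∀ r (A : Subset n) → List (Colouring r A)
colourings r []            = List.[ [] ]
colourings r (inside  ∷ A) = cartesianProductWith _∷_ (allFin r) (colourings r A)
colourings r (outside ∷ A) = List.map skip (colourings r A)

PairwiseDistinct : Fin r → Fin r → Fin r → Set
PairwiseDistinct x y z = x ≢ y × y ≢ z × x ≢ z

RainbowFree : Colouring r A → Set
RainbowFree {A = A} χ =
  ∀ a (a∈A : a ∈ A) b (b∈A : b ∈ A) c (c∈A : c ∈ A) → Is3AP a b c →
  ¬ PairwiseDistinct (colour χ a∈A) (colour χ b∈A) (colour χ c∈A)

private
  allMembers? : (A : Subset n) {P : ∀ i → i ∈ A → Set} →
                (∀ i (p : i ∈ A) → Dec (P i p)) → Dec (∀ i (p : i ∈ A) → P i p)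
  allMembers? A {P} P? = Fin.all? at
    where
    at : ∀ i → Dec ((p : i ∈ A) → P i p)
    at i with i ∈? A
    ... | no  i∉A = yes (λ p → contradiction p i∉A)
    ... | yes i∈A = map′ (λ Pp q → subst (P i) ([]=-irrelevant i∈A q) Pp)
                         (λ f → f i∈A) (P? i i∈A)

  pairwiseDistinct? : (x y z : Fin r) → Dec (PairwiseDistinct x y z)
  pairwiseDistinct? x y z =
    ¬? (x Fin.≟ y) ×-dec ¬? (y Fin.≟ z) ×-dec ¬? (x Fin.≟ z)

rainbowFree? : Decidable (RainbowFree {r = r} {A = A})
rainbowFree? {A = A} χ =
  allMembers? A λ a a∈A → allMembers? A λ b b∈A → allMembers? A λ c c∈A →
  (_ ∣? _) →-dec ¬? (pairwiseDistinct? (colour χ a∈A) (colour χ b∈A) (colour χ c∈A))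

-- g r A is g_r(A, ℤₙ), and gℤ r n is g_r(ℤₙ).

g : ∀ r → Subset n → ℕ
g r A = length (filter rainbowFree? (colourings r A))

gℤ : ℕ → ℕ → ℕ
gℤ r n = g r (⊤ {n})

values : Colouring r A → List (Fin r)
values []       = List.[]
values (x ∷ χ)  = x List.∷ values χ
values (skip χ) = values χ

Is2Colouring : Colouring r A → Set
Is2Colouring χ = length (deduplicate Fin._≟_ (values χ)) ≤ 2

is2Colouring? : Decidable (Is2Colouring {r = r} {A = A})
is2Colouring? χ = _ ≤? 2

-- The number of rainbow 3-AP-free r-colourings of ℤₙ using three or more colours.

gℤ≥3 : ℕ → ℕ → ℕ
gℤ≥3 r n =
  length (filter (λ χ → ¬? (is2Colouring? χ))
                 (filter rainbowFree? (colourings r (⊤ {n}))))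

-- There are no reals in the library, so real inequalities are expressed
-- through comparisons with rationals (pairs of naturals).

-- log₂ n ≤ p / q, for n, q ≥ 1, that is n ≤ 2^(p/q).

log₂_≤_/_ : ℕ → ℕ → ℕ → Set
log₂ n ≤ p / q = n ^ q ≤ 2 ^ p

-- s / t ≤ n / (36 log₂ n), for n ≥ 2 and t ≥ 1: cross-multiplied, this is
-- log₂ n ≤ n t / (36 s), which holds trivially in the case s = 0.

_/_≤_/36log₂ : ℕ → ℕ → ℕ → Set
s / t ≤ n /36log₂ = log₂ n ≤ n * t / (36 * s)

-- x ≤ 2^(- s/t) 2^n, for t ≥ 1: both sides raised to the power t and
-- multiplied by 2^s.

_≤2^-_/_·2^_ : ℕ → ℕ → ℕ → ℕ → Set
x ≤2^- s / t ·2^ n = x ^ t * 2 ^ s ≤ (2 ^ n) ^ t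

-- m ≤ k + 2^(- l / (36 log₂ l)) 2^n, for l ≥ 2.  Since u ↦ 2^(- u) is
-- continuous and decreasing, a bound by its value at a real u amounts to a
-- bound by its values at all rationals s / t ≤ u.  The last summand is
-- positive, so replacing m - k by m ∸ k changes nothing.

_≤_+2^[-_/36log₂]·2^_ : ℕ → ℕ → ℕ → ℕ → Set
m ≤ k +2^[- l /36log₂]·2^ n =
  ∀ s t → .{{NonZero t}} → s / t ≤ l /36log₂ → (m ∸ k) ≤2^- s / t ·2^ n

-- A rainbow-free colouring is an independent set of the 3-uniform hypergraph
-- on ℤₙ × [r] whose edges are the rainbow 3-APs; its codegrees are bounded, so
-- 2^(εn) containers with at most δn² edges cover these sets.  In a container,
-- Roth's theorem in Varnavides' form bounds the points with three or more
-- available colours.  Either a positive proportion of the points has at most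
-- one colour, and the container has few colourings, or almost all points have
-- the same pair {i, j}: two points y, y + d with different pairs would mostly
-- give a rainbow progression y, y + d, y + 2d.  In the latter case a third
-- colour at x forbids x - d and x + d to be coloured by i and j, which leaves
-- about 2^(n/2) colourings.  So for every A there are at most 2^(n - n/K)
-- colourings with three or more colours, while those of ℤₙ with at most two
-- colours are counted exactly.  Roth's theorem is proved by density increment,
-- with the Hilbert cubes of Szemerédi's combinatorial argument.
module Submission where

open import Defs
open import Data.Fin.Subset using (Subset; inside; outside; _∈_; _⊂_; ⊤; ∣_∣)
open import Data.Bool.Base using (Bool; true; false; _∧_; _∨_; not; _xor_; T)
open import Data.Bool.Properties using (∨-comm) renaming (_≟_ to _≟ᵇ_)
open import Data.Empty using (⊥; ⊥-elim)
open import Data.Fin.Base using (Fin; toℕ) renaming (zero to fzero; suc to fsuc)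
open import Data.Fin.Properties using (toℕ<n; toℕ-injective) renaming (_≟_ to _≟ᶠ_)
open import Data.Fin.Subset.Properties using (∣⊤∣≡n; p⊂q⇒∣p∣<∣q∣)
open import Data.List.Base as List using (List; []; _∷_; length)
open import Data.List.Membership.Propositional using () renaming (_∈_ to _∈ₗ_)
open import Data.List.Membership.Propositional.Properties using (∈-deduplicate⁺; ∈-deduplicate⁻)
open import Data.List.Properties using (length-++)
open import Data.List.Relation.Unary.All as All using (All; []; _∷_)
open import Data.List.Relation.Unary.All.Properties using (all-filter) renaming (++⁺ to All-++⁺; filter⁺ to All-filter⁺)
open import Data.List.Relation.Unary.Any using (Any; here; there)
open import Data.List.Relation.Unary.Any.Properties using () renaming (++⁺ˡ to Any-++⁺ˡ; ++⁺ʳ to Any-++⁺ʳ)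
open import Data.List.Relation.Unary.Unique.DecPropositional.Properties using (deduplicate-!)
open import Data.List.Relation.Unary.Unique.Propositional using (Unique; []; _∷_)
open import Data.Nat.Base
open import Data.Nat.Combinatorics using (_C_; nC1≡n; nCk+nC[k+1]≡[n+1]C[k+1])
open import Data.Nat.Divisibility using (_∣_; divides; n∣m*n)
open import Data.Nat.DivMod
open import Data.Nat.Properties
open import Data.Nat.Tactic.RingSolver using (solve-∀)
open import Data.Product.Base using (Σ; _×_; _,_; proj₁; proj₂; ∃-syntax)
open import Data.Sum.Base using (_⊎_; inj₁; inj₂)
open import Data.Vec.Base using ([]; _∷_; here; there)
open import Function.Base using (_∘_; id; case_of_)
open import Relation.Binary.Definitions using (tri<; tri≈; tri>)
open import Relation.Binary.PropositionalEquality using (_≡_; _≢_; refl; sym; trans; cong; cong₂; subst; subst₂)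
open import Relation.Nullary using (¬_; Dec; yes; no; does; contradiction; ¬?; _×-dec_)
open import Relation.Nullary.Decidable using (map′)
open import Relation.Unary using (Decidable)

open ≤-Reasoning

-- Finite sums

-- The constants come in an order without a circle: `K₂` depends on `r`, `κ` comes from Roth's
-- theorem at a density of order `1 / (r * K₂)`, and the container parameters depend on both. Inside
-- a container the saving in the exponent is of order `n / K₂`, so the containers may number
-- `2 ^ (n / (4 * K₂))`; this leaves room for about `n / log n` recorded vertices at a cost of
-- `log n` bits each. In ℤₙ with arbitrary `n` neither doubling nor dilation is a bijection. Where
-- one would be used, the sum runs over several periods instead, at the price of a bounded
-- multiplicity. Degenerate progressions `x, x, x` stay in the hypergraph: three colours at one
-- point form an edge that no colouring contains, so `d = 0` needs no correction. The term
-- `- r² + 2r` is an overcount: each of the `r` constant colourings lies in `r - 1` of the pairs of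
-- colours, hence is counted `r - 2` times too often.

∑ : ℕ → (ℕ → ℕ) → ℕ
∑ zero    f = 0
∑ (suc n) f = f 0 + ∑ n (f ∘ suc)

⟦_⟧ : Bool → ℕ
⟦ true ⟧  = 1
⟦ false ⟧ = 0

count : ℕ → (ℕ → Bool) → ℕ
count n A = ∑ n (λ i → ⟦ A i ⟧)

⟦⟧≤1 : ∀ b → ⟦ b ⟧ ≤ 1
⟦⟧≤1 true  = ≤-refl
⟦⟧≤1 false = z≤n

-- Applied to an identity proved by the ring solver, s being the slack.
lin : ∀ {a b l r} s → l ≤ r → a + r + s ≡ b + l → a ≤ b
lin {a} {b} {l} {r} s l≤r eq = +-cancelʳ-≤ r a b (≤-trans (m≤m+n (a + r) s)
  (≤-trans (≤-reflexive eq) (+-monoʳ-≤ b l≤r)))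

infixr 6 _⊕_
infixr 7 _⊛_

_⊕_ : ∀ {a b c d} → a ≤ b → c ≤ d → a + c ≤ b + d
_⊕_ = +-mono-≤

_⊛_ : ∀ {a b} c → a ≤ b → c * a ≤ c * b
c ⊛ h = *-monoʳ-≤ c h

∑-cong : ∀ n {f h : ℕ → ℕ} → (∀ i → i < n → f i ≡ h i) → ∑ n f ≡ ∑ n h
∑-cong zero    e = refl
∑-cong (suc n) e = cong₂ _+_ (e 0 z<s) (∑-cong n (λ i i<n → e (suc i) (s<s i<n)))

∑-mono : ∀ n {f h : ℕ → ℕ} → (∀ i → i < n → f i ≤ h i) → ∑ n f ≤ ∑ n h
∑-mono zero    e = z≤n
∑-mono (suc n) e = +-mono-≤ (e 0 z<s) (∑-mono n (λ i i<n → e (suc i) (s<s i<n)))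

∑-+ : ∀ n (f h : ℕ → ℕ) → ∑ n (λ i → f i + h i) ≡ ∑ n f + ∑ n h
∑-+ zero    f h = refl
∑-+ (suc n) f h = trans (cong (f 0 + h 0 +_) (∑-+ n (f ∘ suc) (h ∘ suc))) (shuffle (f 0) (h 0) _ _)
  where
  shuffle : ∀ a b c d → a + b + (c + d) ≡ a + c + (b + d)
  shuffle = solve-∀

∑-* : ∀ n c (f : ℕ → ℕ) → ∑ n (λ i → c * f i) ≡ c * ∑ n f
∑-* zero    c f = sym (*-zeroʳ c)
∑-* (suc n) c f = trans (cong (c * f 0 +_) (∑-* n c (f ∘ suc))) (sym (*-distribˡ-+ c (f 0) _))

∑-const : ∀ n c → ∑ n (λ _ → c) ≡ n * c
∑-const zero    c = refl
∑-const (suc n) c = cong (c +_) (∑-const n c)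

∑-*ʳ : ∀ n (f : ℕ → ℕ) c → ∑ n (λ i → f i * c) ≡ ∑ n f * c
∑-*ʳ n f c = trans (∑-cong n (λ i _ → *-comm (f i) c)) (trans (∑-* n c f) (*-comm c (∑ n f)))

∑-1 : ∀ n → ∑ n (λ _ → 1) ≡ n
∑-1 n = trans (∑-const n 1) (*-identityʳ n)

∑-zero : ∀ n {f : ℕ → ℕ} → (∀ i → i < n → f i ≡ 0) → ∑ n f ≡ 0
∑-zero n e = trans (∑-cong n e) (trans (∑-const n 0) (*-zeroʳ n))

∑-bound : ∀ n c {f : ℕ → ℕ} → (∀ i → i < n → f i ≤ c) → ∑ n f ≤ n * c
∑-bound n c e = ≤-trans (∑-mono n e) (≤-reflexive (∑-const n c))

count≤ : ∀ n A → count n A ≤ n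
count≤ n A = ≤-trans (∑-bound n 1 (λ i _ → ⟦⟧≤1 (A i))) (≤-reflexive (*-identityʳ n))

∑-swap : ∀ m n (f : ℕ → ℕ → ℕ) → ∑ m (λ i → ∑ n (f i)) ≡ ∑ n (λ j → ∑ m (λ i → f i j))
∑-swap zero    n f = sym (∑-zero n (λ _ _ → refl))
∑-swap (suc m) n f = trans (cong (∑ n (f 0) +_) (∑-swap m n (f ∘ suc))) (sym (∑-+ n (f 0) _))

∑-split : ∀ m n (f : ℕ → ℕ) → ∑ (m + n) f ≡ ∑ m f + ∑ n (λ i → f (m + i))
∑-split zero    n f = refl
∑-split (suc m) n f = trans (cong (f 0 +_) (∑-split m n (f ∘ suc))) (sym (+-assoc (f 0) _ _))

∑-last : ∀ n (f : ℕ → ℕ) → ∑ (suc n) f ≡ ∑ n f + f n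
∑-last zero    f = +-comm (f 0) 0
∑-last (suc n) f = trans (cong (f 0 +_) (∑-last n (f ∘ suc))) (sym (+-assoc (f 0) _ _))

∑-blocks : ∀ k m (f : ℕ → ℕ) → ∑ (k * m) f ≡ ∑ k (λ i → ∑ m (λ j → f (i * m + j)))
∑-blocks zero    m f = refl
∑-blocks (suc k) m f = trans (∑-split m (k * m) f) (cong (∑ m f +_)
  (trans (∑-blocks k m (λ i → f (m + i)))
         (∑-cong k (λ i _ → ∑-cong m (λ j _ → cong f (sym (+-assoc m (i * m) j)))))))

∑-term : ∀ n (f : ℕ → ℕ) i → i < n → f i ≤ ∑ n f
∑-term (suc n) f zero    _   = m≤m+n (f 0) _
∑-term (suc n) f (suc i) i<n = ≤-trans (∑-term n (f ∘ suc) i (s<s⁻¹ i<n)) (m≤n+m _ (f 0))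

∑-prefix : ∀ {m n} (f : ℕ → ℕ) → m ≤ n → ∑ m f ≤ ∑ n f
∑-prefix {m} {n} f m≤n = subst (λ k → ∑ m f ≤ ∑ k f) (m+[n∸m]≡n m≤n)
  (≤-trans (m≤m+n _ _) (≤-reflexive (sym (∑-split m (n ∸ m) f))))

∑-shift : ∀ n c (f : ℕ → ℕ) → ∑ c f + ∑ n (λ i → f (c + i)) ≡ ∑ n f + ∑ c (λ i → f (n + i))
∑-shift n c f = trans (sym (∑-split c n f)) (trans (cong (λ k → ∑ k f) (+-comm c n)) (∑-split n c f))

∑-shift-≤ : ∀ n c (f : ℕ → ℕ) → (∀ i → n ≤ i → f i ≡ 0) → ∑ n (λ i → f (c + i)) ≤ ∑ n f
∑-shift-≤ n c f z = begin
  ∑ n (λ i → f (c + i)) ≤⟨ m≤n+m _ (∑ c f) ⟩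
  ∑ c f + ∑ n (λ i → f (c + i)) ≡⟨ ∑-shift n c f ⟩
  ∑ n f + ∑ c (λ i → f (n + i)) ≡⟨ cong (∑ n f +_) (∑-zero c (λ i _ → z (n + i) (m≤m+n n i))) ⟩
  ∑ n f + 0 ≡⟨ +-identityʳ _ ⟩
  ∑ n f ∎

∑-shift-≥ : ∀ n c (f : ℕ → ℕ) → ∑ n f ≤ ∑ c f + ∑ n (λ i → f (c + i))
∑-shift-≥ n c f = ≤-trans (m≤m+n _ _) (≤-reflexive (sym (∑-shift n c f)))

-- Keeps only the first term of each block of length `e`. Together with `∑-periods` this replaces a
-- change of variables by dilation, which fails when `e` and the modulus have a common factor.
∑-dilate : ∀ n e (f : ℕ → ℕ) → .{{NonZero e}} → ∑ n (λ i → f (i * e)) ≤ ∑ (n * e) f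
∑-dilate n e@(suc e′) f = ≤-trans (∑-mono n (λ i _ → ≤-trans (≤-reflexive (cong f (sym (+-identityʳ (i * e)))))
    (∑-term e (λ j → f (i * e + j)) 0 z<s)))
  (≤-reflexive (sym (∑-blocks n e f)))

Periodic : ℕ → (ℕ → ℕ) → Set
Periodic n f = ∀ i → f (n + i) ≡ f i

∑-periodic-shift : ∀ n c (f : ℕ → ℕ) → Periodic n f → ∑ n (λ i → f (c + i)) ≡ ∑ n f
∑-periodic-shift n c f per = +-cancelˡ-≡ (∑ c f) _ _ (trans (∑-shift n c f)
  (trans (cong (∑ n f +_) (∑-cong c (λ i _ → per i))) (+-comm (∑ n f) (∑ c f))))

∑-periods : ∀ n e (f : ℕ → ℕ) → Periodic n f → ∑ (e * n) f ≡ e * ∑ n f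
∑-periods n zero    f per = refl
∑-periods n (suc e) f per = trans (∑-split n (e * n) f) (cong (∑ n f +_)
  (trans (∑-cong (e * n) (λ i _ → per i)) (∑-periods n e f per)))

∑-max : ∀ n (f : ℕ → ℕ) → 0 < n → ∃[ i ] i < n × ∑ n f ≤ n * f i
∑-max (suc zero)    f _ = 0 , z<s , ≤-refl
∑-max (suc (suc n)) f _ with ∑-max (suc n) (f ∘ suc) z<s
... | i , i<n , le with f 0 ≤? f (suc i)
...   | yes f0≤ = suc i , s<s i<n , +-mono-≤ f0≤ le
...   | no  f0≰ = 0 , z<s , +-monoʳ-≤ (f 0) (≤-trans le (*-monoʳ-≤ (suc n) (<⇒≤ (≰⇒> f0≰))))

∑-min : ∀ n (f : ℕ → ℕ) → 0 < n → ∃[ i ] i < n × n * f i ≤ ∑ n f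
∑-min (suc zero)    f _ = 0 , z<s , ≤-refl
∑-min (suc (suc n)) f _ with ∑-min (suc n) (f ∘ suc) z<s
... | i , i<n , le with f (suc i) ≤? f 0
...   | yes ≤f0 = suc i , s<s i<n , +-mono-≤ ≤f0 le
...   | no  ≰f0 = 0 , z<s , +-monoʳ-≤ (f 0) (≤-trans (*-monoʳ-≤ (suc n) (<⇒≤ (≰⇒> ≰f0))) le)

search : ∀ n (A : ℕ → Bool) → (∃[ i ] i < n × A i ≡ true) ⊎ (∀ i → i < n → A i ≡ false)
search zero A = inj₂ (λ _ ())
search (suc n) A with A 0 in eq
... | true = inj₁ (0 , z<s , eq)
... | false with search n (A ∘ suc)
...   | inj₁ (i , i<n , e) = inj₁ (suc i , s<s i<n , e)
...   | inj₂ none = inj₂ λ { zero _ → eq ; (suc i) lt → none i (s<s⁻¹ lt) }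

∧-true : ∀ {a b} → a ∧ b ≡ true → a ≡ true × b ≡ true
∧-true {true} {true} refl = refl , refl

∧-intro : ∀ {a b} → a ≡ true → b ≡ true → a ∧ b ≡ true
∧-intro refl refl = refl

∨-true : ∀ {a b} → a ∨ b ≡ true → a ≡ true ⊎ b ≡ true
∨-true {true}  _ = inj₁ refl
∨-true {false} e = inj₂ e

∨-introˡ : ∀ {a} b → a ≡ true → a ∨ b ≡ true
∨-introˡ b refl = refl

∨-introʳ : ∀ a {b} → b ≡ true → a ∨ b ≡ true
∨-introʳ true  _ = refl
∨-introʳ false e = e

true≢false : ∀ {b} → b ≡ true → b ≡ false → ⊥
true≢false refl ()

T⇒≡ : ∀ {b} → T b → b ≡ true
T⇒≡ {true} _ = refl

≡⇒T : ∀ {b} → b ≡ true → T b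
≡⇒T refl = _

<ᵇ-intro : ∀ {m n} → m < n → (m <ᵇ n) ≡ true
<ᵇ-intro lt = T⇒≡ (<⇒<ᵇ lt)

<ᵇ-elim : ∀ m n → (m <ᵇ n) ≡ true → m < n
<ᵇ-elim m n e = <ᵇ⇒< m n (≡⇒T e)

≤ᵇ-intro : ∀ {m n} → m ≤ n → (m ≤ᵇ n) ≡ true
≤ᵇ-intro le = T⇒≡ (≤⇒≤ᵇ le)

≤ᵇ-elim : ∀ m n → (m ≤ᵇ n) ≡ true → m ≤ n
≤ᵇ-elim m n e = ≤ᵇ⇒≤ m n (≡⇒T e)

≡ᵇ-intro : ∀ {m n} → m ≡ n → (m ≡ᵇ n) ≡ true
≡ᵇ-intro {m} {n} e = T⇒≡ (≡⇒≡ᵇ m n e)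

≡ᵇ-elim : ∀ m n → (m ≡ᵇ n) ≡ true → m ≡ n
≡ᵇ-elim m n e = ≡ᵇ⇒≡ m n (≡⇒T e)

≡ᵇ-false : ∀ {m n} → m ≢ n → (m ≡ᵇ n) ≡ false
≡ᵇ-false {m} {n} ne with m ≡ᵇ n in eq
... | true  = contradiction (≡ᵇ-elim m n eq) ne
... | false = refl

not-true : ∀ {b} → not b ≡ true → b ≡ false
not-true {false} _ = refl

not-≡ᵇ : ∀ {m n} → not (m ≡ᵇ n) ≡ true → m ≢ n
not-≡ᵇ {m} e refl = true≢false e (cong not (≡ᵇ-intro {m} refl))

⟦⟧-mono : ∀ {a b} → (a ≡ true → b ≡ true) → ⟦ a ⟧ ≤ ⟦ b ⟧
⟦⟧-mono {true}  imp rewrite imp refl = ≤-refl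
⟦⟧-mono {false} imp = z≤n

count-mono : ∀ n {A B : ℕ → Bool} → (∀ i → i < n → A i ≡ true → B i ≡ true) → count n A ≤ count n B
count-mono n imp = ∑-mono n (λ i i<n → ⟦⟧-mono (imp i i<n))

n<2^n : ∀ n → n < 2 ^ n
n<2^n zero    = s≤s z≤n
n<2^n (suc n) = ≤-trans (+-mono-≤ (m^n>0 2 n) (n<2^n n)) (≤-reflexive (cong (2 ^ n +_) (sym (+-identityʳ _))))

-- Roth's theorem

infix 4 _∈S_

-- Subset sums of the generators, that is, the points of a Hilbert cube relative to its base point.
data _∈S_ : ℕ → List ℕ → Set where
  nil  : 0 ∈S []
  skip : ∀ {s d ds} → s ∈S ds → s ∈S (d ∷ ds)
  take : ∀ {s d ds} → s ∈S ds → d + s ∈S (d ∷ ds)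

Supported : ℕ → (ℕ → Bool) → Set
Supported t B = ∀ z → B z ≡ true → z < t

support-zero : ∀ {t B} → Supported t B → ∀ z → t ≤ z → ⟦ B z ⟧ ≡ 0
support-zero {t} {B} supp z t≤z with B z in eq
... | true  = contradiction (supp z eq) (≤⇒≯ t≤z)
... | false = refl

-- The pairs that begin at the first point of `β` in the window already number one less than its
-- points.
pairs-in-window : ∀ v w (β : ℕ → Bool) → w ≤ v →
  count w β ≤ 1 + ∑ w (λ i → ∑ v (λ e → ⟦ β i ∧ β (i + suc e) ⟧))
pairs-in-window v zero    β _   = z≤n
pairs-in-window v (suc w) β w<v with β 0
... | true  = s≤s (≤-trans (∑-prefix (λ i → ⟦ β (suc i) ⟧) (<⇒≤ w<v)) (m≤m+n _ _))
... | false = ≤-trans (pairs-in-window v w (β ∘ suc) (<⇒≤ w<v))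
                      (s≤s (m≤n+m _ (∑ v (λ _ → 0))))

-- A window of length `2 * b` contains about two points of `B` on average, hence about one pair, and
-- one of the `2 * b` possible differences takes its share of these pairs. The bound on `d` does not
-- involve `t`.
popular-difference : ∀ b t (B : ℕ → Bool) → 1 ≤ b → 8 * (b * b) ≤ t → Supported t B → t ≤ b * count t B →
  ∃[ d ] 1 ≤ d × d ≤ 2 * b × t ≤ 8 * (b * b) * count t (λ z → B z ∧ B (z + d))
popular-difference b t B 1≤b t-large supp dense
  with ∑-max (2 * b) (λ e → count t (λ z → B z ∧ B (z + suc e))) (≤-trans 1≤b (m≤m+n b _))
... | e , e<w , max = suc e , s≤s z≤n , e<w ,
      combine b t (P e) (count t B) (∑ w P) dense t-large (≤-trans (≤-reflexive (+-comm (w * count t B) 0)) windows) max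
  where
  w = 2 * b
  P : ℕ → ℕ
  P e = count t (λ z → B z ∧ B (z + suc e))

  starts : ∀ i → i < w → count t B ≤ w + ∑ t (λ y → ⟦ B (i + y) ⟧)
  starts i i<w = ≤-trans (∑-shift-≥ t i (λ z → ⟦ B z ⟧))
    (+-monoˡ-≤ _ (≤-trans (count≤ i B) (<⇒≤ i<w)))

  translate : ∀ i e → ∑ t (λ y → ⟦ B (i + y) ∧ B (i + y + suc e) ⟧) ≤ P e
  translate i e = ∑-shift-≤ t i (λ z → ⟦ B z ∧ B (z + suc e) ⟧)
    (support-zero {B = λ z → B z ∧ B (z + suc e)} (λ z h → supp z (proj₁ (∧-true h))))


  windows : w * count t B ≤ w * w + (t + w * ∑ w P)
  windows = begin
    w * count t B
      ≡⟨ ∑-const w (count t B) ⟨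
    ∑ w (λ _ → count t B)
      ≤⟨ ∑-mono w starts ⟩
    ∑ w (λ i → w + ∑ t (λ y → ⟦ B (i + y) ⟧))
      ≡⟨ ∑-+ w (λ _ → w) _ ⟩
    ∑ w (λ _ → w) + ∑ w (λ i → ∑ t (λ y → ⟦ B (i + y) ⟧))
      ≡⟨ cong₂ _+_ (∑-const w w) (∑-swap w t _) ⟩
    w * w + ∑ t (λ y → count w (λ i → B (i + y)))
      ≤⟨ +-monoʳ-≤ (w * w) (∑-mono t (λ y _ → pairs-in-window w w (λ i → B (i + y)) ≤-refl)) ⟩
    w * w + ∑ t (λ y → 1 + ∑ w (λ i → ∑ w (λ e → ⟦ B (i + y) ∧ B (i + suc e + y) ⟧)))
      ≡⟨ cong (w * w +_) (trans (∑-+ t (λ _ → 1) _) (cong₂ _+_ (∑-1 t) rearrange)) ⟩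
    w * w + (t + ∑ w (λ i → ∑ w (λ e → ∑ t (λ y → ⟦ B (i + y) ∧ B (i + y + suc e) ⟧))))
      ≤⟨ +-monoʳ-≤ (w * w) (+-monoʳ-≤ t (∑-bound w (∑ w P) (λ i _ → ∑-mono w (λ e _ → translate i e)))) ⟩
    w * w + (t + w * ∑ w P) ∎
    where
    rearrange : ∑ t (λ y → ∑ w (λ i → ∑ w (λ e → ⟦ B (i + y) ∧ B (i + suc e + y) ⟧)))
              ≡ ∑ w (λ i → ∑ w (λ e → ∑ t (λ y → ⟦ B (i + y) ∧ B (i + y + suc e) ⟧)))
    rearrange = trans (∑-swap t w _) (∑-cong w (λ i _ → trans (∑-swap t w _)
      (∑-cong w (λ e _ → ∑-cong t (λ y _ → cong (λ z → ⟦ B (i + y) ∧ B z ⟧)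
        (trans (+-assoc i (suc e) y) (trans (cong (i +_) (+-comm (suc e) y)) (sym (+-assoc i y (suc e))))))))))

  combine : ∀ b t p c s → t ≤ b * c → 8 * (b * b) ≤ t →
            2 * b * c + 0 ≤ 2 * b * (2 * b) + (t + 2 * b * s) → s ≤ 2 * b * p → t ≤ 8 * (b * b) * p
  combine b t p c s h₁ h₂ h₃ h₄ =
    lin 0 (4 ⊛ h₁ ⊕ h₂ ⊕ 2 ⊛ h₃ ⊕ (2 * (2 * b)) ⊛ h₄)
        (identity b t p c s)
    where
    identity : ∀ b t p c s →
      t + (4 * (b * c) + (t + (2 * (2 * b * (2 * b) + (t + 2 * b * s)) + 2 * (2 * b) * (2 * b * p)))) + 0
      ≡ 8 * (b * b) * p + (4 * t + (8 * (b * b) + (2 * (2 * b * c + 0) + 2 * (2 * b) * s)))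
    identity = solve-∀

HasCube : ℕ → ℕ → (ℕ → Bool) → Set
HasCube k D B = ∃[ ds ] length ds ≡ k × All (λ d → 1 ≤ d × d ≤ D) ds
  × ∃[ x ] (∀ s → s ∈S ds → B (x + s) ≡ true)

cube-extend : ∀ {k D E d} {B : ℕ → Bool} → 1 ≤ d → d ≤ E →
  HasCube k D (λ z → B z ∧ B (z + d)) → HasCube (suc k) (E ⊔ D) B
cube-extend {D = D} {E} {d} {B} 1≤d d≤E (ds , len , small , x , contained) =
  d ∷ ds , cong suc len ,
  (1≤d , ≤-trans d≤E (m≤m⊔n E D)) ∷ All.map (λ (l , u) → l , ≤-trans u (m≤n⊔m E D)) small ,
  x , contained′
  where
  contained′ : ∀ s → s ∈S (d ∷ ds) → B (x + s) ≡ true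
  contained′ s (skip i)     = proj₁ (∧-true (contained s i))
  contained′ _ (take {s} i) = subst (λ z → B z ≡ true)
    (trans (+-assoc x s d) (cong (x +_) (+-comm s d))) (proj₂ (∧-true {B (x + s)} (contained s i)))

CubesIn : ℕ → ℕ → ℕ → ℕ → Set
CubesIn k b D t₀ = ∀ t → t₀ ≤ t → ∀ B → Supported t B → t ≤ b * count t B → HasCube k D B

cubes-zero : ∀ b → CubesIn 0 b 0 1
cubes-zero b t 1≤t B supp dense with search t B
... | inj₁ (x , _ , Bx) = [] , refl , [] , x , λ { _ nil → subst (λ z → B z ≡ true) (sym (+-identityʳ x)) Bx }
... | inj₂ none = contradiction (≤-trans 1≤t (≤-trans dense (≤-reflexive
        (trans (cong (b *_) (∑-zero t (λ i i<t → cong ⟦_⟧ (none i i<t)))) (*-zeroʳ b))))) λ ()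

-- A cube inside `B` intersected with its translate by a popular difference `d` extends by the
-- generator `d`; the intersection has density at least `1 / (8 * (b * b))`.
cubes-suc : ∀ k b D t₀ → 1 ≤ b → CubesIn k (8 * (b * b)) D t₀ →
  CubesIn (suc k) b ((2 * b) ⊔ D) ((8 * (b * b)) ⊔ t₀)
cubes-suc k b D t₀ 1≤b rec t t≥ B supp dense =
  let d , 1≤d , d≤ , dense′ = popular-difference b t B 1≤b (≤-trans (m≤m⊔n _ t₀) t≥) supp dense
  in cube-extend {k} {D} {2 * b} {d} {B} 1≤d d≤
       (rec t (≤-trans (m≤n⊔m (8 * (b * b)) t₀) t≥) (λ z → B z ∧ B (z + d))
            (λ z h → supp z (proj₁ (∧-true h))) dense′)

-- Hilbert's cube lemma, with generators bounded independently of t.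
cube : ∀ k b → 1 ≤ b → ∃[ D ] ∃[ t₀ ] CubesIn k b D t₀
cube zero    b _   = 0 , 1 , cubes-zero b
cube (suc k) b 1≤b =
  let D , t₀ , rec = cube k (8 * (b * b)) (≤-trans (*-mono-≤ 1≤b 1≤b) (m≤m+n _ _))
  in _ , _ , cubes-suc k b D t₀ 1≤b rec

HasAP : (ℕ → Bool) → ℕ → Set
HasAP A m = ∃[ x ] ∃[ d ] 1 ≤ d × x + d + d < m × A x ≡ true × A (x + d) ≡ true × A (x + d + d) ≡ true

NoAP : (ℕ → Bool) → Set
NoAP A = ∀ x d → 1 ≤ d → A x ≡ true → A (x + d) ≡ true → A (x + d + d) ≡ true → ⊥

RothAt : ℕ → ℕ → ℕ → Set
RothAt p Q m = ∀ A → p * m ≤ Q * count m A → HasAP A m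

hasAP? : ∀ A m → Dec (HasAP A m)
hasAP? A m = map′ (λ (x , _ , d , _ , ap) → x , d , ap)
  (λ (x , d , ap@(_ , lt , _)) → x , ≤-<-trans (≤-trans (m≤m+n x d) (m≤m+n (x + d) d)) lt , d , ≤-<-trans (m≤n+m d (x + d)) lt , ap)
  (anyUpTo? (λ x → anyUpTo? (λ d → (1 ≤? d) ×-dec (x + d + d <? m)
    ×-dec (A x ≟ᵇ true) ×-dec (A (x + d) ≟ᵇ true) ×-dec (A (x + d + d) ≟ᵇ true)) m) m)

not-+ : ∀ b → ⟦ not b ⟧ + ⟦ b ⟧ ≡ 1
not-+ true  = refl
not-+ false = refl

xor-≤ : ∀ a b → ⟦ a xor b ⟧ ≤ ⟦ a ∧ not b ⟧ + ⟦ not a ∧ b ⟧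
xor-≤ true  true  = z≤n
xor-≤ true  false = s≤s z≤n
xor-≤ false true  = s≤s z≤n
xor-≤ false false = z≤n

difference-swap : ∀ a b → ⟦ a ∧ not b ⟧ + ⟦ b ⟧ ≡ ⟦ a ⟧ + ⟦ not a ∧ b ⟧
difference-swap true  true  = refl
difference-swap true  false = refl
difference-swap false true  = refl
difference-swap false false = refl

-- A set `N` nearly invariant under translation by `d` is nearly a union of progressions of
-- difference `d` and length `m`. Since `A` misses `N` and is sparse on every such progression, it
-- is as sparse on the complement of `N`, up to errors from the boundary and from the changes of
-- `N`.
module Windows
  (Q s m d n : ℕ) (A N : ℕ → Bool)
  (1≤m : 1 ≤ m)
  (sparse : ∀ y → Q * ∑ m (λ j → ⟦ A (j * d + y) ⟧) ≤ (4 + s) * m)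
  (disjoint : ∀ z → N z ≡ true → A z ≡ false)
  (bounded : ∀ z → N z ≡ true → z < n)
  (low : ∀ z → N z ≡ true → m * d ≤ z)
  where

  exits : ℕ
  exits = count n (λ z → not (N z) ∧ N (z + d))

  X : ℕ → Bool
  X z = N z xor N (z + d)

  N-zero : ∀ z → z < m * d → ⟦ N z ⟧ ≡ 0
  N-zero z lt with N z in eq
  ... | true  = contradiction (low z eq) (<⇒≱ lt)
  ... | false = refl

  shifted : ∀ c → c ≤ m * d → count n N ≤ ∑ n (λ y → ⟦ N (c + y) ⟧)
  shifted c c≤ = ≤-trans (∑-shift-≥ n c (λ z → ⟦ N z ⟧))
    (≤-reflexive (cong (_+ ∑ n (λ y → ⟦ N (c + y) ⟧)) (∑-zero c (λ z z<c → N-zero z (<-≤-trans z<c c≤)))))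

  -- Translation by `d` loses no point of `N`, which has none below `m * d`; so along steps of
  -- length `d` the set `N` is left at most as often as it is entered from outside.
  entries≤exits : count n (λ z → N z ∧ not (N (z + d))) ≤ exits
  entries≤exits = +-cancelʳ-≤ (count n (λ z → N (z + d))) _ _ (begin
    count n (λ z → N z ∧ not (N (z + d))) + count n (λ z → N (z + d))
      ≡⟨ ∑-+ n _ _ ⟨
    ∑ n (λ z → ⟦ N z ∧ not (N (z + d)) ⟧ + ⟦ N (z + d) ⟧)
      ≡⟨ ∑-cong n (λ z _ → difference-swap (N z) (N (z + d))) ⟩
    ∑ n (λ z → ⟦ N z ⟧ + ⟦ not (N z) ∧ N (z + d) ⟧)
      ≡⟨ ∑-+ n _ _ ⟩
    count n N + exits
      ≤⟨ +-monoˡ-≤ exits (shifted d (≤-trans (≤-reflexive (sym (+-identityʳ d))) (*-monoˡ-≤ d 1≤m))) ⟩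
    ∑ n (λ y → ⟦ N (d + y) ⟧) + exits
      ≡⟨ cong (_+ exits) (∑-cong n (λ y _ → cong (λ z → ⟦ N z ⟧) (+-comm d y))) ⟩
    count n (λ z → N (z + d)) + exits
      ≡⟨ +-comm _ exits ⟩
    exits + count n (λ z → N (z + d)) ∎)

  changes : count n X ≤ 2 * exits
  changes = ≤-trans (∑-mono n (λ z _ → xor-≤ (N z) (N (z + d))))
    (≤-trans (≤-reflexive (∑-+ n _ _)) (≤-trans (+-monoˡ-≤ exits entries≤exits)
      (≤-reflexive (cong (exits +_) (sym (+-identityʳ exits))))))

  F H β : ℕ → ℕ
  F y = ∑ m (λ j → ⟦ A (j * d + y) ⟧)
  H y = ∑ m (λ j → ⟦ not (N (j * d + y)) ⟧)
  β y = ∑ m (λ j → ⟦ X (j * d + y) ⟧)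

  xor-false : ∀ a b → ⟦ a xor b ⟧ ≡ 0 → b ≡ a
  xor-false true  true  _ = refl
  xor-false false false _ = refl

  constant : ∀ y → β y ≡ 0 → ∀ j → j < m → N (j * d + y) ≡ N y
  constant y none zero    _    = refl
  constant y none (suc j) j+1<m = trans (cong N (trans (+-assoc d (j * d) y) (+-comm d (j * d + y))))
    (trans (xor-false _ _ (n≤0⇒n≡0 (≤-trans (∑-term m (λ j → ⟦ X (j * d + y) ⟧) j j<m) (≤-reflexive none))))
           (constant y none j j<m))
    where j<m = <-trans (n<1+n j) j+1<m

  -- A window on which `N` changes is paid for by the term in `β`. On any other window `N` is
  -- constant: either it contains the window and `A` is absent, or it misses the window and `sparse`
  -- applies.
  window : ∀ y → Q * F y ≤ (4 + s) * H y + Q * (m * β y)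
  window y with β y in eq
  ... | suc c = ≤-trans (*-monoʳ-≤ Q (≤-trans (∑-bound m 1 (λ j _ → ⟦⟧≤1 (A (j * d + y)))) (*-monoʳ-≤ m (s≤s (z≤n {c})))))
                        (m≤n+m _ ((4 + s) * H y))
  ... | zero with N y in Ny
  ...   | true  = ≤-trans (≤-reflexive (trans (cong (Q *_) (∑-zero m (λ j j<m →
                    cong ⟦_⟧ (disjoint (j * d + y) (trans (constant y eq j j<m) Ny))))) (*-zeroʳ Q))) z≤n
  ...   | false = ≤-trans (sparse y) (≤-trans (≤-reflexive (cong ((4 + s) *_) (sym full))) (m≤m+n _ _))
    where
    full : H y ≡ m
    full = trans (∑-cong m (λ j j<m → cong (λ b → ⟦ not b ⟧) (trans (constant y eq j j<m) Ny))) (∑-1 m)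

  ∑F : m * count n A ≤ m * (m * d) + ∑ n F
  ∑F = begin
    m * count n A ≡⟨ ∑-const m _ ⟨
    ∑ m (λ _ → count n A) ≤⟨ ∑-mono m bound ⟩
    ∑ m (λ j → m * d + ∑ n (λ y → ⟦ A (j * d + y) ⟧)) ≡⟨ ∑-+ m (λ _ → m * d) _ ⟩
    ∑ m (λ _ → m * d) + ∑ m (λ j → ∑ n (λ y → ⟦ A (j * d + y) ⟧))
                                                             ≡⟨ cong₂ _+_ (∑-const m (m * d)) (∑-swap m n _) ⟩
    m * (m * d) + ∑ n F ∎
    where
    bound : ∀ j → j < m → count n A ≤ m * d + ∑ n (λ y → ⟦ A (j * d + y) ⟧)
    bound j j<m = ≤-trans (∑-shift-≥ n (j * d) (λ z → ⟦ A z ⟧))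
      (+-monoˡ-≤ _ (≤-trans (count≤ (j * d) A) (*-monoˡ-≤ d (<⇒≤ j<m))))

  ∑H : ∑ n H + m * count n N ≤ m * n
  ∑H = begin
    ∑ n H + m * count n N
      ≡⟨ cong₂ _+_ (∑-swap n m _) (sym (∑-const m _)) ⟩
    ∑ m (λ j → ∑ n (λ y → ⟦ not (N (j * d + y)) ⟧)) + ∑ m (λ _ → count n N)
      ≡⟨ ∑-+ m _ _ ⟨
    ∑ m (λ j → ∑ n (λ y → ⟦ not (N (j * d + y)) ⟧) + count n N)
      ≤⟨ ∑-bound m n (λ j j<m → begin
           ∑ n (λ y → ⟦ not (N (j * d + y)) ⟧) + count n N
             ≤⟨ +-monoʳ-≤ _ (shifted (j * d) (*-monoˡ-≤ d (<⇒≤ j<m))) ⟩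
           ∑ n (λ y → ⟦ not (N (j * d + y)) ⟧) + ∑ n (λ y → ⟦ N (j * d + y) ⟧)
             ≡⟨ ∑-+ n _ _ ⟨
           ∑ n (λ y → ⟦ not (N (j * d + y)) ⟧ + ⟦ N (j * d + y) ⟧)
             ≡⟨ ∑-cong n (λ y _ → not-+ (N (j * d + y))) ⟩
           ∑ n (λ _ → 1)
             ≡⟨ ∑-1 n ⟩
           n ∎) ⟩
    m * n ∎

  X-zero : ∀ z → n ≤ z → ⟦ X z ⟧ ≡ 0
  X-zero z n≤z with N z in e₁ | N (z + d) in e₂
  ... | true  | _     = contradiction (bounded z e₁) (≤⇒≯ n≤z)
  ... | false | true  = contradiction (bounded (z + d) e₂) (≤⇒≯ (≤-trans n≤z (m≤m+n z d)))
  ... | false | false = refl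

  ∑β : ∑ n β ≤ m * (2 * exits)
  ∑β = ≤-trans (≤-reflexive (∑-swap n m _)) (∑-bound m (2 * exits) (λ j _ →
    ≤-trans (∑-shift-≤ n (j * d) (λ z → ⟦ X z ⟧) X-zero) changes))

  -- Summing `window` over all starting points counts every point `m` times, apart from a boundary
  -- of `m * d` points; the factor `m` is then cancelled.
  total : Q * count n A + (4 + s) * count n N ≤ Q * (m * d) + (4 + s) * n + Q * (m * (2 * exits))
  total = *-cancelˡ-≤ m {{>-nonZero 1≤m}} (combine Q s m (m * d) n (count n A) (count n N) (∑ n F) (∑ n H) (∑ n β) (2 * exits)
      ∑F ∑H ∑β (begin
        Q * ∑ n F ≡⟨ ∑-* n Q F ⟨
        ∑ n (λ y → Q * F y) ≤⟨ ∑-mono n (λ y _ → window y) ⟩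
        ∑ n (λ y → (4 + s) * H y + Q * (m * β y)) ≡⟨ ∑-+ n _ _ ⟩
        ∑ n (λ y → (4 + s) * H y) + ∑ n (λ y → Q * (m * β y))
          ≡⟨ cong₂ _+_ (∑-* n (4 + s) H) (trans (∑-* n Q _) (cong (Q *_) (∑-* n m β))) ⟩
        (4 + s) * ∑ n H + Q * (m * ∑ n β) ∎))
    where
    combine : ∀ Q s m D n a c f h b e → m * a ≤ m * D + f → h + m * c ≤ m * n → b ≤ m * e →
              Q * f ≤ (4 + s) * h + Q * (m * b) →
              m * (Q * a + (4 + s) * c) ≤ m * (Q * D + (4 + s) * n + Q * (m * e))
    combine Q s m D n a c f h b e h₁ h₂ h₃ h₄ =
      lin 0 (Q ⊛ h₁ ⊕ (4 + s) ⊛ h₂ ⊕ (Q * m) ⊛ h₃ ⊕ h₄)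
          (identity Q (4 + s) m D n a c f h b e)
      where
      identity : ∀ Q p m D n a c f h b e →
        m * (Q * a + p * c) + (Q * (m * D + f) + (p * (m * n) + (Q * m * (m * e) + (p * h + Q * (m * b))))) + 0
        ≡ m * (Q * D + p * n + Q * (m * e)) + (Q * (m * a) + (p * (h + m * c) + (Q * m * b + Q * f)))
      identity = solve-∀

-- The map `j ↦ j * d + y` carries progressions to progressions, so a dense pullback would produce
-- one in `A`.
sparse-progressions : ∀ {Q s m} → RothAt (4 + s) Q m → ∀ {A} → NoAP A →
  ∀ d → 1 ≤ d → ∀ y → Q * ∑ m (λ j → ⟦ A (j * d + y) ⟧) ≤ (4 + s) * m
sparse-progressions {Q} {s} {m} roth {A} noAP d 1≤d y with (4 + s) * m ≤? Q * count m (λ j → A (j * d + y))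
... | no ≰ = <⇒≤ (≰⇒> ≰)
... | yes dense with roth (λ j → A (j * d + y)) dense
...   | x , e , 1≤e , _ , a , b , c = ⊥-elim (noAP (x * d + y) (e * d) (*-mono-≤ 1≤e 1≤d) a
          (subst (λ z → A z ≡ true) (regroup x e d y) b)
          (subst (λ z → A z ≡ true) (trans (regroup (x + e) e d y) (cong (_+ e * d) (regroup x e d y))) c))
  where
  regroup : ∀ x e d y → (x + e) * d + y ≡ x * d + y + e * d
  regroup = solve-∀

-- The first quarter of `[0, 4 * q)` supplies a Hilbert cube in `A`, the second supplies midpoints,
-- and the reflections of the cube through them stay below `4 * q`. Adding the generators one at a
-- time makes the set of reflections grow, and with `K + 1` generators some step adds at most
-- `n / K` points.
module Increment
  (Q s m k D : ℕ)
  (1≤m : 1 ≤ m) (1≤s : 1 ≤ s) (large-s : 6 * Q < (4 + s) * s)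
  (roth : RothAt (4 + s) Q m)
  (1≤k : 1 ≤ k)
  (D-small : Q * (m * D) ≤ k * m) (D-small′ : m * D ≤ k * m)
  (cubes : ∀ B → Supported (k * m) B → k * m ≤ Q * count (k * m) B → HasCube (suc (8 * (Q * m))) D B)
  (A : ℕ → Bool) (noAP : NoAP A)
  (dense : (3 + s) * (4 * (k * m)) ≤ Q * count (4 * (k * m)) A)
  where

  q n K : ℕ
  q = k * m
  n = 4 * q
  -- With at most `n / K` exits the error `Q * (m * (2 * exits))` of `Windows.total` is at most `q`.
  K = 8 * (Q * m)

  a : ℕ → ℕ
  a z = ⟦ A z ⟧

  1≤q : 1 ≤ q
  1≤q = *-mono-≤ 1≤k 1≤m

  quarter : ℕ → ℕ
  quarter c = ∑ q (λ i → a (c + i))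

  quarter-≤ : ∀ c → Q * quarter c ≤ (4 + s) * q
  quarter-≤ c = begin
    Q * quarter c
      ≡⟨ cong (Q *_) (∑-blocks k m (λ i → a (c + i))) ⟩
    Q * ∑ k (λ i → ∑ m (λ j → a (c + (i * m + j))))
      ≡⟨ ∑-* k Q _ ⟨
    ∑ k (λ i → Q * ∑ m (λ j → a (c + (i * m + j))))
      ≡⟨ ∑-cong k (λ i _ → cong (Q *_) (∑-cong m (λ j _ → cong a (regroup c (i * m) j)))) ⟩
    ∑ k (λ i → Q * ∑ m (λ j → a (j * 1 + (c + i * m))))
      ≤⟨ ∑-bound k ((4 + s) * m) (λ i _ → sparse-progressions {Q} {s} {m} roth {A} noAP 1 ≤-refl (c + i * m)) ⟩
    k * ((4 + s) * m)
      ≡⟨ rearrange k (4 + s) m ⟩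
    (4 + s) * q ∎
    where
    regroup : ∀ c i j → c + (i + j) ≡ j * 1 + (c + i)
    regroup = solve-∀
    rearrange : ∀ k p m → k * (p * m) ≡ p * (k * m)
    rearrange = solve-∀

  quarters : count n A ≡ quarter 0 + (quarter q + (quarter (q + q) + quarter (q + (q + q))))
  quarters = trans (∑-split q (q + (q + (q + 0))) a) (cong (quarter 0 +_)
    (trans (∑-split q (q + (q + 0)) (λ i → a (q + i))) (cong (quarter q +_)
      (trans (∑-split q (q + 0) (λ i → a (q + (q + i)))) (cong₂ _+_
        (∑-cong q (λ i _ → cong a (sym (+-assoc q q i))))
        (trans (∑-split q 0 (λ i → a (q + (q + (q + i))))) (trans (+-identityʳ _)
          (∑-cong q (λ i _ → cong a (trans (cong (q +_) (sym (+-assoc q q i))) (sym (+-assoc q (q + q) i))))))))))))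

  -- Three quarters of density at most `(4 + s) / Q` leave `4 * (3 + s) - 3 * (4 + s) = s` for the
  -- fourth.
  combine-quarters : ∀ {w x y z} → Q * (w + (x + (y + z))) ≥ (3 + s) * (4 * q) →
    Q * x ≤ (4 + s) * q → Q * y ≤ (4 + s) * q → Q * z ≤ (4 + s) * q → s * q ≤ Q * w
  combine-quarters {w} {x} {y} {z} h h₁ h₂ h₃ =
    lin 0 (h ⊕ h₁ ⊕ h₂ ⊕ h₃) (identity Q s q w x y z)
    where
    identity : ∀ Q s q w x y z →
      s * q + (Q * (w + (x + (y + z))) + ((4 + s) * q + ((4 + s) * q + (4 + s) * q))) + 0
      ≡ Q * w + ((3 + s) * (4 * q) + (Q * x + (Q * y + Q * z)))
    identity = solve-∀

  dense′ : (3 + s) * (4 * q) ≤ Q * (quarter 0 + (quarter q + (quarter (q + q) + quarter (q + (q + q)))))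
  dense′ = ≤-trans dense (≤-reflexive (cong (Q *_) quarters))

  first-quarter : s * q ≤ Q * quarter 0
  first-quarter = combine-quarters dense′ (quarter-≤ q) (quarter-≤ (q + q)) (quarter-≤ (q + (q + q)))

  second-quarter : s * q ≤ Q * quarter q
  second-quarter = combine-quarters
    (≤-trans dense′ (≤-reflexive (cong (Q *_) (swap (quarter 0) (quarter q) _))))
    (quarter-≤ 0) (quarter-≤ (q + q)) (quarter-≤ (q + (q + q)))
    where
    swap : ∀ w x y → w + (x + y) ≡ x + (w + y)
    swap = solve-∀

  B : ℕ → Bool
  B z = A z ∧ (z <ᵇ q)

  the-cube : HasCube (suc K) D B
  the-cube = cubes B (λ z h → <ᵇ-elim z q (proj₂ (∧-true {A z} h))) (begin
    q ≡⟨ +-identityʳ q ⟨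
    1 * q ≤⟨ *-monoˡ-≤ q 1≤s ⟩
    s * q ≤⟨ first-quarter ⟩
    Q * quarter 0 ≤⟨ *-monoʳ-≤ Q (count-mono q (λ i i<q h → ∧-intro h (<ᵇ-intro i<q))) ⟩
    Q * count q B ∎)

  -- The reflections 2b - m of the cube points m through the b ∈ A ∩ [q, 2q)
  -- complete progressions m, b, 2b - m; A has to avoid them.
  record Avoided (N : ℕ → Bool) : Set where
    field
      disjoint : ∀ z → N z ≡ true → A z ≡ false
      bounded  : ∀ z → N z ≡ true → z < n
      low      : ∀ z → N z ≡ true → q ≤ z
      big      : quarter q ≤ count n N

  record Stable : Set where
    field
      N       : ℕ → Bool
      d       : ℕ
      1≤d     : 1 ≤ d
      d≤D     : d ≤ D
      avoided : Avoided N
      stable  : K * count n (λ z → not (N z) ∧ N (z + d)) ≤ n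

  -- Avoiding `N` costs `A` a mass of `(4 + s) * count n N`, while the density of `A` is only one
  -- unit of `1 / Q` below the maximum on windows. So this cost is at most `6 * q`: `4 * q` from
  -- that unit, `q` from the boundary and `q` from the exits.
  stable-absurd : Stable → ⊥
  stable-absurd st = <⇒≱ large-s (*-cancelʳ-≤ ((4 + s) * s) (6 * Q) q {{>-nonZero 1≤q}}
    (combine Q s q m d (count n A) (count n N) W.exits
      dense (≤-trans second-quarter (*-monoʳ-≤ Q big))
      (≤-trans (*-monoʳ-≤ Q (*-monoʳ-≤ m d≤D)) D-small) stable W.total))
    where
    open Stable st
    open Avoided avoided
    module W = Windows Q s m d n A N 1≤m (sparse-progressions {Q} {s} {m} roth {A} noAP d 1≤d) disjoint bounded
                 (λ z h → ≤-trans (≤-trans (*-monoʳ-≤ m d≤D) D-small′) (low z h))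
    combine : ∀ Q s q m d a c e → (3 + s) * (4 * q) ≤ Q * a → s * q ≤ Q * c → Q * (m * d) ≤ q →
      8 * (Q * m) * e ≤ 4 * q → Q * a + (4 + s) * c ≤ Q * (m * d) + (4 + s) * (4 * q) + Q * (m * (2 * e)) →
      (4 + s) * s * q ≤ 6 * Q * q
    combine Q s q m d a c e h₁ h₂ h₃ h₄ h₅ = *-cancelˡ-≤ 4
      (lin 0 ((4 * Q) ⊛ h₁ ⊕ (4 * (4 + s)) ⊛ h₂ ⊕ (4 * Q) ⊛ h₃ ⊕ Q ⊛ h₄ ⊕ (4 * Q) ⊛ h₅)
        (identity Q s q m d a c e))
      where
      identity : ∀ Q s q m d a c e →
        4 * ((4 + s) * s * q) + (4 * Q * (Q * a) + (4 * (4 + s) * (Q * c) + (4 * Q * q + (Q * (4 * q)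
          + 4 * Q * (Q * (m * d) + (4 + s) * (4 * q) + Q * (m * (2 * e))))))) + 0
        ≡ 4 * (6 * Q * q) + (4 * Q * ((3 + s) * (4 * q)) + (4 * (4 + s) * (s * q) + (4 * Q * (Q * (m * d))
          + (Q * (8 * (Q * m) * e) + 4 * Q * (Q * a + (4 + s) * c)))))
      identity = solve-∀

  module Chain (x : ℕ) where

    -- The equation says `z = 2b - (x + t)` without truncated subtraction.
    Reflected : List ℕ → (ℕ → Bool) → Set
    Reflected ds N = ∀ z → N z ≡ true → ∃[ t ] t ∈S ds × ∃[ b ] z + (x + t) ≡ b * 2 × q ≤ b × b < q + q × A b ≡ true

    -- The set of doubles `2b` of the points `b` of `A` in the second quarter.
    h : ℕ → Bool
    h y = (y / 2 * 2 ≡ᵇ y) ∧ (q ≤ᵇ y / 2) ∧ (y / 2 <ᵇ q + q) ∧ A (y / 2)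

    h-elim : ∀ y → h y ≡ true → y ≡ y / 2 * 2 × q ≤ y / 2 × y / 2 < q + q × A (y / 2) ≡ true
    h-elim y e with ∧-true {y / 2 * 2 ≡ᵇ y} e
    ... | e₁ , e′ with ∧-true {q ≤ᵇ y / 2} e′
    ...   | e₂ , e″ with ∧-true {y / 2 <ᵇ q + q} e″
    ...     | e₃ , e₄ = sym (≡ᵇ-elim _ y e₁) , ≤ᵇ-elim q _ e₂ , <ᵇ-elim _ (q + q) e₃ , e₄

    N₀ : ℕ → Bool
    N₀ z = h (x + z)

    N₀-reflected : Reflected [] N₀
    N₀-reflected z e with h-elim (x + z) e
    ... | e₁ , e₂ , e₃ , e₄ = 0 , nil , (x + z) / 2 , trans (trans (cong (z +_) (+-identityʳ x)) (+-comm z x)) e₁ , e₂ , e₃ , e₄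

    N₀-big : x < q → quarter q ≤ count n N₀
    N₀-big x<q = begin
      quarter q
        ≤⟨ ∑-mono q (λ i i<q → ⟦⟧-mono (double i i<q)) ⟩
      ∑ q (λ i → ⟦ h ((q + i) * 2) ⟧)
        ≤⟨ m≤n+m _ (∑ q (λ i → ⟦ h (i * 2) ⟧)) ⟩
      ∑ q (λ i → ⟦ h (i * 2) ⟧) + ∑ q (λ i → ⟦ h ((q + i) * 2) ⟧)
        ≡⟨ ∑-split q q (λ i → ⟦ h (i * 2) ⟧) ⟨
      ∑ (q + q) (λ i → ⟦ h (i * 2) ⟧)
        ≤⟨ ∑-dilate (q + q) 2 (λ y → ⟦ h y ⟧) ⟩
      count ((q + q) * 2) h
        ≡⟨ cong (λ l → count l h) (four q) ⟩
      count n h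
        ≤⟨ ∑-shift-≥ n x (λ y → ⟦ h y ⟧) ⟩
      count x h + count n N₀
        ≡⟨ cong (_+ count n N₀) (∑-zero x below) ⟩
      count n N₀ ∎
      where
      four : ∀ q → (q + q) * 2 ≡ 4 * q
      four = solve-∀
      half : ∀ b → b * 2 / 2 ≡ b
      half b = m*n/n≡m b 2
      double : ∀ i → i < q → A (q + i) ≡ true → h ((q + i) * 2) ≡ true
      double i i<q e rewrite half (q + i) =
        ∧-intro (≡ᵇ-intro {(q + i) * 2} refl) (∧-intro (≤ᵇ-intro (m≤m+n q i)) (∧-intro (<ᵇ-intro (+-monoʳ-< q i<q)) e))
      below : ∀ y → y < x → ⟦ h y ⟧ ≡ 0
      below y y<x with h y in e
      ... | false = refl
      ... | true with h-elim y e
      ...   | _ , q≤ , _ = contradiction (≤-trans q≤ (m/n≤m y 2)) (<⇒≱ (<-trans y<x x<q))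

    avoided : ∀ ds N → (∀ t → t ∈S ds → B (x + t) ≡ true) → Reflected ds N → quarter q ≤ count n N → Avoided N
    avoided ds N contained refl′ big′ = record
      { disjoint = λ z Nz → disj z (refl′ z Nz)
      ; bounded = λ z Nz → bnd z (refl′ z Nz)
      ; low = λ z Nz → lw z (refl′ z Nz)
      ; big = big′ }
      where
      Witness : ℕ → Set
      Witness z = ∃[ t ] t ∈S ds × ∃[ b ] z + (x + t) ≡ b * 2 × q ≤ b × b < q + q × A b ≡ true
      cube<q : ∀ {t} → t ∈S ds → x + t < q
      cube<q {t} t∈ = <ᵇ-elim (x + t) q (proj₂ (∧-true {A (x + t)} (contained t t∈)))
      double : ∀ b → b * 2 ≡ b + b
      double = solve-∀
      disj : ∀ z → Witness z → A z ≡ false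
      disj z (t , t∈ , b , eq , q≤b , b< , Ab) with A z in Az
      ... | false = refl
      ... | true  = ⊥-elim (noAP c e (m<n⇒0<n∸m c<b) (proj₁ (∧-true (contained t t∈)))
                      (subst (λ w → A w ≡ true) (sym c+e) Ab) (subst (λ w → A w ≡ true) z≡ Az))
        where
        c = x + t
        c<b : c < b
        c<b = <-≤-trans (cube<q t∈) q≤b
        e = b ∸ c
        c+e : c + e ≡ b
        c+e = m+[n∸m]≡n (<⇒≤ c<b)
        z≡ : z ≡ c + e + e
        z≡ = +-cancelʳ-≡ c _ _ (trans eq (trans (double b) (trans (cong₂ _+_ (sym c+e) (sym c+e)) (regroup c e))))
          where
          regroup : ∀ c e → c + e + (c + e) ≡ c + e + e + c
          regroup = solve-∀
      bnd : ∀ z → Witness z → z < n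
      bnd z (t , t∈ , b , eq , q≤b , b< , Ab) = ≤-<-trans (≤-trans (m≤m+n z (x + t)) (≤-reflexive (trans eq (double b))))
        (<-≤-trans (+-mono-< b< b<) (≤-reflexive (four q)))
        where
        four : ∀ q → q + q + (q + q) ≡ 4 * q
        four = solve-∀
      lw : ∀ z → Witness z → q ≤ z
      lw z (t , t∈ , b , eq , q≤b , b< , Ab) = +-cancelʳ-≤ (x + t) q z
        (≤-trans (+-monoʳ-≤ q (<⇒≤ (cube<q t∈))) (≤-trans (+-mono-≤ q≤b q≤b) (≤-reflexive (sym (trans eq (double b))))))

    -- Each generator either adds at most `n / K` reflections, which is the stable case, or raises
    -- the size by more than `n / K`; the last component records this growth.
    chain : x < q → ∀ ds → All (λ d → 1 ≤ d × d ≤ D) ds → (∀ t → t ∈S ds → B (x + t) ≡ true) →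
      Stable ⊎ (∃[ N ] Reflected ds N × quarter q ≤ count n N × length ds * n ≤ K * count n N)
    chain x<q [] _ contained = inj₂ (N₀ , N₀-reflected , N₀-big x<q , z≤n)
    chain x<q (d ∷ ds) ((1≤d , d≤D) ∷ small) contained with chain x<q ds small (λ t t∈ → contained t (skip t∈))
    ... | inj₁ st = inj₁ st
    ... | inj₂ (N , reflected , big , long) with K * count n (λ z → not (N z) ∧ N (z + d)) ≤? n
    ...   | yes stable = inj₁ record { N = N ; d = d ; 1≤d = 1≤d ; d≤D = d≤D
                           ; avoided = avoided ds N (λ t t∈ → contained t (skip t∈)) reflected big ; stable = stable }
    ...   | no unstable = inj₂ (N′ , reflected′ , ≤-trans big (≤-trans (m≤m+n _ _) (≤-reflexive (sym grows))) ,
            ≤-trans (≤-reflexive (+-comm n _)) (≤-trans (+-mono-≤ long (<⇒≤ (≰⇒> unstable)))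
              (≤-reflexive (trans (sym (*-distribˡ-+ K _ _)) (cong (K *_) (sym grows))))))
      where
      -- Raising the cube point by `d` lowers its reflection through the same midpoint by `d`.
      N′ : ℕ → Bool
      N′ z = N z ∨ N (z + d)
      ∨-count : ∀ a b → ⟦ a ∨ b ⟧ ≡ ⟦ a ⟧ + ⟦ not a ∧ b ⟧
      ∨-count true  b = refl
      ∨-count false b = refl
      grows : count n N′ ≡ count n N + count n (λ z → not (N z) ∧ N (z + d))
      grows = trans (∑-cong n (λ z _ → ∨-count (N z) (N (z + d)))) (∑-+ n _ _)
      reflected′ : Reflected (d ∷ ds) N′
      reflected′ z e with ∨-true {N z} e
      ... | inj₁ e₁ with reflected z e₁
      ...   | t , t∈ , rest = t , skip t∈ , rest
      reflected′ z e | inj₂ e₂ with reflected (z + d) e₂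
      ...   | t , t∈ , b , eq , rest = d + t , take t∈ , b , trans (regroup z x d t) eq , rest
        where
        regroup : ∀ z x d t → z + (x + (d + t)) ≡ z + d + (x + t)
        regroup = solve-∀

  absurd : ⊥
  absurd with the-cube
  ... | ds , len , small , x , contained with Chain.chain x x<q ds small contained
    where
    zero-sum : ∀ ds → ∃[ t ] t ∈S ds
    zero-sum []       = 0 , nil
    zero-sum (_ ∷ ds) = let t , t∈ = zero-sum ds in t , skip t∈
    x<q : x < q
    x<q with zero-sum ds
    ... | t , t∈ = ≤-<-trans (m≤m+n x t) (<ᵇ-elim (x + t) q (proj₂ (∧-true {A (x + t)} (contained t t∈))))
  ...   | inj₁ st = stable-absurd st
  -- Growth at all `K + 1` generators would give `N` more than `n` points below `n`.
  ...   | inj₂ (N , _ , _ , long) = <⇒≱ (*-monoˡ-< n {{>-nonZero (≤-trans 1≤q (m≤m+n q _))}} (n<1+n K))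
          (≤-trans (≤-reflexive (cong (_* n) (sym len))) (≤-trans long (*-monoʳ-≤ K (count≤ n N))))

increment : ∀ Q s m k D → 1 ≤ m → 1 ≤ s → 6 * Q < (4 + s) * s → RothAt (4 + s) Q m → 1 ≤ k →
  Q * (m * D) ≤ k * m → m * D ≤ k * m →
  (∀ B → Supported (k * m) B → k * m ≤ Q * count (k * m) B → HasCube (suc (8 * (Q * m))) D B) →
  RothAt (3 + s) Q (4 * (k * m))
increment Q s m k D 1≤m 1≤s large roth 1≤k D-small D-small′ cubes A dense with hasAP? A (4 * (k * m))
... | yes ap = ap
... | no none = ⊥-elim (Increment.absurd Q s m k D 1≤m 1≤s large roth 1≤k D-small D-small′ cubes A° noAP
        (≤-trans dense (*-monoʳ-≤ Q (count-mono n (λ i i<n e → ∧-intro e (<ᵇ-intro i<n))))))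
  where
  n : ℕ
  n = 4 * (k * m)
  -- The increment argument excludes progressions in all of `ℕ`, so `A` is first cut off at `n`.
  A° : ℕ → Bool
  A° z = A z ∧ (z <ᵇ n)
  noAP : NoAP A°
  noAP x d 1≤d a b c = none (x , d , 1≤d , <ᵇ-elim _ n (proj₂ (∧-true {A (x + d + d)} c)) ,
    proj₁ (∧-true a) , proj₁ (∧-true b) , proj₁ (∧-true c))

-- The cube bounds `D` and `t₀` depend on `Q` and `m` but not on the length in which the cube is
-- sought. Hence `k` can be chosen after them, large enough to make `Q * (m * D)` negligible.
roth-step : ∀ {Q s m} → 1 ≤ Q → 1 ≤ m → 1 ≤ s → 6 * Q < (4 + s) * s → RothAt (4 + s) Q m →
  ∃[ n ] 1 ≤ n × RothAt (3 + s) Q n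
roth-step {Q} {s} {m} 1≤Q 1≤m 1≤s large roth =
  let D , t₀ , cubes = cube (suc (8 * (Q * m))) Q 1≤Q in with-cubes D t₀ cubes (suc (Q * D + t₀)) (s≤s z≤n) (n≤1+n _)
  where
  with-cubes : ∀ D t₀ → CubesIn (suc (8 * (Q * m))) Q D t₀ → ∀ k → 1 ≤ k → Q * D + t₀ ≤ k → ∃[ n ] 1 ≤ n × RothAt (3 + s) Q n
  with-cubes D t₀ cubes k 1≤k k-large =
    4 * (k * m) , ≤-trans (*-mono-≤ 1≤k 1≤m) (m≤m+n (k * m) _) ,
    increment Q s m k D 1≤m 1≤s large roth 1≤k D-small
      (≤-trans (≤-trans (≤-reflexive (sym (*-identityˡ (m * D)))) (*-monoˡ-≤ (m * D) 1≤Q)) D-small)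
      (cubes (k * m) (≤-trans (≤-trans (m≤n+m t₀ (Q * D)) k-large) (m≤m*n k m {{>-nonZero 1≤m}})))
    where
    regroup : ∀ Q m D → Q * (m * D) ≡ Q * D * m
    regroup = solve-∀
    D-small : Q * (m * D) ≤ k * m
    D-small = ≤-trans (≤-reflexive (regroup Q m D)) (*-monoˡ-≤ m (≤-trans (m≤m+n (Q * D) t₀) k-large))

roth-descent : ∀ {Q} j s {m} → 1 ≤ Q → 1 ≤ m → 1 ≤ s → 6 * Q < (4 + s) * s → RothAt (3 + s + j) Q m →
  ∃[ n ] 1 ≤ n × RothAt (3 + s) Q n
roth-descent {Q} zero s {m} 1≤Q 1≤m 1≤s large roth = m , 1≤m , subst (λ p → RothAt p Q m) (+-identityʳ (3 + s)) roth
roth-descent {Q} (suc j) s {m} 1≤Q 1≤m 1≤s large roth =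
  let n , 1≤n , roth′ = roth-descent j (suc s) 1≤Q 1≤m (s≤s z≤n)
        (<-≤-trans large (*-mono-≤ (n≤1+n (4 + s)) (n≤1+n s)))
        (subst (λ p → RothAt p Q m) (+-suc (3 + s) j) roth)
  in roth-step {Q} {s} {n} 1≤Q 1≤n 1≤s large roth′

roth-from : ∀ E s Q → Q ≡ (3 + s) * E → 1 ≤ Q → 1 ≤ s → 6 * Q < (4 + s) * s →
  ∃[ m ] 1 ≤ m × (∀ A → m ≤ E * count m A → HasAP A m)
roth-from E s Q Q≡ 1≤Q 1≤s large =
  let m , 1≤m , rothAt = roth-descent {Q} Q s {1} 1≤Q ≤-refl 1≤s large trivial
  in m , 1≤m , λ A dense → rothAt A (≤-trans (*-monoʳ-≤ (3 + s) dense)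
       (≤-reflexive (trans (sym (*-assoc (3 + s) E _)) (cong (_* count m A) (sym Q≡)))))
  where
  -- The descent starts at a density above 1, where no set qualifies.
  trivial : RothAt (3 + s + Q) Q 1
  trivial A dense = ⊥-elim (<⇒≱ (s≤s (m≤n+m Q (2 + s))) (≤-trans (≤-reflexive (sym (*-identityʳ (3 + s + Q))))
    (≤-trans dense (≤-trans (*-monoʳ-≤ Q (count≤ 1 A)) (≤-reflexive (*-identityʳ Q))))))

roth : ∀ E → 1 ≤ E → ∃[ m ] 1 ≤ m × (∀ A → m ≤ E * count m A → HasAP A m)
roth E 1≤E = roth-from E s _ refl (*-mono-≤ {1} {3 + s} (s≤s z≤n) 1≤E) (s≤s z≤n) (large E)
  where
  -- Once `s` exceeds `6 * E`, `(4 + s) * s` exceeds `6 * ((3 + s) * E)`; the final density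
  -- `(3 + s) / Q` is `1 / E`.
  s = 7 + 6 * E
  identity : ∀ E → suc (6 * ((3 + (7 + 6 * E)) * E)) + (48 * E + 76) ≡ (4 + (7 + 6 * E)) * (7 + 6 * E)
  identity = solve-∀
  large : ∀ E → 6 * ((3 + (7 + 6 * E)) * E) < (4 + (7 + 6 * E)) * (7 + 6 * E)
  large E = m+n≤o⇒m≤o _ (≤-reflexive (identity E))

-- Varnavides' supersaturation in ℤₙ

periodic-% : ∀ n .{{_ : NonZero n}} (f : ℕ → ℕ) → Periodic n (λ z → f (z % n))
periodic-% n f z = cong f (trans (cong (_% n) (+-comm n z)) ([m+n]%n≡m%n z n))

∑-% : ∀ n .{{_ : NonZero n}} (f : ℕ → ℕ) → ∑ n (λ z → f (z % n)) ≡ ∑ n f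
∑-% n f = ∑-cong n (λ i i<n → cong f (m<n⇒m%n≡m i<n))

∑-cyclic : ∀ n .{{_ : NonZero n}} c (f : ℕ → ℕ) → ∑ n (λ z → f ((c + z) % n)) ≡ ∑ n f
∑-cyclic n c f = trans (∑-periodic-shift n c _ (periodic-% n f)) (∑-% n f)

∧₃-intro : ∀ {a b c} → a ≡ true → b ≡ true → c ≡ true → ⟦ a ∧ b ∧ c ⟧ ≡ 1
∧₃-intro refl refl refl = refl

-- Trivial progressions are counted too.
apCount : (n : ℕ) .{{_ : NonZero n}} → (ℕ → Bool) → ℕ
apCount n X = ∑ n λ d → ∑ n λ x → ⟦ X (x % n) ∧ X ((x + d) % n) ∧ X ((x + 2 * d) % n) ⟧

-- `X` is pulled back along all maps `j ↦ j * d + x` of length `m`. On average its density survives,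
-- and every pullback of density at least `1 / (2 * E)` contains a progression. Each progression of
-- ℤₙ arises at most `m * (m * m)` times: `m` starts, `m` steps, and a multiplicity of at most `m`
-- from the dilation.
varnavides-from : ∀ E m → 1 ≤ m → (∀ A → m ≤ 2 * E * count m A → HasAP A m) →
  ∀ n .{{_ : NonZero n}} X → n ≤ E * count n X → n * n ≤ 2 * E * (m * (m * m)) * apCount n X
varnavides-from E m 1≤m rothₘ n X dense =
  *-cancelˡ-≤ m {{>-nonZero 1≤m}} (combine E m n (count n X) (apCount n X) _ dense summed ∑R)
  where
  Y : ℕ → ℕ → ℕ
  Y d x = ⟦ X (x % n) ∧ X ((x + d) % n) ∧ X ((x + 2 * d) % n) ⟧

  S : ℕ → ℕ
  S d = ∑ n (Y d)

  shift-% : ∀ c z → (n + z + c) % n ≡ (z + c) % n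
  shift-% c z = trans (cong (_% n) (trans (cong (_+ c) (+-comm n z)) (trans (+-assoc z n c)
    (trans (cong (z +_) (+-comm n c)) (sym (+-assoc z c n)))))) ([m+n]%n≡m%n (z + c) n)

  Y-periodic : ∀ d → Periodic n (Y d)
  Y-periodic d x = cong₂ (λ u v → ⟦ u ∧ v ⟧) (cong X (trans (cong (_% n) (+-comm n x)) ([m+n]%n≡m%n x n)))
    (cong₂ _∧_ (cong X (shift-% d x)) (cong X (shift-% (2 * d) x)))

  S-periodic : Periodic n S
  S-periodic d = ∑-cong n (λ x _ → cong₂ (λ u v → ⟦ X (x % n) ∧ u ∧ v ⟧)
    (cong X (trans (cong (_% n) (trans (cong (x +_) (+-comm n d)) (sym (+-assoc x d n)))) ([m+n]%n≡m%n (x + d) n)))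
    (cong X (trans (cong (_% n) (regroup x n d)) ([m+kn]%n≡m%n (x + 2 * d) 2 n))))
    where
    regroup : ∀ x n d → x + 2 * (n + d) ≡ x + 2 * d + 2 * n
    regroup = solve-∀

  pulled : ℕ → ℕ → ℕ → Bool
  pulled x d j = X ((j * d + x) % n)

  R : ℕ → ℕ → ℕ
  R d x = ∑ m λ j → ∑ m λ e → Y (suc e * d) (j * d + x)

  pointwise : ∀ d x → 2 * E * count m (pulled x d) ≤ m + 2 * E * (m * R d x)
  pointwise d x with m ≤? 2 * E * count m (pulled x d)
  ... | no  ≰ = ≤-trans (<⇒≤ (≰⇒> ≰)) (m≤m+n m _)
  ... | yes dense′ with rothₘ (pulled x d) dense′
  ...   | j , suc e , _ , lt , a , b , c = ≤-trans (*-monoʳ-≤ (2 * E) (≤-trans (count≤ m (pulled x d))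
          (≤-trans (≤-reflexive (sym (*-identityʳ m))) (*-monoʳ-≤ m one≤R)))) (m≤n+m _ m)
    where
    j<m : j < m
    j<m = ≤-<-trans (≤-trans (m≤m+n j (suc e)) (m≤m+n _ (suc e))) lt
    e<m : e < m
    e<m = <-trans (n<1+n e) (≤-<-trans (m≤n+m (suc e) (j + suc e)) lt)
    b′ : X ((j * d + x + suc e * d) % n) ≡ true
    b′ = trans (cong (λ z → X (z % n)) (regroup j (suc e) d x)) b
      where
      regroup : ∀ j e d x → j * d + x + e * d ≡ (j + e) * d + x
      regroup = solve-∀
    c′ : X ((j * d + x + 2 * (suc e * d)) % n) ≡ true
    c′ = trans (cong (λ z → X (z % n)) (regroup j (suc e) d x)) c
      where
      regroup : ∀ j e d x → j * d + x + 2 * (e * d) ≡ (j + e + e) * d + x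
      regroup = solve-∀
    one≤R : 1 ≤ R d x
    one≤R = begin
      1 ≡⟨ ∧₃-intro a b′ c′ ⟨
      Y (suc e * d) (j * d + x) ≤⟨ ∑-term m (λ e → Y (suc e * d) (j * d + x)) e e<m ⟩
      ∑ m (λ e → Y (suc e * d) (j * d + x)) ≤⟨ ∑-term m (λ j → ∑ m λ e → Y (suc e * d) (j * d + x)) j j<m ⟩
      R d x ∎


  mass : ∑ n (λ d → ∑ n λ x → count m (pulled x d)) ≡ n * (m * count n X)
  mass = begin-equality
    ∑ n (λ d → ∑ n λ x → ∑ m λ j → ⟦ X ((j * d + x) % n) ⟧)
      ≡⟨ ∑-cong n (λ d _ → trans (∑-swap n m _) (∑-cong m (λ j _ →
           ∑-cyclic n (j * d) (λ z → ⟦ X z ⟧)))) ⟩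
    ∑ n (λ d → ∑ m λ j → count n X)
      ≡⟨ trans (∑-const n _) (cong (n *_) (∑-const m _)) ⟩
    n * (m * count n X) ∎

  summed : 2 * E * (n * (m * count n X)) ≤ n * (n * m) + 2 * E * (m * ∑ n (λ d → ∑ n (R d)))
  summed = begin
    2 * E * (n * (m * count n X))
      ≡⟨ cong (2 * E *_) mass ⟨
    2 * E * ∑ n (λ d → ∑ n λ x → count m (pulled x d))
      ≡⟨ trans (∑-cong n (λ d _ → ∑-* n (2 * E) _)) (∑-* n (2 * E) _) ⟨
    ∑ n (λ d → ∑ n λ x → 2 * E * count m (pulled x d))
      ≤⟨ ∑-mono n (λ d _ → ∑-mono n (λ x _ → pointwise d x)) ⟩
    ∑ n (λ d → ∑ n λ x → m + 2 * E * (m * R d x))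
      ≡⟨ ∑-cong n (λ d _ → trans (∑-+ n (λ _ → m) _) (cong₂ _+_ (∑-const n m)
           (trans (∑-* n (2 * E) _) (cong (2 * E *_) (∑-* n m _))))) ⟩
    ∑ n (λ d → n * m + 2 * E * (m * ∑ n (R d)))
      ≡⟨ trans (∑-+ n (λ _ → n * m) _) (cong₂ _+_ (∑-const n (n * m))
           (trans (∑-* n (2 * E) _) (cong (2 * E *_) (∑-* n m _)))) ⟩
    n * (n * m) + 2 * E * (m * ∑ n (λ d → ∑ n (R d))) ∎

  -- The multiples of `e + 1` below `n * (e + 1)` lie in `e + 1` periods of `S`, so no residue is
  -- met more than `e + 1` times, whatever common factor `e + 1` has with `n`.
  dilated : ∀ e → e < m → ∑ n (λ d → S (suc e * d)) ≤ m * ∑ n S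
  dilated e e<m = begin
    ∑ n (λ d → S (suc e * d)) ≡⟨ ∑-cong n (λ d _ → cong S (*-comm (suc e) d)) ⟩
    ∑ n (λ d → S (d * suc e)) ≤⟨ ∑-dilate n (suc e) S ⟩
    ∑ (n * suc e) S ≡⟨ cong (λ l → ∑ l S) (*-comm n (suc e)) ⟩
    ∑ (suc e * n) S ≡⟨ ∑-periods n (suc e) S S-periodic ⟩
    suc e * ∑ n S ≤⟨ *-monoˡ-≤ (∑ n S) e<m ⟩
    m * ∑ n S ∎

  ∑R : ∑ n (λ d → ∑ n (R d)) ≤ m * (m * (m * apCount n X))
  ∑R = begin
    ∑ n (λ d → ∑ n (λ x → ∑ m λ j → ∑ m λ e → Y (suc e * d) (j * d + x)))
      ≡⟨ ∑-cong n (λ d _ → trans (∑-swap n m _) (∑-cong m (λ j _ → trans (∑-swap n m _) (∑-cong m (λ e _ →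
           ∑-periodic-shift n (j * d) (Y (suc e * d)) (Y-periodic (suc e * d))))))) ⟩
    ∑ n (λ d → ∑ m λ j → ∑ m λ e → S (suc e * d))
      ≡⟨ trans (∑-swap n m _) (∑-cong m (λ j _ → ∑-swap n m _)) ⟩
    ∑ m (λ j → ∑ m λ e → ∑ n λ d → S (suc e * d))
      ≤⟨ ∑-bound m _ (λ j _ → ∑-bound m _ dilated) ⟩
    m * (m * (m * ∑ n S)) ∎

  combine : ∀ E m n c s r → n ≤ E * c → 2 * E * (n * (m * c)) ≤ n * (n * m) + 2 * E * (m * r) →
    r ≤ m * (m * (m * s)) → m * (n * n) ≤ m * (2 * E * (m * (m * m)) * s)
  combine E m n c s r h₁ h₂ h₃ =
    lin 0 ((2 * (n * m)) ⊛ h₁ ⊕ h₂ ⊕ (2 * E * m) ⊛ h₃) (identity E m n c s r)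
    where
    identity : ∀ E m n c s r →
      m * (n * n) + (2 * (n * m) * (E * c) + (n * (n * m) + 2 * E * (m * r) + 2 * E * m * (m * (m * (m * s))))) + 0
      ≡ m * (2 * E * (m * (m * m)) * s) + (2 * (n * m) * n + (2 * E * (n * (m * c)) + 2 * E * m * r))
    identity = solve-∀

varnavides : ∀ E → 1 ≤ E → ∃[ κ ] (∀ n .{{_ : NonZero n}} X → n ≤ E * count n X → n * n ≤ κ * apCount n X)
varnavides E 1≤E =
  let m , 1≤m , rothₘ = roth (2 * E) (≤-trans 1≤E (m≤m+n E _))
  in 2 * E * (m * (m * m)) , varnavides-from E m 1≤m rothₘ

-- Containers for 3-uniform hypergraphs of bounded codegree

Sub : ℕ → (ℕ → Bool) → (ℕ → Bool) → Set
Sub M I V = ∀ v → v < M → I v ≡ true → V v ≡ true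

-- `cover-union` adds and `cover-refine` multiplies the bounds on the number of members, so a
-- branching algorithm becomes a recursive construction of covers, with `Φ` recording the answers
-- given so far.
record Cover (M : ℕ) (Φ Good : (ℕ → Bool) → Set) (N : ℕ) : Set where
  constructor mkCover
  field
    members : List (ℕ → Bool)
    size    : length members ≤ N
    good    : All Good members
    covers  : ∀ I → Φ I → Any (Sub M I) members

cover-one : ∀ {M Φ Good N} V → 1 ≤ N → Good V → (∀ I → Φ I → Sub M I V) → Cover M Φ Good N
cover-one V 1≤N good sub = mkCover (V ∷ []) 1≤N (good ∷ []) (λ I φ → here (sub I φ))

cover-weaken : ∀ {M Φ Φ′ Good Good′ N N′} → (∀ I → Φ′ I → Φ I) → (∀ {V} → Good V → Good′ V) → N ≤ N′ →
  Cover M Φ Good N → Cover M Φ′ Good′ N′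
cover-weaken Φ′⇒Φ G⇒G′ N≤N′ (mkCover Vs size good covers) =
  mkCover Vs (≤-trans size N≤N′) (All.map G⇒G′ good) (λ I φ → covers I (Φ′⇒Φ I φ))

cover-union : ∀ {M Φ Φ₁ Φ₂ Good N₁ N₂} → (∀ I → Φ I → Φ₁ I ⊎ Φ₂ I) →
  Cover M Φ₁ Good N₁ → Cover M Φ₂ Good N₂ → Cover M Φ Good (N₁ + N₂)
cover-union split (mkCover Vs size good covers) (mkCover Vs′ size′ good′ covers′) =
  mkCover (Vs List.++ Vs′) (≤-trans (≤-reflexive (length-++ Vs)) (+-mono-≤ size size′)) (All-++⁺ good good′)
    (λ I φ → case split I φ of λ { (inj₁ φ₁) → Any-++⁺ˡ (covers I φ₁) ; (inj₂ φ₂) → Any-++⁺ʳ Vs (covers′ I φ₂) })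

cover-split : ∀ {M Φ Good N₁ N₂} v → Cover M (λ I → Φ I × I v ≡ true) Good N₁ →
  Cover M (λ I → Φ I × I v ≡ false) Good N₂ → Cover M Φ Good (N₁ + N₂)
cover-split {Φ = Φ} v = cover-union decide
  where
  decide : ∀ I → Φ I → (Φ I × I v ≡ true) ⊎ (Φ I × I v ≡ false)
  decide I φ with I v
  ... | true  = inj₁ (φ , refl)
  ... | false = inj₂ (φ , refl)

cover-refine : ∀ {M Φ Good Good′ N N′} → (∀ V → Good V → Cover M (λ I → Φ I × Sub M I V) Good′ N′) →
  Cover M Φ Good N → Cover M Φ Good′ (N * N′)
cover-refine {M} {Φ} {Good} {Good′} {N} {N′} refine (mkCover Vs size good covers) = cover-weaken
    (λ I φ → φ , covers I φ) id (*-monoˡ-≤ N′ size) (go Vs good)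
  where
  split : ∀ V Vs I → Φ I × Any (Sub M I) (V ∷ Vs) → (Φ I × Sub M I V) ⊎ (Φ I × Any (Sub M I) Vs)
  split V Vs I (φ , here sub)  = inj₁ (φ , sub)
  split V Vs I (φ , there any) = inj₂ (φ , any)
  go : ∀ Vs → All Good Vs → Cover M (λ I → Φ I × Any (Sub M I) Vs) Good′ (length Vs * N′)
  go []       []       = mkCover [] z≤n [] (λ { I (φ , ()) })
  go (V ∷ Vs) (g ∷ gs) = cover-union (split V Vs) (refine V g) (go Vs gs)

count-≡ᵇ : ∀ {M k} → k < M → count M (λ u → u ≡ᵇ k) ≡ 1
count-≡ᵇ {suc M} {zero}  _   = cong suc (∑-zero M (λ _ _ → refl))
count-≡ᵇ {suc M} {suc k} k<M = count-≡ᵇ (s<s⁻¹ k<M)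

⟦∧⟧ : ∀ a b → ⟦ a ∧ b ⟧ ≡ ⟦ a ⟧ * ⟦ b ⟧
⟦∧⟧ true  b = sym (+-identityʳ ⟦ b ⟧)
⟦∧⟧ false b = refl

-- `D₁` separates heavy from light vertices, and `D₂` plays the same part in the link graph. Per
-- round, up to `q` heavy vertices and then up to `j₀` vertices of the link graph are recorded from
-- an independent set. `T` need not be symmetric, the terms of a progression being ordered; each
-- pair of slots has its own codegree bound.
module Containers
  (M Δ D₁ D₂ q j₀ : ℕ) (T : ℕ → ℕ → ℕ → Bool)
  (1≤q : 1 ≤ q) (2MD₂≤qD₁ : 2 * (M * D₂) ≤ q * D₁) (D₁≤j₀ : D₁ ≤ j₀ * (4 * D₂))
  (codegree₁ : ∀ u v → count M (T u v) ≤ Δ)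
  (codegree₂ : ∀ u w → count M (λ v → T u v w) ≤ Δ)
  (codegree₃ : ∀ v w → count M (λ u → T u v w) ≤ Δ)
  (Ok : (ℕ → Bool) → Set)
  (independent : ∀ {I} → Ok I → ∀ u v w → u < M → v < M → w < M →
    I u ≡ true → I v ≡ true → I w ≡ true → T u v w ≡ false)
  where

  deg : (ℕ → Bool) → ℕ → ℕ
  deg V u = ∑ M λ v → ∑ M λ w → ⟦ V v ∧ V w ∧ T u v w ⟧

  edges : (ℕ → Bool) → ℕ
  edges V = ∑ M λ u → ⟦ V u ⟧ * deg V u

  Sparse : (ℕ → Bool) → Set
  Sparse V = edges V ≤ M * D₁ + q * (M * Δ)

  Shrunk : (ℕ → Bool) → (ℕ → Bool) → Set
  Shrunk V₀ V = 4 * Δ * count M V + D₁ ≤ 4 * Δ * count M V₀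

  -- The recursion for choosing at most `j` of the remaining vertices: recording a vertex uses up
  -- one of `j`, passing over it one of `f`.
  branching : ∀ f j → (2 + f) ^ j + (1 + f) ^ suc j ≤ (2 + f) ^ suc j
  branching f j = +-monoʳ-≤ ((2 + f) ^ j) (*-monoʳ-≤ (1 + f) (^-monoˡ-≤ j (n≤1+n (1 + f))))

  -- The vertices of D span, through T, a graph G on V₀ of bounded degree with
  -- many edges, so an independent set containing D is contained in a small
  -- number of sets which are smaller than V₀ by a constant factor.
  module LinkGraph (V₀ D : ℕ → Bool)
    (D-size : count M D ≡ q) (heavy : ∀ u → u < M → D u ≡ true → D₁ ≤ deg V₀ u) where

    G : ℕ → ℕ → ℕ
    G v w = count M (λ u → D u ∧ T u v w)

    G≤Δ : ∀ v w → G v w ≤ Δ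
    G≤Δ v w = ≤-trans (count-mono M (λ u _ h → proj₂ (∧-true {D u} h))) (codegree₃ v w)

    degG : (ℕ → Bool) → ℕ → ℕ
    degG V v = ∑ M λ w → ⟦ V w ⟧ * G v w

    removed : (ℕ → Bool) → ℕ
    removed V = count M (λ v → V₀ v ∧ not (V v))

    V₀-split : ∀ V → Sub M V V₀ → count M V₀ ≡ count M V + removed V
    V₀-split V sub = trans (∑-cong M (λ v v<M → pointwise (V₀ v) (V v) (sub v v<M))) (∑-+ M _ _)
      where
      pointwise : ∀ a b → (b ≡ true → a ≡ true) → ⟦ a ⟧ ≡ ⟦ b ⟧ + ⟦ a ∧ not b ⟧
      pointwise true  true  _ = refl
      pointwise true  false _ = refl
      pointwise false true  h = contradiction (h refl) λ ()
      pointwise false false _ = refl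

    -- A removed vertex destroys at most `Δ` edges at `u` in the second slot and at most `Δ` in the
    -- third.
    deg-loss : ∀ V u → deg V₀ u ≤ deg V u + 2 * Δ * removed V
    deg-loss V u = begin
      deg V₀ u
        ≤⟨ ∑-mono M (λ v _ → ∑-mono M (λ w _ → pointwise (V₀ v) (V₀ w) (V v) (V w) (T u v w))) ⟩
      ∑ M (λ v → ∑ M λ w → ⟦ V v ∧ V w ∧ T u v w ⟧ + (⟦ R v ⟧ * ⟦ T u v w ⟧ + ⟦ R w ⟧ * ⟦ T u v w ⟧))
        ≡⟨ trans (∑-cong M (λ v _ → trans (∑-+ M _ _) (cong (∑ M (λ w → ⟦ V v ∧ V w ∧ T u v w ⟧) +_) (∑-+ M _ _))))
             (trans (∑-+ M _ _) (cong (deg V u +_) (∑-+ M _ _))) ⟩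
      deg V u + (∑ M (λ v → ∑ M λ w → ⟦ R v ⟧ * ⟦ T u v w ⟧) + ∑ M (λ v → ∑ M λ w → ⟦ R w ⟧ * ⟦ T u v w ⟧))
        ≤⟨ +-monoʳ-≤ (deg V u) (+-mono-≤
             (≤-trans (∑-mono M (λ v _ → ≤-trans (≤-reflexive (∑-* M ⟦ R v ⟧ _)) (*-monoʳ-≤ ⟦ R v ⟧ (codegree₁ u v)))) sum-R)
             (≤-trans (≤-reflexive (∑-swap M M _)) (≤-trans (∑-mono M (λ w _ → ≤-trans (≤-reflexive (∑-* M ⟦ R w ⟧ _))
               (*-monoʳ-≤ ⟦ R w ⟧ (codegree₂ u w)))) sum-R))) ⟩
      deg V u + (Δ * removed V + Δ * removed V)
        ≡⟨ cong (deg V u +_) (double Δ (removed V)) ⟩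
      deg V u + 2 * Δ * removed V ∎
      where
      R : ℕ → Bool
      R v = V₀ v ∧ not (V v)
      double : ∀ c r → c * r + c * r ≡ 2 * c * r
      double = solve-∀
      sum-R : ∑ M (λ v → ⟦ R v ⟧ * Δ) ≤ Δ * removed V
      sum-R = ≤-reflexive (trans (∑-*ʳ M _ Δ) (*-comm (removed V) Δ))
      pointwise : ∀ a b a′ b′ t → ⟦ a ∧ b ∧ t ⟧ ≤ ⟦ a′ ∧ b′ ∧ t ⟧ + (⟦ a ∧ not a′ ⟧ * ⟦ t ⟧ + ⟦ b ∧ not b′ ⟧ * ⟦ t ⟧)
      pointwise false b     a′    b′    t     = z≤n
      pointwise true  false a′    b′    t     = z≤n
      pointwise true  true  a′    b′    false = z≤n
      pointwise true  true  true  true  true  = s≤s z≤n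
      pointwise true  true  true  false true  = s≤s z≤n
      pointwise true  true  false b′    true  = s≤s z≤n

    degree-sum : ∀ V → ∑ M (λ u → ⟦ D u ⟧ * deg V u) ≡ ∑ M (λ v → ⟦ V v ⟧ * degG V v)
    degree-sum V = begin-equality
      ∑ M (λ u → ⟦ D u ⟧ * deg V u)
        ≡⟨ ∑-cong M (λ u _ → trans (∑-cong M (λ v _ → ∑-* M ⟦ D u ⟧ _)) (∑-* M ⟦ D u ⟧ _)) ⟨
      ∑ M (λ u → ∑ M λ v → ∑ M λ w → ⟦ D u ⟧ * ⟦ V v ∧ V w ∧ T u v w ⟧)
        ≡⟨ trans (∑-swap M M _) (∑-cong M (λ v _ → trans (∑-swap M M _)
             (∑-cong M (λ w _ → ∑-cong M (λ u _ → regroup (D u) (V v) (V w) (T u v w)))))) ⟩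
      ∑ M (λ v → ∑ M λ w → ∑ M λ u → ⟦ V v ⟧ * (⟦ V w ⟧ * ⟦ D u ∧ T u v w ⟧))
        ≡⟨ ∑-cong M (λ v _ → trans (∑-cong M (λ w _ → trans (∑-* M ⟦ V v ⟧ _) (cong (⟦ V v ⟧ *_) (∑-* M ⟦ V w ⟧ _))))
             (∑-* M ⟦ V v ⟧ _)) ⟩
      ∑ M (λ v → ⟦ V v ⟧ * degG V v) ∎
      where
      regroup : ∀ d a b t → ⟦ d ⟧ * ⟦ a ∧ b ∧ t ⟧ ≡ ⟦ a ⟧ * (⟦ b ⟧ * ⟦ d ∧ t ⟧)
      regroup true  true  true  t = cong (_+ 0) (sym (trans (+-identityʳ _) refl))
      regroup true  true  false t = refl
      regroup true  false b     t = refl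
      regroup false true  true  t = refl
      regroup false true  false t = refl
      regroup false false b     t = refl

    -- If all link degrees in `V` are below `D₂`, at most half of the total degree `q * D₁` of `D`
    -- survives in `V`. By `deg-loss` the missing half requires at least `D₁ / (4 * Δ)` removed
    -- vertices.
    low-degrees-shrunk : ∀ V → Sub M V V₀ → (∀ v → v < M → (V v ∧ (D₂ ≤ᵇ degG V v)) ≡ false) → Shrunk V₀ V
    low-degrees-shrunk V sub none = finish Δ (count M V) (removed V) D₁ (count M V₀) (V₀-split V sub)
      (*-cancelˡ-≤ q {{>-nonZero 1≤q}} (combine q D₁ (M * D₂) Δ (removed V) 2MD₂≤qD₁ (begin
        q * D₁
          ≡⟨ trans (∑-*ʳ M _ D₁) (cong (_* D₁) D-size) ⟨
        ∑ M (λ u → ⟦ D u ⟧ * D₁)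
          ≤⟨ ∑-mono M (λ u u<M → weigh (D u) (λ h → ≤-trans (heavy u u<M h) (deg-loss V u))) ⟩
        ∑ M (λ u → ⟦ D u ⟧ * (deg V u + 2 * Δ * removed V))
          ≡⟨ trans (∑-cong M (λ u _ → *-distribˡ-+ ⟦ D u ⟧ _ _)) (∑-+ M _ _) ⟩
        ∑ M (λ u → ⟦ D u ⟧ * deg V u) + ∑ M (λ u → ⟦ D u ⟧ * (2 * Δ * removed V))
          ≡⟨ cong₂ _+_ (degree-sum V) (trans (∑-*ʳ M _ (2 * Δ * removed V)) (cong (_* (2 * Δ * removed V)) D-size)) ⟩
        ∑ M (λ v → ⟦ V v ⟧ * degG V v) + q * (2 * Δ * removed V)
          ≤⟨ +-monoˡ-≤ _ (∑-bound M D₂ small) ⟩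
        M * D₂ + q * (2 * Δ * removed V) ∎)))
      where
      weigh : ∀ b {x y} → (b ≡ true → x ≤ y) → ⟦ b ⟧ * x ≤ ⟦ b ⟧ * y
      weigh true  h = *-monoʳ-≤ 1 (h refl)
      weigh false h = z≤n
      small : ∀ v → v < M → ⟦ V v ⟧ * degG V v ≤ D₂
      small v v<M with V v | none v v<M
      ... | false | _ = z≤n
      ... | true  | e with D₂ ≤? degG V v
      ...   | yes ≤d = contradiction (≤ᵇ-intro ≤d) (λ e′ → true≢false e′ e)
      ...   | no ≰d  = ≤-trans (≤-reflexive (+-identityʳ _)) (<⇒≤ (≰⇒> ≰d))
      combine : ∀ q d m c r → 2 * m ≤ q * d → q * d ≤ m + q * (2 * c * r) → q * d ≤ q * (4 * c * r)
      combine q d m c r h₁ h₂ = lin 0 (h₁ ⊕ 2 ⊛ h₂) (identity q d m c r)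
        where
        identity : ∀ q d m c r → q * d + (q * d + 2 * (m + q * (2 * c * r))) + 0 ≡ q * (4 * c * r) + (2 * m + 2 * (q * d))
        identity = solve-∀
      finish : ∀ c v r d v₀ → v₀ ≡ v + r → d ≤ 4 * c * r → 4 * c * v + d ≤ 4 * c * v₀
      finish c v r d _ refl h = ≤-trans (+-monoʳ-≤ (4 * c * v) h) (≤-reflexive (sym (*-distribˡ-+ (4 * c) v r)))

    Inside : (ℕ → Bool) → (ℕ → Bool) → Set
    Inside V I = Ok I × Sub M D I × Sub M I V

    delete : (ℕ → Bool) → ℕ → ℕ → Bool
    delete V v w = V w ∧ not (w ≡ᵇ v)

    delete-size : ∀ V v f → v < M → V v ≡ true → count M V ≤ suc f → count M (delete V v) ≤ f
    delete-size V v f v<M Vv le = s≤s⁻¹ (≤-trans (≤-trans (≤-reflexive (trans (+-comm 1 _)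
        (trans (cong (count M (delete V v) +_) (sym (count-≡ᵇ v<M))) (sym (∑-+ M _ _)))))
        (∑-mono M (λ w _ → pointwise w))) le)
      where
      pointwise : ∀ w → ⟦ V w ∧ not (w ≡ᵇ v) ⟧ + ⟦ w ≡ᵇ v ⟧ ≤ ⟦ V w ⟧
      pointwise w with w ≡ᵇ v in eq
      ... | true rewrite ≡ᵇ-elim w v eq | Vv = s≤s z≤n
      ... | false with V w
      ...   | true  = s≤s z≤n
      ...   | false = z≤n

    isolate : (ℕ → Bool) → ℕ → ℕ → Bool
    isolate V v w = V w ∧ (G v w ≡ᵇ 0)

    -- The weight `D₂` at `v` is spread over neighbours of weight at most `Δ`, so at least `D₂ / Δ`
    -- of them go.
    isolate-size : ∀ V v → D₂ ≤ degG V v → Δ * count M (isolate V v) + D₂ ≤ Δ * count M V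
    isolate-size V v D₂≤ = begin
      Δ * count M (isolate V v) + D₂
        ≤⟨ +-monoʳ-≤ _ D₂≤ ⟩
      Δ * count M (isolate V v) + degG V v
        ≡⟨ trans (∑-+ M _ _) (cong (_+ degG V v) (∑-* M Δ _)) ⟨
      ∑ M (λ w → Δ * ⟦ V w ∧ (G v w ≡ᵇ 0) ⟧ + ⟦ V w ⟧ * G v w)
        ≤⟨ ∑-mono M (λ w _ → pointwise (V w) (G v w) (G≤Δ v w)) ⟩
      ∑ M (λ w → Δ * ⟦ V w ⟧)
        ≡⟨ ∑-* M Δ _ ⟩
      Δ * count M V ∎
      where
      pointwise : ∀ b c → c ≤ Δ → Δ * ⟦ b ∧ (c ≡ᵇ 0) ⟧ + ⟦ b ⟧ * c ≤ Δ * ⟦ b ⟧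
      pointwise false c       _   = ≤-reflexive (+-identityʳ _)
      pointwise true  zero    _   = ≤-reflexive (+-identityʳ _)
      pointwise true  (suc c) c≤Δ = ≤-reflexive′ c≤Δ
        where
        ≤-reflexive′ : suc c ≤ Δ → Δ * 0 + (suc c + 0) ≤ Δ * 1
        ≤-reflexive′ h rewrite *-zeroʳ Δ | +-identityʳ c | *-identityʳ Δ = h

    isolate-covers : ∀ V v → v < M → ∀ I → Inside V I × I v ≡ true → Sub M I (isolate V v)
    isolate-covers V v v<M I ((ok , D⊆I , I⊆V) , Iv) w w<M Iw =
      ∧-intro (I⊆V w w<M Iw) (≡ᵇ-intro (∑-zero M none))
      where
      none : ∀ u → u < M → ⟦ D u ∧ T u v w ⟧ ≡ 0
      none u u<M with D u in Du
      ... | false = refl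
      ... | true  = cong ⟦_⟧ (independent ok u v w u<M v<M w<M (D⊆I u u<M Du) Iv Iw)

    -- The graph container algorithm. A vertex of high degree inside `I` expels its neighbours,
    -- which pays for one unit `4 * D₂` of the deficit in the invariant; one outside `I` is merely
    -- deleted and lowers `f`. At `j = 0` the deficit is paid off.
    shrink : ∀ j f V → count M V ≤ f → Sub M V V₀ →
      4 * Δ * count M V + D₁ ≤ 4 * Δ * count M V₀ + j * (4 * D₂) →
      Cover M (Inside V) (Shrunk V₀) (suc f ^ j)
    shrink zero    f V _  _   inv = cover-one V ≤-refl (≤-trans inv (≤-reflexive (+-identityʳ _))) (λ I φ → proj₂ (proj₂ φ))
    shrink (suc j) f V ≤f sub inv with search M (λ v → V v ∧ (D₂ ≤ᵇ degG V v))
    ... | inj₂ none = cover-one V (m^n>0 (suc f) (suc j)) (low-degrees-shrunk V sub none) (λ I φ → proj₂ (proj₂ φ))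
    shrink (suc j) zero V ≤f sub inv | inj₁ (v , v<M , h) =
      contradiction (≤-trans (≤-reflexive (sym (cong ⟦_⟧ (proj₁ (∧-true h))))) (≤-trans (∑-term M (λ v → ⟦ V v ⟧) v v<M) ≤f)) λ ()
    shrink (suc j) (suc f) V ≤f sub inv | inj₁ (v , v<M , h) = cover-weaken (λ _ → id) id (branching f j)
      (cover-split v
        (cover-weaken (λ I φ → proj₁ (proj₁ φ) , proj₁ (proj₂ (proj₁ φ)) , isolate-covers V v v<M I φ) id ≤-refl
          (shrink j (suc f) (isolate V v)
            (≤-trans (count-mono M (λ w _ → proj₁ ∘ ∧-true)) ≤f)
            (λ w w<M e → sub w w<M (proj₁ (∧-true e)))
            (combine Δ (count M (isolate V v)) (count M V) (count M V₀) D₁ D₂ j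
              (isolate-size V v (≤ᵇ-elim D₂ _ (proj₂ (∧-true {V v} h)))) inv)))
        (cover-weaken (λ I φ → proj₁ (proj₁ φ) , proj₁ (proj₂ (proj₁ φ)) , delete-covers I φ) id ≤-refl
          (shrink (suc j) f (delete V v) (delete-size V v f v<M (proj₁ (∧-true h)) ≤f)
            (λ w w<M e → sub w w<M (proj₁ (∧-true e)))
            (≤-trans (+-monoˡ-≤ D₁ (*-monoʳ-≤ (4 * Δ) (count-mono M (λ w _ → proj₁ ∘ ∧-true)))) inv))))
      where
      combine : ∀ c v′ v v₀ d₁ d₂ j → c * v′ + d₂ ≤ c * v → 4 * c * v + d₁ ≤ 4 * c * v₀ + suc j * (4 * d₂) →
        4 * c * v′ + d₁ ≤ 4 * c * v₀ + j * (4 * d₂)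
      combine c v′ v v₀ d₁ d₂ j h₁ h₂ = lin 0 (4 ⊛ h₁ ⊕ h₂) (identity c v′ v v₀ d₁ d₂ j)
        where
        identity : ∀ c v′ v v₀ d₁ d₂ j → 4 * c * v′ + d₁ + (4 * (c * v) + (4 * c * v₀ + suc j * (4 * d₂))) + 0
          ≡ 4 * c * v₀ + j * (4 * d₂) + (4 * (c * v′ + d₂) + (4 * c * v + d₁))
        identity = solve-∀
      delete-covers : ∀ I → Inside V I × I v ≡ false → Sub M I (delete V v)
      delete-covers I ((_ , _ , I⊆V) , Iv) w w<M Iw = ∧-intro (I⊆V w w<M Iw) (cong not (≡ᵇ-false w≢v))
        where
        w≢v : w ≢ v
        w≢v refl = true≢false Iw Iv

  module Fingerprint (V₀ : ℕ → Bool) where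

    H : ℕ → Bool
    H u = V₀ u ∧ (D₁ ≤ᵇ deg V₀ u)

    -- The scan runs downwards through the vertices: heavy vertices of `I` at `k` or above are
    -- already recorded in `D`.
    Picked : ℕ → (ℕ → Bool) → (ℕ → Bool) → Set
    Picked k D I = (Ok I × Sub M D I × Sub M I V₀) × (∀ u → k ≤ u → u < M → H u ≡ true → I u ≡ true → D u ≡ true)

    deg-bound : ∀ V u → deg V u ≤ M * Δ
    deg-bound V u = ∑-bound M Δ (λ v _ → ≤-trans (count-mono M (λ w _ h → proj₂ (∧-true {V w} (proj₂ (∧-true {V v} h))))) (codegree₁ u v))

    deg-mono : ∀ {V V′} → (∀ v → V v ≡ true → V′ v ≡ true) → ∀ u → deg V u ≤ deg V′ u
    deg-mono {V} {V′} V⊆V′ u = ∑-mono M (λ v _ → ∑-mono M (λ w _ → ⟦⟧-mono (λ e →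
      let a , bc = ∧-true {V v} e ; b , c = ∧-true {V w} bc in ∧-intro (V⊆V′ v a) (∧-intro (V⊆V′ w b) c))))

    -- When the scan ends with fewer than `q` picks, `I` consists of light vertices and recorded
    -- ones. The former have degree at most `D₁`, the latter are few.
    lightened : (ℕ → Bool) → ℕ → Bool
    lightened D u = V₀ u ∧ (not (H u) ∨ D u)

    lightened-sparse : ∀ D → count M D ≤ q → Sparse (lightened D)
    lightened-sparse D D≤q = begin
      edges (lightened D)
        ≤⟨ ∑-mono M (λ u _ → pointwise u) ⟩
      ∑ M (λ u → D₁ + ⟦ D u ⟧ * (M * Δ))
        ≡⟨ trans (∑-+ M (λ _ → D₁) _) (cong₂ _+_ (∑-const M D₁) (∑-*ʳ M _ (M * Δ))) ⟩
      M * D₁ + count M D * (M * Δ)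
        ≤⟨ +-monoʳ-≤ (M * D₁) (*-monoˡ-≤ (M * Δ) D≤q) ⟩
      M * D₁ + q * (M * Δ) ∎
      where
      cases : ∀ a b t x → x ≤ M * Δ → (t ≡ false → x ≤ D₁) → ⟦ a ∧ (not (a ∧ t) ∨ b) ⟧ * x ≤ D₁ + ⟦ b ⟧ * (M * Δ)
      cases false b     t     x _ _  = z≤n
      cases true  true  t     x h _  = ≤-trans (≤-trans (*-monoˡ-≤ x (⟦⟧≤1 (not t ∨ true))) (*-monoʳ-≤ 1 h)) (m≤n+m _ D₁)
      cases true  false true  x _ _  = z≤n
      cases true  false false x _ h′ = ≤-trans (≤-trans (≤-reflexive (*-identityˡ x)) (h′ refl)) (m≤m+n D₁ _)
      light : ∀ u → (D₁ ≤ᵇ deg V₀ u) ≡ false → deg V₀ u ≤ D₁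
      light u e with D₁ ≤? deg V₀ u
      ... | yes D₁≤ = contradiction (≤ᵇ-intro D₁≤) (λ e′ → true≢false e′ e)
      ... | no D₁≰  = <⇒≤ (≰⇒> D₁≰)
      pointwise : ∀ u → ⟦ lightened D u ⟧ * deg (lightened D) u ≤ D₁ + ⟦ D u ⟧ * (M * Δ)
      pointwise u = cases (V₀ u) (D u) (D₁ ≤ᵇ deg V₀ u) (deg (lightened D) u) (deg-bound (lightened D) u)
        (λ e → ≤-trans (deg-mono {lightened D} {V₀} (λ v e → proj₁ (∧-true e)) u) (light u e))

    insert : (ℕ → Bool) → ℕ → ℕ → Bool
    insert D k u = D u ∨ (u ≡ᵇ k)

    insert-size : ∀ D k → k < M → D k ≡ false → count M (insert D k) ≡ suc (count M D)
    insert-size D k k<M Dk = trans (∑-cong M (λ u _ → pointwise u)) (trans (∑-+ M _ _)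
      (trans (cong (count M D +_) (count-≡ᵇ k<M)) (+-comm _ 1)))
      where
      pointwise : ∀ u → ⟦ D u ∨ (u ≡ᵇ k) ⟧ ≡ ⟦ D u ⟧ + ⟦ u ≡ᵇ k ⟧
      pointwise u with u ≡ᵇ k in eq
      ... | true rewrite ≡ᵇ-elim u k eq | Dk = refl
      ... | false with D u
      ...   | true  = refl
      ...   | false = refl

    Outcome : (ℕ → Bool) → Set
    Outcome V = Sparse V ⊎ Shrunk V₀ V

    -- `j` picks are still to be made. At `j = 0` the recorded set `D` has `q` heavy vertices and
    -- its link graph takes over; at `k = 0` the scan is finished and `lightened` is the container.
    pick : ∀ k j D → count M D + j ≡ q → k ≤ M → (∀ u → u < M → D u ≡ true → k ≤ u × D₁ ≤ deg V₀ u) →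
      Cover M (Picked k D) Outcome (suc k ^ j * suc M ^ j₀)
    pick k zero D size k≤M heavy = cover-weaken (λ I φ → proj₁ φ) inj₂ (≤-reflexive (sym (+-identityʳ _)))
      (LinkGraph.shrink V₀ D (trans (sym (+-identityʳ _)) size) (λ u u<M Du → proj₂ (heavy u u<M Du))
        j₀ M V₀ (count≤ M V₀) (λ _ _ → id) (+-monoʳ-≤ _ D₁≤j₀))
    pick zero (suc j) D size k≤M heavy = cover-one (lightened D) (*-mono-≤ (m^n>0 1 (suc j)) (m^n>0 (suc M) j₀))
      (inj₁ (lightened-sparse D (≤-trans (m≤m+n _ (suc j)) (≤-reflexive size)))) contained
      where
      contained : ∀ I → Picked 0 D I → Sub M I (lightened D)
      contained I ((ok , D⊆I , I⊆V₀) , all) u u<M Iu with H u in Hu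
      ... | false = ∧-intro (I⊆V₀ u u<M Iu) refl
      ... | true  = ∧-intro (I⊆V₀ u u<M Iu) (all u z≤n u<M Hu Iu)
    pick (suc k) (suc j) D size k<M heavy with H k in Hk
    ... | false = cover-weaken skip-k id (*-monoˡ-≤ (suc M ^ j₀) (^-monoˡ-≤ (suc j) (n≤1+n (suc k))))
        (pick k (suc j) D size (<⇒≤ k<M) (λ u u<M Du → let a , b = heavy u u<M Du in <⇒≤ a , b))
      where
      skip-k : ∀ I → Picked (suc k) D I → Picked k D I
      skip-k I (φ , all) = φ , λ u k≤u u<M Hu Iu → case m≤n⇒m<n∨m≡n k≤u of λ
        { (inj₁ k<u) → all u k<u u<M Hu Iu ; (inj₂ refl) → ⊥-elim (true≢false Hu Hk) }
    ... | true = cover-weaken (λ _ → id) id (≤-trans (≤-reflexive (sym (*-distribʳ-+ (suc M ^ j₀) (suc (suc k) ^ j) (suc k ^ suc j))))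
          (*-monoˡ-≤ (suc M ^ j₀) (branching k j)))
        (cover-split k
          (cover-weaken add-k id (*-monoˡ-≤ (suc M ^ j₀) (^-monoˡ-≤ j (n≤1+n (suc k))))
            (pick k j (insert D k) (trans (cong (_+ j) (insert-size D k k<M Dk)) (trans (sym (+-suc _ j)) size)) (<⇒≤ k<M) heavy′))
          (cover-weaken drop-k id ≤-refl
            (pick k (suc j) D size (<⇒≤ k<M) (λ u u<M Du → let a , b = heavy u u<M Du in <⇒≤ a , b))))
      where
      Dk : D k ≡ false
      Dk with D k in e
      ... | false = refl
      ... | true  = contradiction (proj₁ (heavy k k<M e)) (<-irrefl refl)
      heavy′ : ∀ u → u < M → insert D k u ≡ true → k ≤ u × D₁ ≤ deg V₀ u
      heavy′ u u<M e with ∨-true {D u} e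
      ... | inj₁ Du = let a , b = heavy u u<M Du in <⇒≤ a , b
      ... | inj₂ u≡k rewrite ≡ᵇ-elim u k u≡k = ≤-refl , ≤ᵇ-elim D₁ _ (proj₂ (∧-true {V₀ k} Hk))
      add-k : ∀ I → Picked (suc k) D I × I k ≡ true → Picked k (insert D k) I
      add-k I (((ok , D⊆I , I⊆V₀) , all) , Ik) = (ok , sub , I⊆V₀) , all′
        where
        sub : Sub M (insert D k) I
        sub u u<M e with ∨-true {D u} e
        ... | inj₁ Du = D⊆I u u<M Du
        ... | inj₂ u≡k rewrite ≡ᵇ-elim u k u≡k = Ik
        all′ : ∀ u → k ≤ u → u < M → H u ≡ true → I u ≡ true → insert D k u ≡ true
        all′ u k≤u u<M Hu Iu with m≤n⇒m<n∨m≡n k≤u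
        ... | inj₁ k<u  = ∨-introˡ _ (all u k<u u<M Hu Iu)
        ... | inj₂ refl = ∨-introʳ (D u) (≡ᵇ-intro {u} refl)
      drop-k : ∀ I → Picked (suc k) D I × I k ≡ false → Picked k D I
      drop-k I ((φ , all) , Ik) = φ , λ u k≤u u<M Hu Iu → case m≤n⇒m<n∨m≡n k≤u of λ
        { (inj₁ k<u) → all u k<u u<M Hu Iu ; (inj₂ refl) → ⊥-elim (true≢false Iu Ik) }

    round : Cover M (λ I → Ok I × Sub M I V₀) Outcome (suc M ^ (q + j₀))
    round = cover-weaken (λ I (ok , sub) → (ok , (λ _ _ ()) , sub) , λ u M≤u u<M → contradiction M≤u (<⇒≱ u<M)) id
      (≤-reflexive (sym (^-distribˡ-+-* (suc M) q j₀)))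
      (pick M q (λ _ → false) (cong (_+ q) (∑-zero M (λ _ _ → refl))) ≤-refl (λ _ _ ()))

  -- A round that does not end in a sparse container lowers `4 * Δ * count M V₀` by at least `D₁`,
  -- which bounds the number of rounds; for `R = 0` the hypothesis is absurd.
  rounds : ∀ R V₀ → 4 * Δ * count M V₀ < R * D₁ →
    Cover M (λ I → Ok I × Sub M I V₀) Sparse ((suc M ^ (q + j₀)) ^ R)
  rounds (suc R) V₀ lt = cover-refine {N′ = (suc M ^ (q + j₀)) ^ R} refine (Fingerprint.round V₀)
    where
    1≤ : 1 ≤ (suc M ^ (q + j₀)) ^ R
    1≤ = m^n>0 (suc M ^ (q + j₀)) {{m^n≢0 (suc M) (q + j₀)}} R
    refine : ∀ V → Fingerprint.Outcome V₀ V →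
      Cover M (λ I → (Ok I × Sub M I V₀) × Sub M I V) Sparse ((suc M ^ (q + j₀)) ^ R)
    refine V (inj₁ sparse) = cover-one V 1≤ sparse (λ I → proj₂)
    refine V (inj₂ shrunk) = cover-weaken (λ I ((ok , _) , sub) → ok , sub) id ≤-refl
      (rounds R V (+-cancelʳ-< D₁ _ _ (≤-trans (s≤s shrunk) (≤-trans lt (≤-reflexive (+-comm D₁ _))))))

  containers : ∀ R → 4 * Δ * M < R * D₁ → Cover M Ok Sparse ((suc M ^ (q + j₀)) ^ R)
  containers R lt = cover-weaken (λ I ok → ok , λ _ _ _ → refl) id ≤-refl
    (rounds R (λ _ → true) (≤-<-trans (*-monoʳ-≤ (4 * Δ) (count≤ M _)) lt))

-- The hypergraph of rainbow progressions

count-≡ᵇ-≤ : ∀ n c → count n (λ x → x ≡ᵇ c) ≤ 1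
count-≡ᵇ-≤ zero    c       = z≤n
count-≡ᵇ-≤ (suc n) zero    = s≤s (≤-reflexive (∑-zero n (λ _ _ → refl)))
count-≡ᵇ-≤ (suc n) (suc c) = count-≡ᵇ-≤ n c

≡ᵇ-sym : ∀ m n → (m ≡ᵇ n) ≡ (n ≡ᵇ m)
≡ᵇ-sym zero    zero    = refl
≡ᵇ-sym zero    (suc n) = refl
≡ᵇ-sym (suc m) zero    = refl
≡ᵇ-sym (suc m) (suc n) = ≡ᵇ-sym m n

distinct : ℕ → ℕ → ℕ → Bool
distinct p q s = not (p ≡ᵇ q) ∧ not (q ≡ᵇ s) ∧ not (p ≡ᵇ s)

distinct-intro : ∀ {p q s} → p ≢ q → q ≢ s → p ≢ s → distinct p q s ≡ true
distinct-intro a b c = ∧-intro (cong not (≡ᵇ-false a)) (∧-intro (cong not (≡ᵇ-false b)) (cong not (≡ᵇ-false c)))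

distinct-elim : ∀ p q s → distinct p q s ≡ true → p ≢ q × q ≢ s × p ≢ s
distinct-elim p q s e with ∧-true {not (p ≡ᵇ q)} e
... | a , e′ with ∧-true {not (q ≡ᵇ s)} e′
...   | b , c = not-≡ᵇ a , not-≡ᵇ b , not-≡ᵇ c

-- The vertex p * n + x stands for the element x of ℤₙ having colour p.
module Rainbow (r n : ℕ) {{_ : NonZero n}} where

  M : ℕ
  M = r * n

  position : ∀ p x → x < n → (p * n + x) % n ≡ x
  position p x x<n = trans (cong (_% n) (+-comm (p * n) x)) (trans ([m+kn]%n≡m%n x p n) (m<n⇒m%n≡m x<n))

  colour-of : ∀ p x → x < n → (p * n + x) / n ≡ p
  colour-of p x x<n = trans (+-distrib-/-∣ˡ x (n∣m*n p)) (trans (cong₂ _+_ (m*n/n≡m p n) (m<n⇒m/n≡0 x<n)) (+-identityʳ p))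

  vertex<M : ∀ {p x} → p < r → x < n → p * n + x < M
  vertex<M {p} {x} p<r x<n = <-≤-trans (+-monoʳ-< (p * n) x<n) (≤-trans (≤-reflexive (+-comm (p * n) n)) (*-monoˡ-≤ n p<r))

  progression : ℕ → ℕ → ℕ → Bool
  progression a b c = (b * 2) % n ≡ᵇ (a + c) % n

  -- The three positions may coincide: three colours at one point also form an edge.
  rainbow : ℕ → ℕ → ℕ → Bool
  rainbow u v w = progression (u % n) (v % n) (w % n) ∧ distinct (u / n) (v / n) (w / n)

  ∑-positions : ∀ f → ∑ M (λ w → f (w % n)) ≡ r * ∑ n f
  ∑-positions f = trans (∑-blocks r n _) (trans (∑-cong r (λ p _ → ∑-cong n (λ x x<n → cong f (position p x x<n)))) (∑-const r _))

  hits : ∀ k → count n (λ x → k ≡ᵇ x % n) ≤ 1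
  hits k = ≤-trans (≤-reflexive (trans (∑-% n (λ x → ⟦ k ≡ᵇ x ⟧)) (∑-cong n (λ x _ → cong ⟦_⟧ (≡ᵇ-sym k x))))) (count-≡ᵇ-≤ n k)

  translated-hits : ∀ k a → ∑ n (λ x → ⟦ k ≡ᵇ (a + x) % n ⟧) ≤ 1
  translated-hits k a = ≤-trans (≤-reflexive (∑-periodic-shift n a _ (periodic-% n (λ x → ⟦ k ≡ᵇ x ⟧)))) (hits k)

  -- The doubles lie in two periods; for even `n` two endpoints can indeed have two midpoints.
  doubled-hits : ∀ k → ∑ n (λ x → ⟦ (x * 2) % n ≡ᵇ k ⟧) ≤ 2
  doubled-hits k = begin
    ∑ n (λ x → ⟦ (x * 2) % n ≡ᵇ k ⟧)
      ≡⟨ ∑-cong n (λ x _ → cong ⟦_⟧ (≡ᵇ-sym ((x * 2) % n) k)) ⟩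
    ∑ n (λ x → ⟦ k ≡ᵇ (x * 2) % n ⟧)
      ≤⟨ ∑-dilate n 2 (λ z → ⟦ k ≡ᵇ z % n ⟧) ⟩
    ∑ (n * 2) (λ z → ⟦ k ≡ᵇ z % n ⟧)
      ≡⟨ cong (λ l → ∑ l (λ z → ⟦ k ≡ᵇ z % n ⟧)) (*-comm n 2) ⟩
    ∑ (2 * n) (λ z → ⟦ k ≡ᵇ z % n ⟧)
      ≡⟨ ∑-periods n 2 _ (periodic-% n (λ x → ⟦ k ≡ᵇ x ⟧)) ⟩
    2 * ∑ n (λ z → ⟦ k ≡ᵇ z % n ⟧)
      ≤⟨ *-monoʳ-≤ 2 (hits k) ⟩
    2 ∎

  codegree : ∀ (A P : ℕ → Bool) b → (∀ w → A w ≡ true → P (w % n) ≡ true) → count n P ≤ b → b ≤ 2 → count M A ≤ r * 2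
  codegree A P b imp P≤b b≤2 = ≤-trans (count-mono M (λ w _ → imp w))
    (≤-trans (≤-reflexive (∑-positions (λ x → ⟦ P x ⟧))) (*-monoʳ-≤ r (≤-trans P≤b b≤2)))

  codegree₁ : ∀ u v → count M (rainbow u v) ≤ r * 2
  codegree₁ u v = codegree (rainbow u v) (λ x → (v % n * 2) % n ≡ᵇ (u % n + x) % n) 1
    (λ w e → proj₁ (∧-true e)) (translated-hits ((v % n * 2) % n) (u % n)) (s≤s z≤n)

  codegree₂ : ∀ u w → count M (λ v → rainbow u v w) ≤ r * 2
  codegree₂ u w = codegree (λ v → rainbow u v w) (λ x → (x * 2) % n ≡ᵇ (u % n + w % n) % n) 2
    (λ v e → proj₁ (∧-true e)) (doubled-hits _) ≤-refl

  codegree₃ : ∀ v w → count M (λ u → rainbow u v w) ≤ r * 2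
  codegree₃ v w = codegree (λ u → rainbow u v w) (λ x → (v % n * 2) % n ≡ᵇ (w % n + x) % n) 1
    (λ u e → trans (cong (λ z → (v % n * 2) % n ≡ᵇ z % n) (+-comm (w % n) (u % n))) (proj₁ (∧-true e)))
    (translated-hits ((v % n * 2) % n) (w % n)) (s≤s z≤n)

  rainbow-intro : ∀ {p q s} x d → x < n → distinct p q s ≡ true →
    rainbow (p * n + x) (q * n + (x + d) % n) (s * n + (x + 2 * d) % n) ≡ true
  rainbow-intro {p} {q} {s} x d x<n dist
    rewrite position p x x<n | position q ((x + d) % n) (m%n<n (x + d) n) | position s ((x + 2 * d) % n) (m%n<n (x + 2 * d) n)
          | colour-of p x x<n | colour-of q ((x + d) % n) (m%n<n (x + d) n) | colour-of s ((x + 2 * d) % n) (m%n<n (x + 2 * d) n)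
    = ∧-intro (≡ᵇ-intro middle) dist
    where
    double : ∀ a → a * 2 ≡ a + a
    double = solve-∀
    regroup : ∀ x d → x + d + (x + d) ≡ x + (x + 2 * d)
    regroup = solve-∀
    middle : ((x + d) % n * 2) % n ≡ (x + (x + 2 * d) % n) % n
    middle = begin-equality
      ((x + d) % n * 2) % n ≡⟨ cong (_% n) (double ((x + d) % n)) ⟩
      ((x + d) % n + (x + d) % n) % n ≡⟨ %-distribˡ-+ (x + d) (x + d) n ⟨
      (x + d + (x + d)) % n ≡⟨ cong (_% n) (regroup x d) ⟩
      (x + (x + 2 * d)) % n ≡⟨ %-distribˡ-+ x (x + 2 * d) n ⟩
      (x % n + (x + 2 * d) % n) % n ≡⟨ cong (λ z → (z + (x + 2 * d) % n) % n) (m<n⇒m%n≡m x<n) ⟩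
      (x + (x + 2 * d) % n) % n ∎

  edges : (ℕ → Bool) → ℕ
  edges V = ∑ M λ u → ⟦ V u ⟧ * ∑ M λ v → ∑ M λ w → ⟦ V v ∧ V w ∧ rainbow u v w ⟧

  palette : (ℕ → Bool) → ℕ → ℕ → Bool
  palette V x p = V (p * n + x)

  Transversal : (ℕ → Bool) → (ℕ → Bool) → (ℕ → Bool) → Set
  Transversal P Q S = ∃[ p ] ∃[ q ] ∃[ s ] (p < r × P p ≡ true) × (q < r × Q q ≡ true) × (s < r × S s ≡ true)
    × p ≢ q × q ≢ s × p ≢ s

  -- One edge is chosen for each pair `d`, `x`. The positions `x` and `x + d` of its first two
  -- vertices give the pair back, so no edge is chosen twice.
  rainbow-count : ∀ V (Z : ℕ → ℕ → Bool) →
    (∀ d x → Z d x ≡ true → x < n → Transversal (palette V x) (palette V ((x + d) % n)) (palette V ((x + 2 * d) % n))) →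
    ∑ n (λ d → ∑ n λ x → ⟦ Z d x ⟧) ≤ edges V
  rainbow-count V Z transversal = begin
    ∑ n (λ d → ∑ n λ x → ⟦ Z d x ⟧)
      ≡⟨ ∑-swap n n _ ⟩
    ∑ n (λ x → ∑ n λ d → ⟦ Z d x ⟧)
      ≤⟨ ∑-mono n (λ x x<n → ∑-mono n (λ d _ → found x x<n d)) ⟩
    ∑ n (λ x → ∑ n λ d → h x ((x + d) % n))
      ≡⟨ ∑-cong n (λ x _ → ∑-cyclic n x (h x)) ⟩
    ∑ n (λ x → ∑ n λ y → ∑ r λ p → ∑ r λ q → W (p * n + x) (q * n + y))
      ≡⟨ ∑-cong n (λ x _ → trans (∑-swap n r _) (∑-cong r (λ p _ → ∑-swap n r _))) ⟩
    ∑ n (λ x → ∑ r λ p → ∑ r λ q → ∑ n λ y → W (p * n + x) (q * n + y))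
      ≡⟨ ∑-swap n r _ ⟩
    ∑ r (λ p → ∑ n λ x → ∑ r λ q → ∑ n λ y → W (p * n + x) (q * n + y))
      ≡⟨ trans (∑-blocks r n _) (∑-cong r (λ p _ → ∑-cong n (λ x _ → ∑-blocks r n _))) ⟨
    ∑ M (λ u → ∑ M λ v → W u v)
      ≡⟨ ∑-cong M (λ u _ → trans (∑-cong M (λ v _ → ∑-* M ⟦ V u ⟧ _)) (∑-* M ⟦ V u ⟧ _)) ⟩
    edges V ∎
    where
    W : ℕ → ℕ → ℕ
    W u v = ∑ M λ w → ⟦ V u ⟧ * ⟦ V v ∧ V w ∧ rainbow u v w ⟧
    h : ℕ → ℕ → ℕ
    h x y = ∑ r λ p → ∑ r λ q → W (p * n + x) (q * n + y)
    found : ∀ x → x < n → ∀ d → ⟦ Z d x ⟧ ≤ h x ((x + d) % n)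
    found x x<n d with Z d x in Zdx
    ... | false = z≤n
    ... | true with transversal d x Zdx x<n
    ...   | p , q , s , (p<r , Vp) , (q<r , Vq) , (s<r , Vs) , p≢q , q≢s , p≢s = begin
      1
        ≡⟨ cong₂ (λ a b → ⟦ a ⟧ * ⟦ b ⟧) Vp (∧-intro Vq (∧-intro Vs (rainbow-intro {p} {q} {s} x d x<n (distinct-intro p≢q q≢s p≢s)))) ⟨
      ⟦ V u ⟧ * ⟦ V v ∧ V w ∧ rainbow u v w ⟧
        ≤⟨ ∑-term M (λ w → ⟦ V u ⟧ * ⟦ V v ∧ V w ∧ rainbow u v w ⟧) w (vertex<M s<r (m%n<n (x + 2 * d) n)) ⟩
      W u v
        ≤⟨ ∑-term r (λ q → W u (q * n + (x + d) % n)) q q<r ⟩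
      ∑ r (λ q → W u (q * n + (x + d) % n))
        ≤⟨ ∑-term r (λ p → ∑ r λ q → W (p * n + x) (q * n + (x + d) % n)) p p<r ⟩
      h x ((x + d) % n) ∎
      where
      u = p * n + x
      v = q * n + (x + d) % n
      w = s * n + (x + 2 * d) % n

  pick-outside : ∀ P F → count r F < count r P → ∃[ p ] (p < r × P p ≡ true) × F p ≡ false
  pick-outside P F lt with search r (λ p → P p ∧ not (F p))
  ... | inj₁ (p , p<r , e) = p , (p<r , proj₁ (∧-true e)) , not-true (proj₂ (∧-true {P p} e))
  ... | inj₂ none = contradiction (count-mono r covered) (<⇒≱ lt)
    where
    covered : ∀ p → p < r → P p ≡ true → F p ≡ true
    covered p p<r Pp with F p in Fp
    ... | true  = refl
    ... | false = ⊥-elim (true≢false (∧-intro Pp (cong not Fp)) (none p p<r))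

  pick-one : ∀ {P} → 1 ≤ count r P → ∃[ p ] p < r × P p ≡ true
  pick-one {P} 1≤c =
    let p , Pp , _ = pick-outside P (λ _ → false) (≤-<-trans (≤-reflexive (∑-zero r (λ _ _ → refl))) 1≤c) in p , Pp

  pick-avoiding : ∀ {P} → 2 ≤ count r P → ∀ a → ∃[ p ] (p < r × P p ≡ true) × p ≢ a
  pick-avoiding {P} 2≤c a =
    let p , Pp , e = pick-outside P (_≡ᵇ a) (≤-trans (s≤s (count-≡ᵇ-≤ r a)) 2≤c) in p , Pp , not-≡ᵇ (cong not e)

  pick-avoiding₂ : ∀ {P} → 3 ≤ count r P → ∀ a b → ∃[ p ] (p < r × P p ≡ true) × p ≢ a × p ≢ b
  pick-avoiding₂ {P} 3≤c a b =
    let p , Pp , e = pick-outside P (λ p → (p ≡ᵇ a) ∨ (p ≡ᵇ b)) (≤-trans (s≤s two) 3≤c)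
        e₁ , e₂ = ∨-false (p ≡ᵇ a) e
    in p , Pp , not-≡ᵇ (cong not e₁) , not-≡ᵇ (cong not e₂)
    where
    ∨-false : ∀ x {y} → x ∨ y ≡ false → x ≡ false × y ≡ false
    ∨-false false e = refl , e
    ∨-≤ : ∀ x y → ⟦ x ∨ y ⟧ ≤ ⟦ x ⟧ + ⟦ y ⟧
    ∨-≤ true  y = s≤s z≤n
    ∨-≤ false y = ≤-refl
    two : count r (λ p → (p ≡ᵇ a) ∨ (p ≡ᵇ b)) ≤ 2
    two = ≤-trans (∑-mono r (λ p _ → ∨-≤ (p ≡ᵇ a) (p ≡ᵇ b))) (≤-trans (≤-reflexive (∑-+ r _ _)) (count-≡ᵇ-≤ r a ⊕ count-≡ᵇ-≤ r b))

  transversal-of-triples : ∀ {P Q S} → 3 ≤ count r P → 3 ≤ count r Q → 3 ≤ count r S → Transversal P Q S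
  transversal-of-triples 3≤P 3≤Q 3≤S =
    let p , Pp = pick-one (≤-trans (s≤s z≤n) 3≤P)
        q , Qq , q≢p , _ = pick-avoiding₂ 3≤Q p p
        s , Ss , s≢p , s≢q = pick-avoiding₂ 3≤S p q
    in p , q , s , Pp , Qq , Ss , q≢p ∘ sym , s≢q ∘ sym , s≢p ∘ sym

  differ : (ℕ → Bool) → (ℕ → Bool) → Bool
  differ P Q = not (count r (λ p → P p xor Q p) ≡ᵇ 0)

  separate : ∀ P Q → differ P Q ≡ true →
    (∃[ p ] p < r × P p ≡ true × Q p ≡ false) ⊎ (∃[ q ] q < r × Q q ≡ true × P q ≡ false)
  separate P Q e with search r (λ p → P p xor Q p)
  ... | inj₁ (p , p<r , x) with P p in Pp | Q p in Qp
  ...   | true  | false = inj₁ (p , p<r , Pp , Qp)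
  ...   | false | true  = inj₂ (p , p<r , Qp , Pp)
  separate P Q e | inj₂ none = ⊥-elim (true≢false e (cong not (≡ᵇ-intro (∑-zero r (λ i i<r → cong ⟦_⟧ (none i i<r))))))

  -- A colour in one of `P`, `Q` but not in the other cannot clash between them. The colour from `S`
  -- is chosen to avoid it, and the last one to avoid the colour from `S`.
  transversal-of-pairs : ∀ {P Q S} → 2 ≤ count r P → 2 ≤ count r Q → 2 ≤ count r S → differ P Q ≡ true → Transversal P Q S
  transversal-of-pairs {P} {Q} {S} 2≤P 2≤Q 2≤S e with separate P Q e
  ... | inj₁ (p , p<r , Pp , Qp) =
    let s , Ss , s≢p = pick-avoiding 2≤S p
        q , Qq , q≢s = pick-avoiding 2≤Q s
    in p , q , s , (p<r , Pp) , Qq , Ss , (λ p≡q → true≢false (proj₂ Qq) (trans (cong Q (sym p≡q)) Qp)) , q≢s , s≢p ∘ sym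
  ... | inj₂ (q , q<r , Qq , Pq) =
    let s , Ss , s≢q = pick-avoiding 2≤S q
        p , Pp , p≢s = pick-avoiding 2≤P s
    in p , q , s , Pp , (q<r , Qq) , Ss , (λ p≡q → true≢false (proj₂ Pp) (trans (cong P p≡q) Pq)) , s≢q ∘ sym , p≢s

-- Palettes in a sparse container

module Templates (r n : ℕ) {{_ : NonZero n}} where

  open Rainbow r n

  choices : (ℕ → Bool) → ℕ → ℕ
  choices V x = count r (palette V x)

  few many : (ℕ → Bool) → ℕ → Bool
  few  V x = choices V x ≤ᵇ 1
  many V x = 3 ≤ᵇ choices V x

  -- Three palettes of three colours always have a transversal. The degenerate progressions in
  -- `apCount` need no exception, since one such palette used three times gives an edge too.
  many-sparse : ∀ V → apCount n (many V) ≤ edges V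
  many-sparse V = rainbow-count V (λ d x → X (x % n) ∧ X ((x + d) % n) ∧ X ((x + 2 * d) % n)) transversal
    where
    X = many V
    transversal : ∀ d x → (X (x % n) ∧ X ((x + d) % n) ∧ X ((x + 2 * d) % n)) ≡ true → x < n →
      Transversal (palette V x) (palette V ((x + d) % n)) (palette V ((x + 2 * d) % n))
    transversal d x e x<n =
      let a , bc = ∧-true {X (x % n)} e
          b , c  = ∧-true {X ((x + d) % n)} bc
      in transversal-of-triples (≤ᵇ-elim 3 _ (subst (λ y → X y ≡ true) (m<n⇒m%n≡m x<n) a)) (≤ᵇ-elim 3 _ b) (≤ᵇ-elim 3 _ c)

  few-false : ∀ V x → few V x ≡ false → 2 ≤ choices V x
  few-false V x e with choices V x ≤? 1
  ... | yes ≤1 = ⊥-elim (true≢false (≤ᵇ-intro ≤1) e)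
  ... | no ≰1  = ≰⇒> ≰1

  deviation : (ℕ → Bool) → ℕ → ℕ
  deviation V x = count n (λ y → differ (palette V x) (palette V y))

  -- If the palettes at `x` and `x + d` differ, then either `x`, `x + d`, `x + 2d` include a point
  -- with few choices, which accounts for the factor 3, or the three points carry an edge. A point
  -- `x` of least deviation does at least as well as the average.
  typical : ∀ V → ∃[ x ] x < n × n * deviation V x ≤ 3 * (n * count n (few V)) + edges V
  typical V =
    let x , x<n , le = ∑-min n (deviation V) (>-nonZero⁻¹ n)
    in x , x<n , ≤-trans le bound
    where
    F : ℕ → Bool
    F = few V
    bad Z : ℕ → ℕ → Bool
    bad d x = differ (palette V x) (palette V ((x + d) % n))
    Z d x = not (F x) ∧ not (F ((x + d) % n)) ∧ not (F ((x + 2 * d) % n)) ∧ bad d x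
    pointwise : ∀ a b c z → ⟦ z ⟧ ≤ ⟦ a ⟧ + ⟦ b ⟧ + ⟦ c ⟧ + ⟦ not a ∧ not b ∧ not c ∧ z ⟧
    pointwise a     b     c     false = z≤n
    pointwise true  b     c     true  = s≤s z≤n
    pointwise false true  c     true  = s≤s z≤n
    pointwise false false true  true  = s≤s z≤n
    pointwise false false false true  = s≤s z≤n
    transversal : ∀ d x → Z d x ≡ true → x < n →
      Transversal (palette V x) (palette V ((x + d) % n)) (palette V ((x + 2 * d) % n))
    transversal d x e x<n =
      let a , e₁ = ∧-true {not (F x)} e
          b , e₂ = ∧-true {not (F ((x + d) % n))} e₁
          c , e₃ = ∧-true {not (F ((x + 2 * d) % n))} e₂
      in transversal-of-pairs (few-false V _ (not-true a)) (few-false V _ (not-true b)) (few-false V _ (not-true c)) e₃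
    translated : ∀ c → ∑ n (λ x → ⟦ F ((x + c) % n) ⟧) ≡ count n F
    translated c = trans (∑-cong n (λ x _ → cong (λ z → ⟦ F (z % n) ⟧) (+-comm x c)))
      (∑-cyclic n c (λ x → ⟦ F x ⟧))
    total : ∀ d → ∑ n (λ x → ⟦ bad d x ⟧) ≤ 3 * count n F + ∑ n (λ x → ⟦ Z d x ⟧)
    total d = begin
      ∑ n (λ x → ⟦ bad d x ⟧)
        ≤⟨ ∑-mono n (λ x _ → pointwise (F x) (F ((x + d) % n)) (F ((x + 2 * d) % n)) (bad d x)) ⟩
      ∑ n (λ x → ⟦ F x ⟧ + ⟦ F ((x + d) % n) ⟧ + ⟦ F ((x + 2 * d) % n) ⟧ + ⟦ Z d x ⟧)
        ≡⟨ trans (∑-+ n _ _) (cong (_+ ∑ n (λ x → ⟦ Z d x ⟧)) (trans (∑-+ n _ _) (cong₂ _+_ (∑-+ n _ _) refl))) ⟩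
      count n F + ∑ n (λ x → ⟦ F ((x + d) % n) ⟧) + ∑ n (λ x → ⟦ F ((x + 2 * d) % n) ⟧) + ∑ n (λ x → ⟦ Z d x ⟧)
        ≡⟨ cong (_+ ∑ n (λ x → ⟦ Z d x ⟧)) (cong₂ _+_ (cong (count n F +_) (translated d)) (translated (2 * d))) ⟩
      count n F + count n F + count n F + ∑ n (λ x → ⟦ Z d x ⟧)
        ≡⟨ cong (_+ ∑ n (λ x → ⟦ Z d x ⟧)) (triple (count n F)) ⟩
      3 * count n F + ∑ n (λ x → ⟦ Z d x ⟧) ∎
      where
      triple : ∀ f → f + f + f ≡ 3 * f
      triple = solve-∀
    bound : ∑ n (deviation V) ≤ 3 * (n * count n F) + edges V
    bound = begin
      ∑ n (λ x → ∑ n λ y → ⟦ differ (palette V x) (palette V y) ⟧)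
        ≡⟨ ∑-cong n (λ x _ → ∑-cyclic n x (f x)) ⟨
      ∑ n (λ x → ∑ n λ d → ⟦ bad d x ⟧)
        ≡⟨ ∑-swap n n _ ⟩
      ∑ n (λ d → ∑ n λ x → ⟦ bad d x ⟧)
        ≤⟨ ∑-mono n (λ d _ → total d) ⟩
      ∑ n (λ d → 3 * count n F + ∑ n (λ x → ⟦ Z d x ⟧))
        ≡⟨ trans (∑-+ n _ _) (cong (_+ ∑ n (λ d → ∑ n λ x → ⟦ Z d x ⟧)) (trans (∑-const n _) (exchange n (count n F)))) ⟩
      3 * (n * count n F) + ∑ n (λ d → ∑ n λ x → ⟦ Z d x ⟧)
        ≤⟨ +-monoʳ-≤ _ (rainbow-count V Z transversal) ⟩
      3 * (n * count n F) + edges V ∎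
      where
      f : ℕ → ℕ → ℕ
      f x y = ⟦ differ (palette V x) (palette V y) ⟧
      exchange : ∀ n f → n * (3 * f) ≡ 3 * (n * f)
      exchange = solve-∀

  agree : ∀ {P Q} → differ P Q ≡ false → ∀ p → p < r → P p ≡ Q p
  agree {P} {Q} e p p<r with count r (λ p → P p xor Q p) in c
  ... | zero with P p | Q p | ≤-trans (∑-term r (λ p → ⟦ P p xor Q p ⟧) p p<r) (≤-reflexive c)
  ...   | true  | true  | _ = refl
  ...   | false | false | _ = refl

  deviating : ∀ V x (X : ℕ → Bool) → (∀ y → choices V y ≡ choices V x → X y ≡ true) → n ≤ deviation V x + count n X
  deviating V x X h = begin
    n ≡⟨ ∑-1 n ⟨
    ∑ n (λ _ → 1) ≤⟨ ∑-mono n (λ y _ → pointwise y) ⟩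
    ∑ n (λ y → ⟦ differ (palette V x) (palette V y) ⟧ + ⟦ X y ⟧) ≡⟨ ∑-+ n _ _ ⟩
    deviation V x + count n X ∎
    where
    pointwise : ∀ y → 1 ≤ ⟦ differ (palette V x) (palette V y) ⟧ + ⟦ X y ⟧
    pointwise y with differ (palette V x) (palette V y) in e
    ... | true  = s≤s z≤n
    ... | false rewrite h y (sym (∑-cong r (λ p p<r → cong ⟦_⟧ (agree {palette V x} {palette V y} e p p<r)))) = s≤s z≤n

  record NearPair (V : ℕ → Bool) (b : ℕ) : Set where
    field
      i j         : ℕ
      i<r         : i < r
      j<r         : j < r
      i≢j         : i ≢ j
      exceptional : ℕ → Bool
      exceptions  : count n exceptional ≤ b
      within      : ∀ y → y < n → exceptional y ≡ false → ∀ p → p < r → palette V y p ≡ true → p ≡ i ⊎ p ≡ j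

  -- The palette of the typical point is shared by nearly all points. It has at least two colours,
  -- or else nearly all points would be `few`, and at most two, or else nearly all would be `many`.
  near-pair : ∀ V → (∀ b → n * b ≤ 3 * (n * count n (few V)) + edges V → b + count n (few V) < n × b + count n (many V) < n) →
    ∃[ b ] n * b ≤ 3 * (n * count n (few V)) + edges V × NearPair V b
  near-pair V small with typical V
  ... | x , x<n , le with pick-one {palette V x} (≤-trans (s≤s z≤n) two) | pick-avoiding {palette V x} two
    where
    two : 2 ≤ choices V x
    two with 2 ≤? choices V x
    ... | yes 2≤ = 2≤
    ... | no 2≰ = contradiction (proj₁ (small (deviation V x) le)) (≤⇒≯ (deviating V x (few V) (λ y e → ≤ᵇ-intro (≤-trans (≤-reflexive e) (s≤s⁻¹ (≰⇒> 2≰))))))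
  ... | i , i<r , Pi | avoiding with avoiding i
  ...   | j , (j<r , Pj) , j≢i = deviation V x , le , record
    { i = i ; j = j ; i<r = i<r ; j<r = j<r ; i≢j = j≢i ∘ sym
    ; exceptional = λ y → differ (palette V x) (palette V y)
    ; exceptions = ≤-refl
    ; within = λ y y<n e p p<r Vp → only p p<r (trans (agree {palette V x} {palette V y} e p p<r) Vp) }
    where
    not-three : 3 ≤ choices V x → ⊥
    not-three 3≤ = contradiction (proj₂ (small (deviation V x) le)) (≤⇒≯ (deviating V x (many V) (λ y e → ≤ᵇ-intro (≤-trans 3≤ (≤-reflexive (sym e))))))
    only : ∀ p → p < r → palette V x p ≡ true → p ≡ i ⊎ p ≡ j
    only p p<r Vp with p ≟ i | p ≟ j
    ... | yes p≡i | _       = inj₁ p≡i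
    ... | no _    | yes p≡j = inj₂ p≡j
    ... | no p≢i  | no p≢j  = ⊥-elim (not-three (begin
      3
        ≡⟨ cong₂ _+_ (count-≡ᵇ p<r) (cong₂ _+_ (count-≡ᵇ i<r) (count-≡ᵇ j<r)) ⟨
      count r (_≡ᵇ p) + (count r (_≡ᵇ i) + count r (_≡ᵇ j))
        ≡⟨ trans (∑-+ r _ _) (cong (count r (_≡ᵇ p) +_) (∑-+ r _ _)) ⟨
      ∑ r (λ q → ⟦ q ≡ᵇ p ⟧ + (⟦ q ≡ᵇ i ⟧ + ⟦ q ≡ᵇ j ⟧))
        ≤⟨ ∑-mono r (λ q _ → pointwise q) ⟩
      choices V x ∎))
      where
      pointwise : ∀ q → ⟦ q ≡ᵇ p ⟧ + (⟦ q ≡ᵇ i ⟧ + ⟦ q ≡ᵇ j ⟧) ≤ ⟦ palette V x q ⟧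
      pointwise q with q ≟ p | q ≟ i | q ≟ j
      ... | yes refl | yes refl | _        = contradiction refl p≢i
      ... | yes refl | no _     | yes refl = contradiction refl p≢j
      ... | yes refl | no q≢i   | no q≢j rewrite ≡ᵇ-intro {q} refl | ≡ᵇ-false q≢i | ≡ᵇ-false q≢j | Vp = ≤-refl
      ... | no q≢p   | yes refl | yes refl = contradiction refl j≢i
      ... | no q≢p   | yes refl | no q≢j rewrite ≡ᵇ-false q≢p | ≡ᵇ-intro {q} refl | ≡ᵇ-false q≢j | Pi = ≤-refl
      ... | no q≢p   | no q≢i   | yes refl rewrite ≡ᵇ-false q≢p | ≡ᵇ-false q≢i | ≡ᵇ-intro {q} refl | Pj = ≤-refl
      ... | no q≢p   | no q≢i   | no q≢j rewrite ≡ᵇ-false q≢p | ≡ᵇ-false q≢i | ≡ᵇ-false q≢j = z≤n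

-- Covers around a point of a third colour

cover-∃ : ∀ {M Good N} k (Φ : ℕ → (ℕ → Bool) → Set) → (∀ u → u < k → Cover M (Φ u) Good N) →
  Cover M (λ I → ∃[ u ] u < k × Φ u I) Good (k * N)
cover-∃ zero    Φ cov = mkCover [] z≤n [] (λ { I (_ , () , _) })
cover-∃ (suc k) Φ cov = cover-union split (cov 0 z<s) (cover-∃ k (Φ ∘ suc) (λ u u<k → cov (suc u) (s<s u<k)))
  where
  split : ∀ I → ∃[ u ] u < suc k × Φ u I → Φ 0 I ⊎ (∃[ u ] u < k × Φ (suc u) I)
  split I (zero  , _   , φ) = inj₁ φ
  split I (suc u , u<k , φ) = inj₂ (u , s<s⁻¹ u<k , φ)

module PairCover (r n : ℕ) {{_ : NonZero n}} where

  open Rainbow r n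
  open Templates r n

  -- `third-colour` ranges over all pairs `i`, `j`, because the relevant pair is only known once a
  -- container is given.
  record Admissible (I : ℕ → Bool) : Set where
    field
      functional   : ∀ x p q → x < n → p < r → q < r → I (p * n + x) ≡ true → I (q * n + x) ≡ true → p ≡ q
      rainbow-free : ∀ u v w → u < M → v < M → w < M → I u ≡ true → I v ≡ true → I w ≡ true → rainbow u v w ≡ false
      third-colour : ∀ i j → ∃[ c ] c < r × c ≢ i × c ≢ j × ∃[ x ] x < n × I (c * n + x) ≡ true

  reflect : ∀ x d → d ≤ n → ((x + d) % n + (x + (n ∸ d)) % n) % n ≡ (x * 2) % n
  reflect x d d≤n = trans (sym (%-distribˡ-+ (x + d) (x + (n ∸ d)) n))
    (trans (cong (_% n) (trans (regroup x d (n ∸ d)) (cong (x * 2 +_) (m+[n∸m]≡n d≤n)))) ([m+n]%n≡m%n (x * 2) n))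
    where
    regroup : ∀ x d e → x + d + (x + e) ≡ x * 2 + (d + e)
    regroup = solve-∀

  -- For a point x of colour c ∉ {i, j}, the points x + d and x - d
  -- cannot have the colours i and j in either order.
  module Around {i j c x : ℕ} (i<r : i < r) (j<r : j < r) (c<r : c < r) (x<n : x < n)
    (i≢j : i ≢ j) (c≢i : c ≢ i) (c≢j : c ≢ j) where

    Centred : (ℕ → Bool) → Set
    Centred I = Admissible I × I (c * n + x) ≡ true

    right left : ℕ → ℕ
    right d = (x + d) % n
    left  d = (x + (n ∸ d)) % n

    Lacks : ℕ → ℕ → (ℕ → Bool) → Set
    Lacks p d V = palette V (right d) p ≡ false × palette V (left d) p ≡ false

    Decided : ℕ → (ℕ → Bool) → Set
    Decided d V = Lacks i d V ⊎ Lacks j d V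

    exclude : ℕ → ℕ → (ℕ → Bool) → ℕ → Bool
    exclude p d V u = V u ∧ not (u ≡ᵇ p * n + right d) ∧ not (u ≡ᵇ p * n + left d)

    exclude-lacks : ∀ p d V → Lacks p d (exclude p d V)
    exclude-lacks p d V = first (V (p * n + right d)) (≡ᵇ-intro {p * n + right d} refl) ,
                          second (V (p * n + left d)) (p * n + left d ≡ᵇ p * n + right d) (≡ᵇ-intro {p * n + left d} refl)
      where
      first : ∀ a {b c} → b ≡ true → (a ∧ not b ∧ c) ≡ false
      first true  refl = refl
      first false refl = refl
      second : ∀ a b {c} → c ≡ true → (a ∧ not b ∧ not c) ≡ false
      second true  true  refl = refl
      second true  false refl = refl
      second false b     refl = refl

    exclude-covers : ∀ p d V I → Sub M I V → I (p * n + right d) ≡ false → I (p * n + left d) ≡ false → Sub M I (exclude p d V)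
    exclude-covers p d V I sub R L u u<M Iu = ∧-intro (sub u u<M Iu) (∧-intro (other R) (other L))
      where
      other : ∀ {v} → I v ≡ false → not (u ≡ᵇ v) ≡ true
      other {v} Iv = cong not (≡ᵇ-false {u} {v} (λ u≡v → true≢false Iu (trans (cong I u≡v) Iv)))

    lacks-mono : ∀ {p d V V′} → (∀ u → V′ u ≡ true → V u ≡ true) → Lacks p d V → Lacks p d V′
    lacks-mono {p} {d} {V} {V′} V′⊆V (a , b) = still a , still b
      where
      still : ∀ {u} → V u ≡ false → V′ u ≡ false
      still {u} Vu with V′ u in e
      ... | false = refl
      ... | true  = ⊥-elim (true≢false (V′⊆V u e) Vu)

    not-rainbow : ∀ {I p q} y z → Centred I → p < r → q < r → y < n → z < n → (y + z) % n ≡ (x * 2) % n →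
      p ≢ q → c ≢ p → c ≢ q → I (p * n + y) ≡ true → I (q * n + z) ≡ false
    not-rainbow {I} {p} {q} y z (adm , Ic) p<r q<r y<n z<n mid p≢q c≢p c≢q Ip with I (q * n + z) in Iq
    ... | false = refl
    ... | true  = ⊥-elim (true≢false is (Admissible.rainbow-free adm (p * n + y) (c * n + x) (q * n + z)
                    (vertex<M p<r y<n) (vertex<M c<r x<n) (vertex<M q<r z<n) Ip Ic Iq))
      where
      is : rainbow (p * n + y) (c * n + x) (q * n + z) ≡ true
      is rewrite position p y y<n | position c x x<n | position q z z<n
               | colour-of p y y<n | colour-of c x x<n | colour-of q z z<n
        = ∧-intro (≡ᵇ-intro (sym mid)) (distinct-intro (c≢p ∘ sym) c≢q p≢q)

    same-point : ∀ {I p q} y → Centred I → p < r → q < r → y < n → p ≢ q → I (p * n + y) ≡ true → I (q * n + y) ≡ false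
    same-point {I} {p} {q} y (adm , _) p<r q<r y<n p≢q Ip with I (q * n + y) in Iq
    ... | false = refl
    ... | true  = contradiction (Admissible.functional adm y p q y<n p<r q<r Ip Iq) p≢q

    -- If `i` occurs at one of `x + d`, `x - d`, then `j` is excluded at the opposite point, as `x`
    -- of colour `c` is the midpoint, and at the same point, which has only one colour. Otherwise
    -- `i` occurs at neither.
    decide : ∀ d → d ≤ n → ∀ V → Cover M (λ I → Centred I × Sub M I V)
      (λ V′ → (∀ u → V′ u ≡ true → V u ≡ true) × Decided d V′) 2
    decide d d≤n V = cover-union split
      (cover-one {Φ = λ I → Sub M I (exclude j d V)} (exclude j d V) ≤-refl ((λ u e → proj₁ (∧-true e)) , inj₂ (exclude-lacks j d V)) (λ I → id))
      (cover-one {Φ = λ I → Sub M I (exclude i d V)} (exclude i d V) ≤-refl ((λ u e → proj₁ (∧-true e)) , inj₁ (exclude-lacks i d V)) (λ I → id))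
      where
      R<n : right d < n
      R<n = m%n<n (x + d) n
      L<n : left d < n
      L<n = m%n<n (x + (n ∸ d)) n
      RL : (right d + left d) % n ≡ (x * 2) % n
      RL = reflect x d d≤n
      LR : (left d + right d) % n ≡ (x * 2) % n
      LR = trans (cong (_% n) (+-comm (left d) (right d))) RL
      split : ∀ I → Centred I × Sub M I V → Sub M I (exclude j d V) ⊎ Sub M I (exclude i d V)
      split I (cen , sub) with I (i * n + right d) in iR | I (i * n + left d) in iL
      ... | true  | _     = inj₁ (exclude-covers j d V I sub
              (same-point (right d) cen i<r j<r R<n i≢j iR) (not-rainbow (right d) (left d) cen i<r j<r R<n L<n RL i≢j c≢i c≢j iR))
      ... | false | true  = inj₁ (exclude-covers j d V I sub
              (not-rainbow (left d) (right d) cen i<r j<r L<n R<n LR i≢j c≢i c≢j iL) (same-point (left d) cen i<r j<r L<n i≢j iL))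
      ... | false | false = inj₂ (exclude-covers i d V I sub iR iL)

    halve : ∀ k → k ≤ suc n → ∀ V → Cover M (λ I → Centred I × Sub M I V)
      (λ V′ → (∀ u → V′ u ≡ true → V u ≡ true) × (∀ d → d < k → Decided d V′)) (2 ^ k)
    halve zero    _   V = cover-one V ≤-refl ((λ u → id) , (λ d ())) (λ I → proj₂)
    halve (suc k) k<n V = cover-weaken (λ I → id) id (≤-reflexive (*-comm (2 ^ k) 2))
      (cover-refine {N′ = 2} refine (halve k (<⇒≤ k<n) V))
      where
      Done : ℕ → (ℕ → Bool) → Set
      Done k V′ = (∀ u → V′ u ≡ true → V u ≡ true) × (∀ d → d < k → Decided d V′)
      refine : ∀ V₁ → Done k V₁ → Cover M (λ I → (Centred I × Sub M I V) × Sub M I V₁) (Done (suc k)) 2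
      refine V₁ (V₁⊆V , done) = cover-weaken (λ I ((cen , _) , sub) → cen , sub) good ≤-refl (decide k (s≤s⁻¹ k<n) V₁)
        where
        good : ∀ {V′} → (∀ u → V′ u ≡ true → V₁ u ≡ true) × Decided k V′ → Done (suc k) V′
        good {V′} (V′⊆V₁ , dec) = (λ u e → V₁⊆V u (V′⊆V₁ u e)) , done′
          where
          done′ : ∀ d → d < suc k → Decided d V′
          done′ d d<1+k with m≤n⇒m<n∨m≡n (s≤s⁻¹ d<1+k)
          ... | inj₂ refl = dec
          ... | inj₁ d<k with done d d<k
          ...   | inj₁ l = inj₁ (lacks-mono {i} {d} {V₁} {V′} V′⊆V₁ l)
          ...   | inj₂ l = inj₂ (lacks-mono {j} {d} {V₁} {V′} V′⊆V₁ l)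

    -- One of the two distances between `x` and `y` around the cycle is at most `n / 2`.
    reach : ∀ y → y < n → ∃[ d ] d < suc (n / 2) × (y ≡ right d ⊎ y ≡ left d)
    reach y y<n = half (offset y)
      where
      offset : ∀ y → ∃[ δ ] δ ≤ n × (x + δ) % n ≡ y % n
      offset y with x ≤? y
      ... | yes x≤y = (y ∸ x) % n , <⇒≤ (m%n<n (y ∸ x) n) , trans (%-distribˡ-+ x ((y ∸ x) % n) n)
              (trans (cong (λ z → (x % n + z) % n) (m%n%n≡m%n (y ∸ x) n))
                (trans (sym (%-distribˡ-+ x (y ∸ x) n)) (cong (_% n) (m+[n∸m]≡n x≤y))))
      ... | no x≰y = n ∸ (x ∸ y) , m∸n≤m n (x ∸ y) , trans (cong (_% n) shift) ([m+n]%n≡m%n y n)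
        where
        shift : x + (n ∸ (x ∸ y)) ≡ y + n
        shift = trans (cong (_+ (n ∸ (x ∸ y))) (sym (m+[n∸m]≡n (<⇒≤ (≰⇒> x≰y)))))
          (trans (+-assoc y (x ∸ y) _) (cong (y +_) (m+[n∸m]≡n (≤-trans (m∸n≤m x y) (<⇒≤ x<n)))))
      2h : n < 2 * suc (n / 2)
      2h = subst₂ _<_ (sym (m≡m%n+[m/n]*n n 2)) (regroup (n / 2)) (+-monoˡ-< (n / 2 * 2) (m%n<n n 2))
        where
        regroup : ∀ h → 2 + h * 2 ≡ 2 * suc h
        regroup = solve-∀
      half : ∃[ δ ] δ ≤ n × (x + δ) % n ≡ y % n → ∃[ d ] d < suc (n / 2) × (y ≡ right d ⊎ y ≡ left d)
      half (δ , δ≤n , e) with δ <? suc (n / 2)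
      ... | yes δ<h = δ , δ<h , inj₁ (trans (sym (m<n⇒m%n≡m y<n)) (sym e))
      ... | no δ≮h = n ∸ δ , +-cancelʳ-< δ _ _ (≤-trans (≤-reflexive (cong suc (m∸n+n≡m δ≤n)))
              (≤-trans 2h (≤-trans (≤-reflexive (cong (suc (n / 2) +_) (+-identityʳ _))) (+-monoʳ-≤ (suc (n / 2)) (≮⇒≥ δ≮h)))))
          , inj₂ (trans (sym (m<n⇒m%n≡m y<n)) (trans (sym e) (cong (λ z → (x + z) % n) (sym (m∸[m∸n]≡n δ≤n)))))

  module _ (V : ℕ → Bool) {b : ℕ} (near : NearPair V b) where

    open NearPair near

    Thin : (ℕ → Bool) → Set
    Thin V′ = ∀ y → y < n → exceptional y ≡ false → choices V′ y ≤ 1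

    at-most-one : ∀ {p} (P : ℕ → Bool) → (∀ q → q < r → P q ≡ true → q ≡ p) → count r P ≤ 1
    at-most-one {p} P only = ≤-trans (count-mono r (λ q q<r e → ≡ᵇ-intro (only q q<r e))) (count-≡ᵇ-≤ r p)

    -- There are `r * n` choices for the colour and position of a third-coloured point. Each of the
    -- about `n / 2` pairs `x + d`, `x - d` around it then costs one binary decision, after which
    -- its unexceptional points have no choice left.
    pair-cover : Cover M (λ I → Admissible I × Sub M I V) Thin (r * (n * 2 ^ suc (n / 2)))
    pair-cover = cover-weaken (λ I (adm , sub) → let c , c<r , c≢i , c≢j , x , x<n , Ic = Admissible.third-colour adm i j
                                                 in c , c<r , x , x<n , c≢i , c≢j , (adm , Ic) , sub) id ≤-refl
      (cover-∃ r _ (λ c c<r → cover-∃ n (λ x I → c ≢ i × c ≢ j × (Admissible I × I (c * n + x) ≡ true) × Sub M I V)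
        (λ x x<n → around c x c<r x<n)))
      where
      h≤n : suc (n / 2) ≤ suc n
      h≤n = s≤s (m/n≤m n 2)
      around : ∀ c x → c < r → x < n →
        Cover M (λ I → c ≢ i × c ≢ j × (Admissible I × I (c * n + x) ≡ true) × Sub M I V) Thin (2 ^ suc (n / 2))
      around c x c<r x<n with c ≟ i | c ≟ j
      ... | yes c≡i | _       = mkCover [] z≤n [] (λ I (c≢i , _) → contradiction c≡i c≢i)
      ... | no _    | yes c≡j = mkCover [] z≤n [] (λ I (_ , c≢j , _) → contradiction c≡j c≢j)
      ... | no c≢i  | no c≢j  = cover-weaken (λ I φ → proj₂ (proj₂ φ)) thin ≤-refl (A.halve (suc (n / 2)) h≤n V)
        where
        module A = Around i<r j<r c<r x<n i≢j c≢i c≢j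
        thin : ∀ {V′} → (∀ u → V′ u ≡ true → V u ≡ true) × (∀ d → d < suc (n / 2) → A.Decided d V′) → Thin V′
        thin {V′} (V′⊆V , decided) y y<n ey with A.reach y y<n
        ... | d , d<h , side = bound (decided d d<h)
          where
          lacking : ∀ p → A.Lacks p d V′ → palette V′ y p ≡ false
          lacking p (R , L) = case side of λ { (inj₁ refl) → R ; (inj₂ refl) → L }
          bound : A.Decided d V′ → choices V′ y ≤ 1
          bound (inj₁ lacks-i) = at-most-one {j} (palette V′ y) λ q q<r e → case within y y<n ey q q<r (V′⊆V _ e) of
            λ { (inj₁ refl) → ⊥-elim (true≢false e (lacking i lacks-i)) ; (inj₂ q≡j) → q≡j }
          bound (inj₂ lacks-j) = at-most-one {i} (palette V′ y) λ q q<r e → case within y y<n ey q q<r (V′⊆V _ e) of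
            λ { (inj₁ q≡i) → q≡i ; (inj₂ refl) → ⊥-elim (true≢false e (lacking j lacks-j)) }

-- Colourings as vertex sets

private
  variable
    r n : ℕ
    A : Subset n
    X Y : Set

∑ₗ : List X → (X → ℕ) → ℕ
∑ₗ []       f = 0
∑ₗ (x ∷ xs) f = f x + ∑ₗ xs f

∑ₗ-++ : ∀ (xs ys : List X) f → ∑ₗ (xs List.++ ys) f ≡ ∑ₗ xs f + ∑ₗ ys f
∑ₗ-++ []       ys f = refl
∑ₗ-++ (x ∷ xs) ys f = trans (cong (f x +_) (∑ₗ-++ xs ys f)) (sym (+-assoc (f x) _ _))

∑ₗ-map : ∀ (h : X → Y) xs f → ∑ₗ (List.map h xs) f ≡ ∑ₗ xs (f ∘ h)
∑ₗ-map h []       f = refl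
∑ₗ-map h (x ∷ xs) f = cong (f (h x) +_) (∑ₗ-map h xs f)

∑ₗ-cong : ∀ (xs : List X) {f h} → (∀ x → f x ≡ h x) → ∑ₗ xs f ≡ ∑ₗ xs h
∑ₗ-cong []       e = refl
∑ₗ-cong (x ∷ xs) e = cong₂ _+_ (e x) (∑ₗ-cong xs e)

∑ₗ-mono : ∀ {xs : List X} {f h} → All (λ x → f x ≤ h x) xs → ∑ₗ xs f ≤ ∑ₗ xs h
∑ₗ-mono []       = z≤n
∑ₗ-mono (le ∷ l) = +-mono-≤ le (∑ₗ-mono l)

∑ₗ-bound : ∀ {xs : List X} {f} b → All (λ x → f x ≤ b) xs → ∑ₗ xs f ≤ length xs * b
∑ₗ-bound b []       = z≤n
∑ₗ-bound b (le ∷ l) = +-mono-≤ le (∑ₗ-bound b l)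

∑ₗ-* : ∀ (xs : List X) c f → ∑ₗ xs (λ x → c * f x) ≡ c * ∑ₗ xs f
∑ₗ-* []       c f = sym (*-zeroʳ c)
∑ₗ-* (x ∷ xs) c f = trans (cong (c * f x +_) (∑ₗ-* xs c f)) (sym (*-distribˡ-+ c (f x) _))

∑ₗ-+ : ∀ (xs : List X) f h → ∑ₗ xs (λ x → f x + h x) ≡ ∑ₗ xs f + ∑ₗ xs h
∑ₗ-+ []       f h = refl
∑ₗ-+ (x ∷ xs) f h = trans (cong (f x + h x +_) (∑ₗ-+ xs f h)) (shuffle (f x) (h x) _ _)
  where
  shuffle : ∀ a b c d → a + b + (c + d) ≡ a + c + (b + d)
  shuffle = solve-∀

∑ₗ-swap : ∀ (xs : List X) (ys : List Y) (f : X → Y → ℕ) →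
  ∑ₗ xs (λ x → ∑ₗ ys (f x)) ≡ ∑ₗ ys (λ y → ∑ₗ xs (λ x → f x y))
∑ₗ-swap []       ys f = sym (zeros ys)
  where
  zeros : ∀ ys → ∑ₗ ys (λ _ → 0) ≡ 0
  zeros []       = refl
  zeros (_ ∷ ys) = zeros ys
∑ₗ-swap (x ∷ xs) ys f = trans (cong (∑ₗ ys (f x) +_) (∑ₗ-swap xs ys f)) (sym (∑ₗ-+ ys (f x) _))

∑ₗ-length : ∀ (xs : List X) → ∑ₗ xs (λ _ → 1) ≡ length xs
∑ₗ-length []       = refl
∑ₗ-length (x ∷ xs) = cong suc (∑ₗ-length xs)

∑ₗ-filter-≤ : ∀ {p} {P : X → Set p} (P? : Decidable P) xs f → ∑ₗ (List.filter P? xs) f ≤ ∑ₗ xs f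
∑ₗ-filter-≤ P? []       f = z≤n
∑ₗ-filter-≤ P? (x ∷ xs) f with P? x
... | yes _ = +-monoʳ-≤ (f x) (∑ₗ-filter-≤ P? xs f)
... | no _  = ≤-trans (∑ₗ-filter-≤ P? xs f) (m≤n+m _ (f x))

∑ₗ-tabulate : ∀ k (t : Fin k → X) f (h : ℕ → ℕ) → (∀ i → f (t i) ≡ h (toℕ i)) → ∑ₗ (List.tabulate t) f ≡ ∑ k h
∑ₗ-tabulate zero    t f h e = refl
∑ₗ-tabulate (suc k) t f h e = cong₂ _+_ (e fzero) (∑ₗ-tabulate k (t ∘ fsuc) f (h ∘ suc) (e ∘ fsuc))

∑ₗ-allFin : ∀ r (f : ℕ → ℕ) → ∑ₗ (List.allFin r) (f ∘ toℕ) ≡ ∑ r f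
∑ₗ-allFin r f = ∑ₗ-tabulate r id (f ∘ toℕ) f (λ _ → refl)

-- Points outside `A` receive no colour: a colouring of `A` is then an ordinary vertex set of the
-- hypergraph, and one argument serves every `A`.
has : Colouring r A → ℕ → ℕ → Bool
has []       x       p = false
has (c ∷ χ)  zero    p = toℕ c ≡ᵇ p
has (c ∷ χ)  (suc x) p = has χ x p
has (skip χ) zero    p = false
has (skip χ) (suc x) p = has χ x p

compatible : (ℕ → ℕ → Bool) → Colouring r A → Bool
compatible P []       = true
compatible P (c ∷ χ)  = P 0 (toℕ c) ∧ compatible (P ∘ suc) χ
compatible P (skip χ) = compatible (P ∘ suc) χ

compatible-intro : ∀ {r n} {A : Subset n} (χ : Colouring r A) P →
  (∀ x p → x < n → p < r → has χ x p ≡ true → P x p ≡ true) → compatible P χ ≡ true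
compatible-intro []       P h = refl
compatible-intro (c ∷ χ)  P h = ∧-intro (h 0 (toℕ c) z<s (toℕ<n c) (≡ᵇ-intro {toℕ c} refl))
  (compatible-intro χ (P ∘ suc) (λ x p x<n → h (suc x) p (s<s x<n)))
compatible-intro (skip χ) P h = compatible-intro χ (P ∘ suc) (λ x p x<n → h (suc x) p (s<s x<n))

compatible-elim : ∀ (χ : Colouring r A) P → compatible P χ ≡ true →
  ∀ x p → has χ x p ≡ true → P x p ≡ true
compatible-elim (c ∷ χ)  P e zero    p h = subst (λ q → P 0 q ≡ true) (≡ᵇ-elim (toℕ c) p h) (proj₁ (∧-true e))
compatible-elim (c ∷ χ)  P e (suc x) p h = compatible-elim χ (P ∘ suc) (proj₂ (∧-true {P 0 (toℕ c)} e)) x p h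
compatible-elim (skip χ) P e (suc x) p h = compatible-elim χ (P ∘ suc) e x p h

colourings-inside : ∀ P (cs : List (Fin r)) (L : List (Colouring r A)) →
  ∑ₗ (List.cartesianProductWith Colouring._∷_ cs L) (λ χ → ⟦ compatible P χ ⟧)
  ≡ ∑ₗ cs (λ c → ⟦ P 0 (toℕ c) ⟧) * ∑ₗ L (λ χ → ⟦ compatible (P ∘ suc) χ ⟧)
colourings-inside P []       L = refl
colourings-inside P (c ∷ cs) L = trans (∑ₗ-++ (List.map (c ∷_) L) _ _) (trans (cong₂ _+_
  (trans (∑ₗ-map (c ∷_) L _) (trans (∑ₗ-cong L (λ χ → ⟦∧⟧ (P 0 (toℕ c)) (compatible (P ∘ suc) χ))) (∑ₗ-* L ⟦ P 0 (toℕ c) ⟧ _)))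
  (colourings-inside P cs L)) (sym (*-distribʳ-+ (∑ₗ L (λ χ → ⟦ compatible (P ∘ suc) χ ⟧)) ⟦ P 0 (toℕ c) ⟧ _)))

compatible-count : ∀ {n} r (A : Subset n) → (ℕ → ℕ → Bool) → ℕ
compatible-count r A P = ∑ₗ (colourings r A) (λ χ → ⟦ compatible P χ ⟧)

compatible-count-inside : ∀ {n} r (A : Subset n) P →
  compatible-count r (inside ∷ A) P ≡ count r (P 0) * compatible-count r A (P ∘ suc)
compatible-count-inside r A P = trans (colourings-inside P (List.allFin r) (colourings r A))
  (cong (_* compatible-count r A (P ∘ suc)) (∑ₗ-allFin r (λ p → ⟦ P 0 p ⟧)))

compatible-count-outside : ∀ {n} r (A : Subset n) P →
  compatible-count r (outside ∷ A) P ≡ compatible-count r A (P ∘ suc)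
compatible-count-outside r A P = ∑ₗ-map skip (colourings r A) _

compatible-count-≤ : ∀ {r n} (A : Subset n) P (e : ℕ → ℕ) → (∀ x → x < n → count r (P x) ≤ 2 ^ e x) →
  compatible-count r A P ≤ 2 ^ ∑ n e
compatible-count-≤ []            P e h = ≤-refl
compatible-count-≤ {r} {suc n} (inside ∷ A) P e h = begin
  compatible-count r (inside ∷ A) P ≡⟨ compatible-count-inside r A P ⟩
  count r (P 0) * compatible-count r A (P ∘ suc) ≤⟨ *-mono-≤ (h 0 z<s) (compatible-count-≤ A (P ∘ suc) (e ∘ suc) (λ x x<n → h (suc x) (s<s x<n))) ⟩
  2 ^ e 0 * 2 ^ ∑ n (e ∘ suc) ≡⟨ ^-distribˡ-+-* 2 (e 0) _ ⟨
  2 ^ ∑ (suc n) e ∎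
compatible-count-≤ {r} {suc n} (outside ∷ A) P e h = begin
  compatible-count r (outside ∷ A) P ≡⟨ compatible-count-outside r A P ⟩
  compatible-count r A (P ∘ suc) ≤⟨ compatible-count-≤ A (P ∘ suc) (e ∘ suc) (λ x x<n → h (suc x) (s<s x<n)) ⟩
  2 ^ ∑ n (e ∘ suc) ≤⟨ ^-monoʳ-≤ 2 (m≤n+m _ (e 0)) ⟩
  2 ^ ∑ (suc n) e ∎

has-colour : ∀ {r n} {A : Subset n} (χ : Colouring r A) x p → has χ x p ≡ true →
  Σ (Fin n) λ i → toℕ i ≡ x × Σ (i ∈ A) λ i∈A → toℕ (colour χ i∈A) ≡ p
has-colour (c ∷ χ)  zero    p e = fzero , refl , here , ≡ᵇ-elim (toℕ c) p e
has-colour (c ∷ χ)  (suc x) p e = let i , i≡x , i∈A , c≡p = has-colour χ x p e in fsuc i , cong suc i≡x , there i∈A , c≡p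
has-colour (skip χ) (suc x) p e = let i , i≡x , i∈A , c≡p = has-colour χ x p e in fsuc i , cong suc i≡x , there i∈A , c≡p

has-functional : ∀ (χ : Colouring r A) x p q → has χ x p ≡ true → has χ x q ≡ true → p ≡ q
has-functional (c ∷ χ)  zero    p q e e′ = trans (sym (≡ᵇ-elim (toℕ c) p e)) (≡ᵇ-elim (toℕ c) q e′)
has-functional (c ∷ χ)  (suc x) p q e e′ = has-functional χ x p q e e′
has-functional (skip χ) (suc x) p q e e′ = has-functional χ x p q e e′

value-position : ∀ {r n} {A : Subset n} (χ : Colouring r A) c → c ∈ₗ values χ → ∃[ x ] x < n × has χ x (toℕ c) ≡ true
value-position (c ∷ χ)  _ (here refl) = 0 , z<s , ≡ᵇ-intro {toℕ c} refl
value-position (c ∷ χ)  v (there v∈)  = let x , x<n , e = value-position χ v v∈ in suc x , s<s x<n , e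
value-position (skip χ) v v∈          = let x , x<n , e = value-position χ v v∈ in suc x , s<s x<n , e

outside-pair : ∀ {r} (xs : List (Fin r)) → Unique xs → 3 ≤ length xs → ∀ i j → ∃[ c ] c ∈ₗ xs × toℕ c ≢ i × toℕ c ≢ j
outside-pair []            _ ()             i j
outside-pair (_ ∷ [])      _ (s≤s ())       i j
outside-pair (_ ∷ _ ∷ []) _ (s≤s (s≤s ())) i j
outside-pair (a ∷ b ∷ c ∷ xs) ((a≢b ∷ a≢c ∷ _) ∷ (b≢c ∷ _) ∷ _) _ i j
  with toℕ a ≟ i | toℕ a ≟ j | toℕ b ≟ i | toℕ b ≟ j | toℕ c ≟ i | toℕ c ≟ j
... | no a≢i | no a≢j | _ | _ | _ | _ = a , here refl , a≢i , a≢j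
... | _ | _ | no b≢i | no b≢j | _ | _ = b , there (here refl) , b≢i , b≢j
... | _ | _ | _ | _ | no c≢i | no c≢j = c , there (there (here refl)) , c≢i , c≢j
... | yes ai | _ | yes bi | _ | _ | _ = contradiction (toℕ-injective (trans ai (sym bi))) a≢b
... | yes ai | _ | _ | _ | yes ci | _ = contradiction (toℕ-injective (trans ai (sym ci))) a≢c
... | _ | _ | yes bi | _ | yes ci | _ = contradiction (toℕ-injective (trans bi (sym ci))) b≢c
... | _ | yes aj | _ | yes bj | _ | _ = contradiction (toℕ-injective (trans aj (sym bj))) a≢b
... | _ | yes aj | _ | _ | _ | yes cj = contradiction (toℕ-injective (trans aj (sym cj))) a≢c
... | _ | _ | _ | yes bj | _ | yes cj = contradiction (toℕ-injective (trans bj (sym cj))) b≢c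

∣-of-≡% : ∀ a b n .{{_ : NonZero n}} → a % n ≡ b % n → n ∣ ∣ a - b ∣
∣-of-≡% a b n e = divides ∣ a / n - b / n ∣ (begin-equality
  ∣ a - b ∣
    ≡⟨ cong₂ ∣_-_∣ (m≡m%n+[m/n]*n a n) (m≡m%n+[m/n]*n b n) ⟩
  ∣ a % n + a / n * n - b % n + b / n * n ∣
    ≡⟨ cong (λ z → ∣ a % n + a / n * n - z + b / n * n ∣) (sym e) ⟩
  ∣ a % n + a / n * n - a % n + b / n * n ∣
    ≡⟨ ∣m+n-m+o∣≡∣n-o∣ (a % n) _ _ ⟩
  ∣ a / n * n - b / n * n ∣
    ≡⟨ *-distribʳ-∣-∣ n (a / n) (b / n) ⟨
  ∣ a / n - b / n ∣ * n ∎)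

multicoloured : ∀ {n} r (A : Subset n) → List (Colouring r A)
multicoloured r A = List.filter (λ χ → ¬? (is2Colouring? χ)) (List.filter rainbowFree? (colourings r A))

multicoloured-≤ : ∀ {n} r (A : Subset n) f → ∑ₗ (multicoloured r A) f ≤ ∑ₗ (colourings r A) f
multicoloured-≤ r A f = ≤-trans (∑ₗ-filter-≤ (λ χ → ¬? (is2Colouring? χ)) (List.filter rainbowFree? (colourings r A)) f)
  (∑ₗ-filter-≤ rainbowFree? (colourings r A) f)

module ColourSets (r n : ℕ) {{_ : NonZero n}} (A : Subset n) where

  open Rainbow r n
  open Templates r n
  open PairCover r n

  vertices : Colouring r A → ℕ → Bool
  vertices χ u = has χ (u % n) (u / n)

  vertices-at : ∀ χ {p x} → x < n → vertices χ (p * n + x) ≡ has χ x p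
  vertices-at χ {p} {x} x<n = cong₂ (has χ) (position p x x<n) (colour-of p x x<n)

  admissible : ∀ χ → RainbowFree χ → ¬ Is2Colouring χ → Admissible (vertices χ)
  admissible χ free many = record { functional = functional ; rainbow-free = rainbow-free ; third-colour = third-colour }
    where
    functional : ∀ x p q → x < n → p < r → q < r → vertices χ (p * n + x) ≡ true → vertices χ (q * n + x) ≡ true → p ≡ q
    functional x p q x<n _ _ e e′ = has-functional χ x p q (trans (sym (vertices-at χ x<n)) e) (trans (sym (vertices-at χ x<n)) e′)
    rainbow-free : ∀ u v w → u < M → v < M → w < M → vertices χ u ≡ true → vertices χ v ≡ true → vertices χ w ≡ true → rainbow u v w ≡ false
    rainbow-free u v w _ _ _ eᵤ eᵥ e_w with rainbow u v w in e
    ... | false = refl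
    ... | true with has-colour χ _ _ eᵤ | has-colour χ _ _ eᵥ | has-colour χ _ _ e_w
    ...   | a , a≡ , a∈A , ca | b , b≡ , b∈A , cb | c , c≡ , c∈A , cc =
      ⊥-elim (free a a∈A b b∈A c c∈A (∣-of-≡% (toℕ a + toℕ c) (2 * toℕ b) n is-progression)
        ( (λ x≡y → p≢q (trans (sym ca) (trans (cong toℕ x≡y) cb)))
        , (λ y≡z → q≢s (trans (sym cb) (trans (cong toℕ y≡z) cc)))
        , (λ x≡z → p≢s (trans (sym ca) (trans (cong toℕ x≡z) cc))) ))
      where
      dist = distinct-elim (u / n) (v / n) (w / n) (proj₂ (∧-true {progression (u % n) (v % n) (w % n)} e))
      p≢q = proj₁ dist
      q≢s = proj₁ (proj₂ dist)
      p≢s = proj₂ (proj₂ dist)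
      is-progression : (toℕ a + toℕ c) % n ≡ (2 * toℕ b) % n
      is-progression = trans (cong₂ (λ x z → (x + z) % n) a≡ c≡)
        (trans (sym (≡ᵇ-elim ((v % n * 2) % n) _ (proj₁ (∧-true {progression (u % n) (v % n) (w % n)} e))))
          (cong (_% n) (trans (*-comm (v % n) 2) (cong (2 *_) (sym b≡)))))
    third-colour : ∀ i j → ∃[ c ] c < r × c ≢ i × c ≢ j × ∃[ x ] x < n × vertices χ (c * n + x) ≡ true
    third-colour i j with outside-pair (List.deduplicate _≟ᶠ_ (values χ)) (deduplicate-! _≟ᶠ_ (values χ)) (≰⇒> many) i j
    ... | c , c∈ , c≢i , c≢j with value-position χ c (∈-deduplicate⁻ _≟ᶠ_ (values χ) c∈)
    ...   | x , x<n , e = toℕ c , toℕ<n c , c≢i , c≢j , x , x<n , trans (vertices-at χ x<n) e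

  compat : (ℕ → Bool) → Colouring r A → Bool
  compat V χ = compatible (palette V) χ

  compat-intro : ∀ V χ → Sub M (vertices χ) V → compat V χ ≡ true
  compat-intro V χ sub = compatible-intro χ (palette V) λ x p x<n p<r e →
    sub (p * n + x) (vertex<M p<r x<n) (trans (vertices-at χ x<n) e)

  compat-elim : ∀ V χ → compat V χ ≡ true → Sub M (vertices χ) V
  compat-elim V χ e u u<M eᵤ = subst (λ v → V v ≡ true) (trans (+-comm (u / n * n) (u % n)) (sym (m≡m%n+[m/n]*n u n)))
    (compatible-elim χ (palette V) e (u % n) (u / n) eᵤ)

  -- The union bound over the containers.
  cover-count : ∀ {Φ Good N} b (L : List (Colouring r A)) → Cover M Φ Good N → All (λ χ → Φ (vertices χ)) L →
    (∀ V → Good V → ∑ₗ L (λ χ → ⟦ compat V χ ⟧) ≤ b) → length L ≤ N * b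
  cover-count {Φ} {Good} {N} b L (mkCover Vs size good covers) all bound = begin
    length L
      ≡⟨ ∑ₗ-length L ⟨
    ∑ₗ L (λ _ → 1)
      ≤⟨ ∑ₗ-mono (All.map (λ {χ} φ → member χ Vs (covers (vertices χ) φ)) all) ⟩
    ∑ₗ L (λ χ → ∑ₗ Vs (λ V → ⟦ compat V χ ⟧))
      ≡⟨ ∑ₗ-swap L Vs _ ⟩
    ∑ₗ Vs (λ V → ∑ₗ L (λ χ → ⟦ compat V χ ⟧))
      ≤⟨ ∑ₗ-bound b (All.map (λ {V} g → bound V g) good) ⟩
    length Vs * b
      ≤⟨ *-monoˡ-≤ b size ⟩
    N * b ∎
    where
    member : ∀ χ Vs → Any (Sub M (vertices χ)) Vs → 1 ≤ ∑ₗ Vs (λ V → ⟦ compat V χ ⟧)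
    member χ (V ∷ Vs) (here sub)  = ≤-trans (≤-reflexive (sym (cong ⟦_⟧ (compat-intro V χ sub)))) (m≤m+n _ _)
    member χ (V ∷ Vs) (there any) = ≤-trans (member χ Vs any) (m≤n+m _ _)

  choices≤ : ∀ V x → choices V x ≤ 2 ^ r
  choices≤ V x = ≤-trans (count≤ r (palette V x)) (<⇒≤ (n<2^n r))

  -- The exponent charges nothing for a point of `few`, one for a point with two colours, and covers
  -- the at most `r < 2 ^ r` choices at a point of `many`.
  compat-weight : ∀ V → ∑ₗ (multicoloured r A) (λ χ → ⟦ compat V χ ⟧) ≤ 2 ^ (count n (not ∘ few V) + r * count n (many V))
  compat-weight V = begin
    ∑ₗ (multicoloured r A) (λ χ → ⟦ compat V χ ⟧)
      ≤⟨ multicoloured-≤ r A (λ χ → ⟦ compat V χ ⟧) ⟩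
    compatible-count r A (palette V)
      ≤⟨ compatible-count-≤ A (palette V) e bound ⟩
    2 ^ ∑ n e
      ≡⟨ cong (2 ^_) (trans (∑-+ n _ _) (cong (count n (not ∘ few V) +_) (∑-* n r _))) ⟩
    2 ^ (count n (not ∘ few V) + r * count n (many V)) ∎
    where
    e : ℕ → ℕ
    e x = ⟦ not (few V x) ⟧ + r * ⟦ many V x ⟧
    bound : ∀ x → x < n → choices V x ≤ 2 ^ e x
    bound x x<n with choices V x ≤? 1 | choices V x ≤? 2
    ... | yes ≤1 | _ = ≤-trans ≤1 (m^n>0 2 (e x))
    ... | no ≰1 | yes ≤2 = ≤-trans ≤2 (^-monoʳ-≤ 2 (≤-trans (≤-reflexive (sym (cong (λ b → ⟦ not b ⟧) few-is))) (m≤m+n _ _)))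
      where
      few-is : few V x ≡ false
      few-is with few V x in f
      ... | false = refl
      ... | true  = contradiction (≤ᵇ-elim _ 1 f) ≰1
    ... | no _ | no ≰2 = ≤-trans (choices≤ V x) (^-monoʳ-≤ 2 (≤-trans (≤-reflexive (trans (sym (*-identityʳ r))
          (cong (λ b → r * ⟦ b ⟧) (sym (≤ᵇ-intro (≰⇒> ≰2)))))) (m≤n+m (r * ⟦ many V x ⟧) ⟦ not (few V x) ⟧)))

  keep : (Colouring r A → Bool) → List (Colouring r A) → List (Colouring r A)
  keep f = List.filter (λ χ → f χ ≟ᵇ true)

  keep-length : ∀ f L → ∑ₗ L (λ χ → ⟦ f χ ⟧) ≡ length (keep f L)
  keep-length f []      = refl
  keep-length f (χ ∷ L) with f χ
  ... | true  = cong suc (keep-length f L)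
  ... | false = keep-length f L

  multicoloured-admissible : All (λ χ → Admissible (vertices χ)) (multicoloured r A)
  multicoloured-admissible = All.zipWith (λ {χ} (free , many) → admissible χ free many)
    ( All-filter⁺ (λ χ → ¬? (is2Colouring? χ)) (all-filter rainbowFree? (colourings r A))
    , all-filter (λ χ → ¬? (is2Colouring? χ)) (List.filter rainbowFree? (colourings r A)))

  -- Such a container may hold nearly `2 ^ n` colourings by the two colours `i` and `j`. Only those
  -- with a third colour are counted here, which is what makes the refinement by `pair-cover`
  -- available.
  near-pair-count : ∀ V {b} → NearPair V b →
    ∑ₗ (multicoloured r A) (λ χ → ⟦ compat V χ ⟧) ≤ r * (n * 2 ^ suc (n / 2)) * 2 ^ (r * b)
  near-pair-count V {b} near = ≤-trans (≤-reflexive (keep-length (compat V) (multicoloured r A)))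
    (cover-count (2 ^ (r * b)) (keep (compat V) (multicoloured r A)) (pair-cover V near)
      (All.zipWith (λ {χ} (adm , e) → adm , compat-elim V χ e)
        (All-filter⁺ (λ χ → compat V χ ≟ᵇ true) multicoloured-admissible , all-filter (λ χ → compat V χ ≟ᵇ true) (multicoloured r A)))
      bound)
    where
    open NearPair near
    bound : ∀ V′ → Thin V near V′ → ∑ₗ (keep (compat V) (multicoloured r A)) (λ χ → ⟦ compat V′ χ ⟧) ≤ 2 ^ (r * b)
    bound V′ thin = begin
      ∑ₗ (keep (compat V) (multicoloured r A)) (λ χ → ⟦ compat V′ χ ⟧)
        ≤⟨ ≤-trans (∑ₗ-filter-≤ (λ χ → compat V χ ≟ᵇ true) (multicoloured r A) (λ χ → ⟦ compat V′ χ ⟧))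
             (multicoloured-≤ r A (λ χ → ⟦ compat V′ χ ⟧)) ⟩
      compatible-count r A (palette V′)
        ≤⟨ compatible-count-≤ A (palette V′) (λ x → r * ⟦ exceptional x ⟧) weight ⟩
      2 ^ ∑ n (λ x → r * ⟦ exceptional x ⟧)
        ≡⟨ cong (2 ^_) (∑-* n r _) ⟩
      2 ^ (r * count n exceptional)
        ≤⟨ ^-monoʳ-≤ 2 (*-monoʳ-≤ r exceptions) ⟩
      2 ^ (r * b) ∎
      where
      weight : ∀ x → x < n → choices V′ x ≤ 2 ^ (r * ⟦ exceptional x ⟧)
      weight x x<n with exceptional x in e
      ... | true  = ≤-trans (choices≤ V′ x) (≤-reflexive (cong (2 ^_) (sym (*-identityʳ r))))
      ... | false = ≤-trans (thin x x<n e) (m^n>0 2 (r * 0))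

-- Choice of parameters

binary-length : ∀ n → 1 ≤ n → ∃[ v ] 2 ^ v ≤ n × n < 2 ^ suc v
binary-length (suc zero)    _ = 0 , ≤-refl , ≤-refl
binary-length (suc (suc n)) _ with binary-length (suc n) (s≤s z≤n)
... | v , lo , hi with suc (suc n) <? 2 ^ suc v
...   | yes lt = v , ≤-trans lo (n≤1+n _) , lt
...   | no ge  = suc v , ≮⇒≥ ge , ≤-<-trans hi (^-monoʳ-< 2 (s≤s (s≤s z≤n)) (n<1+n (suc v)))

quartic : ∀ u → suc u * suc u * (suc u * suc u) ≤ 2 ^ (4 * u)
quartic u = ≤-trans (*-mono-≤ (*-mono-≤ s s) (*-mono-≤ s s)) (≤-reflexive (trans (cong₂ _*_ (sym (^-distribˡ-+-* 2 u u)) (sym (^-distribˡ-+-* 2 u u)))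
    (trans (sym (^-distribˡ-+-* 2 (u + u) (u + u))) (cong (2 ^_) (four u)))))
  where
  s : suc u ≤ 2 ^ u
  s = n<2^n u
  four : ∀ u → u + u + (u + u) ≡ 4 * u
  four = solve-∀

-- `w` exceeds the binary logarithm of `n` by a constant. With `u` a quarter of that logarithm, `w`
-- is at most `(r + 8) * suc u` and `n` at least the fourth power of `suc u`; two of the four
-- factors absorb the constants once `t ≤ u`.
log-small : ∀ r B → ∃[ N ] ∀ n → N ≤ n → ∃[ w ] 1 ≤ w × suc (r * n) ≤ 2 ^ w × B * (w * w) ≤ n
log-small r B = 2 ^ (4 * t) , small
  where
  t : ℕ
  t = B * ((r + 8) * (r + 8))
  small : ∀ n → 2 ^ (4 * t) ≤ n → ∃[ w ] 1 ≤ w × suc (r * n) ≤ 2 ^ w × B * (w * w) ≤ n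
  small n N≤n with binary-length n (≤-trans (m^n>0 2 (4 * t)) N≤n)
  ... | v , lo , hi = v + 2 + r , ≤-trans (≤-trans (s≤s z≤n) (m≤n+m 2 v)) (m≤m+n (v + 2) r) , enough , growth
    where
    enough : suc (r * n) ≤ 2 ^ (v + 2 + r)
    enough = begin
      suc (r * n) ≤⟨ s≤s (*-monoʳ-≤ r (<⇒≤ hi)) ⟩
      1 + r * 2 ^ suc v ≤⟨ +-monoˡ-≤ (r * 2 ^ suc v) (m^n>0 2 (suc v)) ⟩
      suc r * 2 ^ suc v ≤⟨ *-monoˡ-≤ (2 ^ suc v) (n<2^n r) ⟩
      2 ^ r * 2 ^ suc v ≡⟨ ^-distribˡ-+-* 2 r (suc v) ⟨
      2 ^ (r + suc v) ≤⟨ ^-monoʳ-≤ 2 (≤-trans (n≤1+n _) (≤-reflexive (regroup r v))) ⟩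
      2 ^ (v + 2 + r) ∎
      where
      regroup : ∀ r v → suc (r + suc v) ≡ v + 2 + r
      regroup = solve-∀
    u : ℕ
    u = v / 4
    v< : v < 4 * suc u
    v< = subst₂ _<_ (sym (m≡m%n+[m/n]*n v 4)) (regroup u) (+-monoˡ-< (u * 4) (m%n<n v 4))
      where
      regroup : ∀ h → 4 + h * 4 ≡ 4 * suc h
      regroup = solve-∀
    t≤u : t ≤ u
    t≤u = s≤s⁻¹ (*-cancelˡ-< 4 t (suc u) (<-≤-trans (^-cancel-< (≤-<-trans N≤n hi)) v<))
      where
      ^-cancel-< : ∀ {a b} → 2 ^ a < 2 ^ suc b → a < suc b
      ^-cancel-< {a} {b} lt = ≰⇒> (λ b<a → <⇒≱ lt (^-monoʳ-≤ 2 b<a))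
    w≤ : v + 2 + r ≤ (r + 8) * suc u
    w≤ = lin (r * u + 2 + 4 * u) (<⇒≤ v<) (identity v r u)
      where
      identity : ∀ v r u → v + 2 + r + 4 * suc u + (r * u + 2 + 4 * u) ≡ (r + 8) * suc u + v
      identity = solve-∀
    growth : B * ((v + 2 + r) * (v + 2 + r)) ≤ n
    growth = begin
      B * ((v + 2 + r) * (v + 2 + r)) ≤⟨ *-monoʳ-≤ B (*-mono-≤ w≤ w≤) ⟩
      B * ((r + 8) * suc u * ((r + 8) * suc u)) ≡⟨ regroup B (r + 8) (suc u) ⟩
      t * (suc u * suc u) ≤⟨ *-monoˡ-≤ (suc u * suc u) (≤-trans t≤u (≤-trans (n≤1+n u) (m≤m*n (suc u) (suc u)))) ⟩
      suc u * suc u * (suc u * suc u) ≤⟨ quartic u ⟩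
      2 ^ (4 * u) ≤⟨ ^-monoʳ-≤ 2 (≤-trans (≤-reflexive (*-comm 4 u)) (m/n*n≤m v 4)) ⟩
      2 ^ v ≤⟨ lo ⟩
      n ∎
      where
      regroup : ∀ B s y → B * (s * y * (s * y)) ≡ B * (s * s) * (y * y)
      regroup = solve-∀

-- With at least `n / K₂` points of `few` a container saves `n / K₂` and loses at most
-- `n / (4 * K₂)` to points of `many`, which leaves more than `slack`. Otherwise the deviation is at
-- most `4 * n / K₂`, and `64 * r ≤ K₂` turns this into `16 * (r * b) ≤ n`.
module TemplateBound (r n : ℕ) {{nz : NonZero n}} (A : Subset n) (1≤r : 1 ≤ r)
  (K₂ κ E₀ w slack : ℕ) (64r≤K₂ : 64 * r ≤ K₂)
  (roth-bound : ∀ X → n ≤ 4 * (r * K₂) * count n X → n * n ≤ κ * apCount n X)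
  (κE₀<n² : κ * E₀ < n * n) (K₂E₀≤n² : K₂ * E₀ ≤ n * n)
  (rn<2^w : suc (r * n) ≤ 2 ^ w) (16w≤n : 16 * w ≤ n) (16≤n : 16 ≤ n)
  (slack-small : 4 * K₂ * slack ≤ 2 * n) where

  open Rainbow r n
  open Templates r n
  open PairCover r n
  open ColourSets r n A

  64≤K₂ : 64 ≤ K₂
  64≤K₂ = ≤-trans (*-monoʳ-≤ 64 1≤r) 64r≤K₂

  1≤K₂ : 1 ≤ K₂
  1≤K₂ = ≤-trans (s≤s z≤n) 64≤K₂

  1≤n : 1 ≤ n
  1≤n = ≤-trans (s≤s z≤n) 16≤n

  few-complement : ∀ V → count n (not ∘ few V) + count n (few V) ≡ n
  few-complement V = trans (sym (∑-+ n _ _)) (trans (∑-cong n (λ x _ → not-+ (few V x))) (∑-1 n))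

  many-rare : ∀ V → edges V ≤ E₀ → 4 * (r * K₂) * count n (many V) < n
  many-rare V sparse = ≰⇒> λ dense → <⇒≱ κE₀<n²
    (≤-trans (roth-bound (many V) dense) (*-monoʳ-≤ κ (≤-trans (many-sparse V) sparse)))

  weight-few : ∀ V → edges V ≤ E₀ → n ≤ K₂ * count n (few V) →
    count n (not ∘ few V) + r * count n (many V) + slack ≤ n
  weight-few V sparse dense = *-cancelˡ-≤ (4 * K₂) {{>-nonZero (≤-trans 1≤K₂ (m≤m+n K₂ _))}}
    (combine K₂ r n slack (count n (not ∘ few V)) (count n (few V)) (count n (many V))
      (few-complement V) (<⇒≤ (many-rare V sparse)) dense slack-small)
    where
    combine : ∀ k r n s a f m → a + f ≡ n → 4 * (r * k) * m ≤ n → n ≤ k * f → 4 * k * s ≤ 2 * n →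
      4 * k * (a + r * m + s) ≤ 4 * k * n
    combine k r _ s a f m refl h₁ h₂ h₃ = lin (a + f) (h₁ ⊕ h₃ ⊕ 4 ⊛ h₂) (identity k r s a f m)
      where
      identity : ∀ k r s a f m → 4 * k * (a + r * m + s) + (a + f + (2 * (a + f) + 4 * (k * f))) + (a + f)
        ≡ 4 * k * (a + f) + (4 * (r * k) * m + (4 * k * s + 4 * (a + f)))
      identity = solve-∀

  small-deviation : ∀ V → edges V ≤ E₀ → K₂ * count n (few V) < n →
    ∀ b → n * b ≤ 3 * (n * count n (few V)) + edges V → K₂ * b ≤ 4 * n
  small-deviation V sparse thin b le = *-cancelˡ-≤ n (combine K₂ n b (count n (few V)) (edges V) le (<⇒≤ thin)
      (≤-trans (*-monoʳ-≤ K₂ sparse) K₂E₀≤n²))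
    where
    combine : ∀ k n b f e → n * b ≤ 3 * (n * f) + e → k * f ≤ n → k * e ≤ n * n → n * (k * b) ≤ n * (4 * n)
    combine k n b f e h₁ h₂ h₃ = lin 0 (k ⊛ h₁ ⊕ (3 * n) ⊛ h₂ ⊕ h₃) (identity k n b f e)
      where
      identity : ∀ k n b f e → n * (k * b) + (k * (3 * (n * f) + e) + (3 * n * n + n * n)) + 0
        ≡ n * (4 * n) + (k * (n * b) + (3 * n * (k * f) + k * e))
      identity = solve-∀

  sixteen : ∀ {b} → K₂ * b ≤ 4 * n → 16 * (r * b) ≤ n
  sixteen {b} le = *-cancelˡ-≤ 4 (≤-trans (≤-reflexive (regroup r b)) (≤-trans (*-monoˡ-≤ b 64r≤K₂) le))
    where
    regroup : ∀ r b → 4 * (16 * (r * b)) ≡ 64 * r * b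
    regroup = solve-∀

  sum-small : ∀ {b f} → K₂ * b ≤ 4 * n → K₂ * f < n → b + f < n
  sum-small {b} {f} hb hf = *-cancelˡ-< K₂ (b + f) n (begin-strict
    K₂ * (b + f) ≡⟨ *-distribˡ-+ K₂ b f ⟩
    K₂ * b + K₂ * f <⟨ +-mono-≤-< hb hf ⟩
    4 * n + n ≡⟨ five n ⟩
    5 * n ≤⟨ *-monoˡ-≤ n (≤-trans (m≤m+n 5 59) 64≤K₂) ⟩
    K₂ * n ∎)
    where
    five : ∀ n → 4 * n + n ≡ 5 * n
    five = solve-∀

  -- In sixteenths of `n`: one for `w`, eight and one for `suc (n / 2)`, one for `r * b` and two for
  -- `slack`, thirteen in all.
  weight-pair : ∀ b → K₂ * b ≤ 4 * n → w + suc (n / 2) + r * b + slack ≤ n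
  weight-pair b le = *-cancelˡ-≤ 16 (combine n w (n / 2) (r * b) slack 16≤n 16w≤n
      (≤-trans (≤-reflexive (*-comm 2 (n / 2))) (m/n*n≤m n 2)) (sixteen le)
      (≤-trans (*-monoˡ-≤ slack (≤-trans (m≤m+n 16 240) (*-monoʳ-≤ 4 64≤K₂))) slack-small))
    where
    combine : ∀ n w h b s → 16 ≤ n → 16 * w ≤ n → 2 * h ≤ n → 16 * b ≤ n → 16 * s ≤ 2 * n →
      16 * (w + suc h + b + s) ≤ 16 * n
    combine n w h b s h₁ h₂ h₃ h₄ h₅ =
      lin (3 * n) (h₁ ⊕ h₂ ⊕ 8 ⊛ h₃ ⊕ h₄ ⊕ h₅) (identity n w h b s)
      where
      identity : ∀ n w h b s → 16 * (w + suc h + b + s) + (n + (n + (8 * n + (n + 2 * n)))) + 3 * n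
        ≡ 16 * n + (16 + (16 * w + (8 * (2 * h) + (16 * b + 16 * s))))
      identity = solve-∀

  slacken : ∀ e → e + slack ≤ n → 2 ^ e ≤ 2 ^ (n ∸ slack)
  slacken e h = ^-monoʳ-≤ 2 (m+n≤o⇒m≤o∸n e h)

  pair-weight : ∀ V → edges V ≤ E₀ → K₂ * count n (few V) < n →
    ∀ b → n * b ≤ 3 * (n * count n (few V)) + edges V → r * (n * 2 ^ suc (n / 2)) * 2 ^ (r * b) ≤ 2 ^ (n ∸ slack)
  pair-weight V sparse thin b le = begin
    r * (n * 2 ^ suc (n / 2)) * 2 ^ (r * b) ≡⟨ cong (_* 2 ^ (r * b)) (*-assoc r n (2 ^ suc (n / 2))) ⟨
    r * n * 2 ^ suc (n / 2) * 2 ^ (r * b) ≤⟨ *-monoˡ-≤ (2 ^ (r * b)) (*-monoˡ-≤ (2 ^ suc (n / 2)) (<⇒≤ rn<2^w)) ⟩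
    2 ^ w * 2 ^ suc (n / 2) * 2 ^ (r * b) ≡⟨ cong (_* 2 ^ (r * b)) (^-distribˡ-+-* 2 w (suc (n / 2))) ⟨
    2 ^ (w + suc (n / 2)) * 2 ^ (r * b) ≡⟨ ^-distribˡ-+-* 2 (w + suc (n / 2)) (r * b) ⟨
    2 ^ (w + suc (n / 2) + r * b) ≤⟨ slacken (w + suc (n / 2) + r * b) (weight-pair b (small-deviation V sparse thin b le)) ⟩
    2 ^ (n ∸ slack) ∎

  K₂≤4rK₂ : K₂ ≤ 4 * (r * K₂)
  K₂≤4rK₂ = ≤-trans (m≤n*m K₂ r {{>-nonZero 1≤r}}) (m≤n*m (r * K₂) 4)

  template-bound : ∀ V → edges V ≤ E₀ → ∑ₗ (multicoloured r A) (λ χ → ⟦ compat V χ ⟧) ≤ 2 ^ (n ∸ slack)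
  template-bound V sparse = split (n ≤? K₂ * count n (few V))
    where
    split : Dec (n ≤ K₂ * count n (few V)) → ∑ₗ (multicoloured r A) (λ χ → ⟦ compat V χ ⟧) ≤ 2 ^ (n ∸ slack)
    split (yes dense) = ≤-trans (compat-weight V) (slacken (count n (not ∘ few V) + r * count n (many V)) (weight-few V sparse dense))
    split (no ≰)      =
      let thin = ≰⇒> ≰
          many-thin = ≤-<-trans (*-monoˡ-≤ (count n (many V)) K₂≤4rK₂) (many-rare V sparse)
          b , le , near = near-pair V (λ b le → let dev = small-deviation V sparse thin b le in sum-small dev thin , sum-small dev many-thin)
      in ≤-trans (near-pair-count V near) (pair-weight V sparse thin b le)

module ContainerBound (r n : ℕ) {{nz : NonZero n}} (A : Subset n) (1≤r : 1 ≤ r)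
  (K₂ κ w D₁ D₂ q j₀ R f : ℕ) (64r≤K₂ : 64 * r ≤ K₂)
  (roth-bound : ∀ X → n ≤ 4 * (r * K₂) * count n X → n * n ≤ κ * apCount n X)
  (1≤q : 1 ≤ q) (q-large : 2 * (r * n * D₂) ≤ q * D₁) (j₀-large : D₁ ≤ j₀ * (4 * D₂)) (R-large : 4 * (r * 2) * (r * n) < R * D₁)
  (κE₀<n² : κ * (r * n * D₁ + q * (r * n * (r * 2))) < n * n) (K₂E₀≤n² : K₂ * (r * n * D₁ + q * (r * n * (r * 2))) ≤ n * n)
  (rn<2^w : suc (r * n) ≤ 2 ^ w) (16w≤n : 16 * w ≤ n) (16≤n : 16 ≤ n)
  (containers-few : 4 * K₂ * (w * ((q + j₀) * R)) ≤ n) (f-small : f * (4 * K₂) ≤ n) where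

  -- Of the exponent saved in each container, `L` pays for the number of containers and `f` remains
  -- for the final bound.
  L slack : ℕ
  L = w * ((q + j₀) * R)
  slack = L + f

  slack-small : 4 * K₂ * slack ≤ 2 * n
  slack-small = begin
    4 * K₂ * (L + f) ≡⟨ *-distribˡ-+ (4 * K₂) L f ⟩
    4 * K₂ * L + 4 * K₂ * f ≤⟨ +-mono-≤ containers-few (≤-trans (≤-reflexive (*-comm (4 * K₂) f)) f-small) ⟩
    n + n ≡⟨ cong (n +_) (+-identityʳ n) ⟨
    2 * n ∎

  slack≤n : slack ≤ n
  slack≤n = *-cancelˡ-≤ 2 (≤-trans (*-monoˡ-≤ slack (≤-trans (m≤m+n 2 254) (*-monoʳ-≤ 4 (≤-trans (*-monoʳ-≤ 64 1≤r) 64r≤K₂)))) slack-small)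

  open Rainbow r n
  open PairCover r n
  open ColourSets r n A
  open TemplateBound r n A 1≤r K₂ κ (r * n * D₁ + q * (r * n * (r * 2))) w slack 64r≤K₂ roth-bound κE₀<n² K₂E₀≤n² rn<2^w 16w≤n 16≤n slack-small
  module K = Containers M (r * 2) D₁ D₂ q j₀ rainbow 1≤q q-large j₀-large codegree₁ codegree₂ codegree₃
               Admissible (λ adm → Admissible.rainbow-free adm)

  number : (suc M ^ (q + j₀)) ^ R ≤ 2 ^ L
  number = begin
    (suc M ^ (q + j₀)) ^ R ≤⟨ ^-monoˡ-≤ R (^-monoˡ-≤ (q + j₀) rn<2^w) ⟩
    ((2 ^ w) ^ (q + j₀)) ^ R ≡⟨ ^-*-assoc (2 ^ w) (q + j₀) R ⟩
    (2 ^ w) ^ ((q + j₀) * R) ≡⟨ ^-*-assoc 2 w ((q + j₀) * R) ⟩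
    2 ^ L ∎

  bound : length (multicoloured r A) * 2 ^ f ≤ 2 ^ n
  bound = begin
    length (multicoloured r A) * 2 ^ f
      ≤⟨ *-monoˡ-≤ (2 ^ f) (cover-count (2 ^ (n ∸ slack)) (multicoloured r A) (K.containers R R-large) multicoloured-admissible template-bound) ⟩
    (suc M ^ (q + j₀)) ^ R * 2 ^ (n ∸ slack) * 2 ^ f
      ≤⟨ *-monoˡ-≤ (2 ^ f) (*-monoˡ-≤ (2 ^ (n ∸ slack)) number) ⟩
    2 ^ L * 2 ^ (n ∸ slack) * 2 ^ f
      ≡⟨ cong (_* 2 ^ f) (^-distribˡ-+-* 2 L (n ∸ slack)) ⟨
    2 ^ (L + (n ∸ slack)) * 2 ^ f
      ≡⟨ ^-distribˡ-+-* 2 (L + (n ∸ slack)) f ⟨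
    2 ^ (L + (n ∸ slack) + f)
      ≡⟨ cong (2 ^_) (trans (regroup L (n ∸ slack) f) (m+[n∸m]≡n slack≤n)) ⟩
    2 ^ n ∎
    where
    regroup : ∀ l m f → l + m + f ≡ l + f + m
    regroup = solve-∀

-- `k` gives the edges at light vertices half of the edge budget; recorded vertices take the other
-- half. `R` rounds suffice because `n < 2 * (k * D₁)`. `c` keeps the `n / D₂` recorded vertices per
-- round to half of the allowed exponent. `s` makes `q` large enough that link degrees below `D₂`
-- are negligible.
module Parameters (r n : ℕ) {{nz : NonZero n}} (A : Subset n) (1≤r : 1 ≤ r)
  (K₂ κ k R c s w : ℕ) (64r≤K₂ : 64 * r ≤ K₂) (1≤k : 1 ≤ k) (1≤c : 1 ≤ c) (1≤w : 1 ≤ w)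
  (k≡ : k ≡ 2 * ((κ + K₂) * r)) (R≡ : R ≡ 16 * (r * r * k)) (c≡ : c ≡ 8 * (K₂ * R)) (s≡ : s ≡ 4 * (r * k) * c)
  (roth-bound : ∀ X → n ≤ 4 * (r * K₂) * count n X → n * n ≤ κ * apCount n X)
  (rn<2^w : suc (r * n) ≤ 2 ^ w)
  (k≤n : k ≤ n) (large₁ : 4 * ((κ + K₂) * r * r * s) * (w * w) ≤ n) (large₂ : c * suc s * (w * w) ≤ n)
  (large₃ : 16 * (w * w) ≤ n) where

  instance
    k≢0 : NonZero k
    k≢0 = >-nonZero 1≤k

  -- w is about log₂ n; D₂ and q are of order w, which makes the number of
  -- containers at most 2 ^ (n / (4 * K₂)).
  D₁ D₂ q : ℕ
  D₁ = n / k
  D₂ = c * w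
  q  = s * w

  instance
    D₂≢0 : NonZero D₂
    D₂≢0 = >-nonZero (*-mono-≤ 1≤c 1≤w)

  j₀ : ℕ
  j₀ = suc (n / D₂)

  w≤w² : w ≤ w * w
  w≤w² = m≤m*n w w {{>-nonZero 1≤w}}

  1≤D₁ : 1 ≤ D₁
  1≤D₁ = *-cancelʳ-< k 0 D₁ (≰⇒> λ le → <⇒≱ (<-≤-trans (n%k<k) k≤n) (≤-trans (≤-reflexive (m≡m%n+[m/n]*n n k))
           (≤-trans (+-monoʳ-≤ (n % k) le) (≤-reflexive (+-identityʳ _)))))
    where
    n%k<k = m%n<n n k

  n<2kD₁ : n < 2 * (k * D₁)
  n<2kD₁ = begin-strict
    n ≡⟨ m≡m%n+[m/n]*n n k ⟩
    n % k + D₁ * k <⟨ +-monoˡ-< (D₁ * k) (m%n<n n k) ⟩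
    k + D₁ * k ≤⟨ +-monoˡ-≤ (D₁ * k) (m≤n*m k D₁ {{>-nonZero 1≤D₁}}) ⟩
    D₁ * k + D₁ * k ≡⟨ double D₁ k ⟩
    2 * (k * D₁) ∎
    where
    double : ∀ d k → d * k + d * k ≡ 2 * (k * d)
    double = solve-∀

  1≤s : 1 ≤ s
  1≤s = subst (1 ≤_) (sym s≡) (*-mono-≤ {1} {4 * (r * k)} (*-mono-≤ {1} {4} (s≤s z≤n) (*-mono-≤ 1≤r 1≤k)) 1≤c)

  1≤q : 1 ≤ q
  1≤q = *-mono-≤ 1≤s 1≤w

  q-large : 2 * (r * n * D₂) ≤ q * D₁
  q-large = begin
    2 * (r * n * (c * w)) ≤⟨ *-monoʳ-≤ 2 (*-monoˡ-≤ (c * w) (*-monoʳ-≤ r (<⇒≤ n<2kD₁))) ⟩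
    2 * (r * (2 * (k * D₁)) * (c * w)) ≡⟨ regroup r k D₁ c w ⟩
    4 * (r * k) * c * w * D₁ ≡⟨ cong (λ s → s * w * D₁) s≡ ⟨
    s * w * D₁ ∎
    where
    regroup : ∀ r k d c w → 2 * (r * (2 * (k * d)) * (c * w)) ≡ 4 * (r * k) * c * w * d
    regroup = solve-∀

  j₀-large : D₁ ≤ j₀ * (4 * D₂)
  j₀-large = begin
    D₁ ≤⟨ m/n≤m n k ⟩
    n ≡⟨ m≡m%n+[m/n]*n n D₂ ⟩
    n % D₂ + n / D₂ * D₂ ≤⟨ +-monoˡ-≤ (n / D₂ * D₂) (<⇒≤ (m%n<n n D₂)) ⟩
    j₀ * D₂ ≤⟨ *-monoʳ-≤ j₀ (m≤n*m D₂ 4) ⟩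
    j₀ * (4 * D₂) ∎

  R-large : 4 * (r * 2) * (r * n) < R * D₁
  R-large = begin-strict
    4 * (r * 2) * (r * n) ≡⟨ regroup r n ⟩
    8 * (r * r) * n <⟨ *-monoʳ-< (8 * (r * r)) {{>-nonZero (*-mono-≤ {1} {8} (s≤s z≤n) (*-mono-≤ 1≤r 1≤r))}} n<2kD₁ ⟩
    8 * (r * r) * (2 * (k * D₁)) ≡⟨ regroup′ r k D₁ ⟩
    16 * (r * r * k) * D₁ ≡⟨ cong (_* D₁) R≡ ⟨
    R * D₁ ∎
    where
    regroup : ∀ r n → 4 * (r * 2) * (r * n) ≡ 8 * (r * r) * n
    regroup = solve-∀
    regroup′ : ∀ r k d → 8 * (r * r) * (2 * (k * d)) ≡ 16 * (r * r * k) * d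
    regroup′ = solve-∀

  E₀ : ℕ
  E₀ = r * n * D₁ + q * (r * n * (r * 2))

  sparse-enough : (κ + K₂) * E₀ ≤ n * n
  sparse-enough = *-cancelˡ-≤ 2 (combine (κ + K₂) r n D₁ q
      (≤-trans (≤-reflexive (trans (cong (_* D₁) (sym k≡)) (*-comm k D₁))) (m/n*n≤m n k))
      (≤-trans (≤-reflexive (regroup (κ + K₂) r s w)) (≤-trans (*-monoʳ-≤ (4 * ((κ + K₂) * r * r * s)) w≤w²) large₁)))
    where
    regroup : ∀ κ r s w → 4 * (κ * r * r * (s * w)) ≡ 4 * (κ * r * r * s) * w
    regroup = solve-∀
    combine : ∀ κ r n d q → 2 * (κ * r) * d ≤ n → 4 * (κ * r * r * q) ≤ n → 2 * (κ * (r * n * d + q * (r * n * (r * 2)))) ≤ 2 * (n * n)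
    combine κ r n d q h₁ h₂ = lin 0 (n ⊛ h₁ ⊕ n ⊛ h₂) (identity κ r n d q)
      where
      identity : ∀ κ r n d q → 2 * (κ * (r * n * d + q * (r * n * (r * 2)))) + (n * n + n * n) + 0
        ≡ 2 * (n * n) + (n * (2 * (κ * r) * d) + n * (4 * (κ * r * r * q)))
      identity = solve-∀

  1≤K₂ : 1 ≤ K₂
  1≤K₂ = ≤-trans (*-mono-≤ {1} {64} (s≤s z≤n) 1≤r) 64r≤K₂

  1≤n : 1 ≤ n
  1≤n = >-nonZero⁻¹ n

  κE₀<n² : κ * E₀ < n * n
  κE₀<n² = <-≤-trans (m<m+n (κ * E₀) (*-mono-≤ 1≤K₂ (≤-trans (*-mono-≤ (*-mono-≤ 1≤r 1≤n) 1≤D₁) (m≤m+n _ _))))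
    (≤-trans (≤-reflexive (sym (*-distribʳ-+ E₀ κ K₂))) sparse-enough)

  K₂E₀≤n² : K₂ * E₀ ≤ n * n
  K₂E₀≤n² = ≤-trans (*-monoˡ-≤ E₀ (m≤n+m K₂ κ)) sparse-enough

  containers-few : 4 * K₂ * (w * ((q + j₀) * R)) ≤ n
  containers-few = *-cancelˡ-≤ 2 (begin
    2 * (4 * K₂ * (w * ((s * w + suc (n / D₂)) * R)))
      ≡⟨ regroup K₂ R w s (n / D₂) ⟩
    8 * (K₂ * R) * (s * (w * w) + w) + n / D₂ * (8 * (K₂ * R) * w)
      ≡⟨ cong (λ c → c * (s * (w * w) + w) + n / D₂ * (c * w)) c≡ ⟨
    c * (s * (w * w) + w) + n / D₂ * (c * w)
      ≤⟨ +-mono-≤ (*-monoʳ-≤ c (+-monoʳ-≤ (s * (w * w)) w≤w²)) (m/n*n≤m n D₂) ⟩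
    c * (s * (w * w) + w * w) + n
      ≡⟨ cong (_+ n) (regroup′ c s (w * w)) ⟩
    c * suc s * (w * w) + n
      ≤⟨ +-monoˡ-≤ n large₂ ⟩
    n + n
      ≡⟨ cong (n +_) (+-identityʳ n) ⟨
    2 * n ∎)
    where
    regroup : ∀ K R w s m → 2 * (4 * K * (w * ((s * w + suc m) * R))) ≡ 8 * (K * R) * (s * (w * w) + w) + m * (8 * (K * R) * w)
    regroup = solve-∀
    regroup′ : ∀ c s x → c * (s * x + x) ≡ c * suc s * x
    regroup′ = solve-∀

  rare : ∀ f → f * (4 * K₂) ≤ n → length (multicoloured r A) * 2 ^ f ≤ 2 ^ n
  rare f f-small = ContainerBound.bound r n A 1≤r K₂ κ w D₁ D₂ q j₀ R f 64r≤K₂ roth-bound 1≤q q-large j₀-large R-large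
    κE₀<n² K₂E₀≤n² rn<2^w (≤-trans (*-monoʳ-≤ 16 w≤w²) large₃)
    (≤-trans (*-monoʳ-≤ 16 (*-mono-≤ 1≤w 1≤w)) large₃) containers-few f-small

-- The bound `2 ^ (n - f)` without subtraction, for every `f` up to `n / K`: the upper estimate uses
-- `f` near `n / K`, the other consequences a constant `f`. `K` and `N` do not depend on `A`.
record Rare (r K N : ℕ) : Set where
  field
    1≤K  : 1 ≤ K
    rare : ∀ n → N ≤ n → (A : Subset n) → ∀ f → f * K ≤ n → length (multicoloured r A) * 2 ^ f ≤ 2 ^ n

rare-from : ∀ r K₂ κ k R c s → 1 ≤ r → 64 * r ≤ K₂ →
  k ≡ 2 * ((κ + K₂) * r) → R ≡ 16 * (r * r * k) → c ≡ 8 * (K₂ * R) → s ≡ 4 * (r * k) * c →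
  (∀ n .{{_ : NonZero n}} X → n ≤ 4 * (r * K₂) * count n X → n * n ≤ κ * apCount n X) →
  ∃[ N ] Rare r (4 * K₂) N
rare-from r K₂ κ k R c s 1≤r 64r≤K₂ k≡ R≡ c≡ s≡ roth-bound =
  suc (proj₁ logs) , record { 1≤K = *-mono-≤ {1} {4} (s≤s z≤n) 1≤K₂ ; rare = conclude }
  where
  1≤K₂ : 1 ≤ K₂
  1≤K₂ = ≤-trans (*-mono-≤ {1} {64} (s≤s z≤n) 1≤r) 64r≤K₂
  1≤k : 1 ≤ k
  1≤k = subst (1 ≤_) (sym k≡) (*-mono-≤ {1} {2} (s≤s z≤n) (*-mono-≤ (≤-trans 1≤K₂ (m≤n+m K₂ κ)) 1≤r))
  1≤R : 1 ≤ R
  1≤R = subst (1 ≤_) (sym R≡) (*-mono-≤ {1} {16} (s≤s z≤n) (*-mono-≤ (*-mono-≤ 1≤r 1≤r) 1≤k))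
  1≤c : 1 ≤ c
  1≤c = subst (1 ≤_) (sym c≡) (*-mono-≤ {1} {8} (s≤s z≤n) (*-mono-≤ 1≤K₂ 1≤R))
  B₁ B₂ : ℕ
  B₁ = 4 * ((κ + K₂) * r * r * s)
  B₂ = c * suc s
  logs : ∃[ N ] ∀ n → N ≤ n → ∃[ w ] 1 ≤ w × suc (r * n) ≤ 2 ^ w × (k + (B₁ + (B₂ + 16))) * (w * w) ≤ n
  logs = log-small r (k + (B₁ + (B₂ + 16)))
  conclude : ∀ n → suc (proj₁ logs) ≤ n → (A : Subset n) → ∀ f → f * (4 * K₂) ≤ n → length (multicoloured r A) * 2 ^ f ≤ 2 ^ n
  conclude n N<n A =
    let w , 1≤w , rn<2^w , large = proj₂ logs n (<⇒≤ N<n)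
        instance n≢0 = >-nonZero (≤-trans (s≤s z≤n) N<n)
        part : ∀ b → b ≤ k + (B₁ + (B₂ + 16)) → b * (w * w) ≤ n
        part = λ b b≤ → ≤-trans (*-monoˡ-≤ (w * w) b≤) large
    in Parameters.rare r n A 1≤r K₂ κ k R c s w 64r≤K₂ 1≤k 1≤c 1≤w k≡ R≡ c≡ s≡ (roth-bound n) rn<2^w
         (≤-trans (≤-trans (≤-reflexive (sym (*-identityʳ k))) (*-monoʳ-≤ k (*-mono-≤ 1≤w 1≤w))) (part k (m≤m+n k _)))
         (part B₁ (≤-trans (m≤m+n B₁ (B₂ + 16)) (m≤n+m _ k)))
         (part B₂ (≤-trans (m≤m+n B₂ 16) (≤-trans (m≤n+m (B₂ + 16) B₁) (m≤n+m _ k))))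
         (part 16 (≤-trans (m≤n+m 16 B₂) (≤-trans (m≤n+m (B₂ + 16) B₁) (m≤n+m _ k))))

multicoloured-rare : ∀ r → 1 ≤ r → ∃[ K ] ∃[ N ] Rare r K N
multicoloured-rare r 1≤r =
  let κ , roth-bound = varnavides (4 * (r * (64 * r))) (*-mono-≤ {1} {4} (s≤s z≤n) (*-mono-≤ 1≤r (*-mono-≤ {1} {64} (s≤s z≤n) 1≤r)))
  in 4 * (64 * r) , rare-from r (64 * r) κ _ _ _ _ 1≤r ≤-refl refl refl refl refl roth-bound

-- Colourings with at most two colours

compatible-count-exact : ∀ {n} r m (A : Subset n) P → (∀ x → count r (P x) ≡ m) → compatible-count r A P ≡ m ^ ∣ A ∣
compatible-count-exact r m []            P h = refl
compatible-count-exact r m (inside ∷ A)  P h = trans (compatible-count-inside r A P) (cong₂ _*_ (h 0) (compatible-count-exact r m A (P ∘ suc) (h ∘ suc)))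
compatible-count-exact r m (outside ∷ A) P h = trans (compatible-count-outside r A P) (compatible-count-exact r m A (P ∘ suc) (h ∘ suc))

∑ₗ-∑-swap : ∀ (xs : List X) m (f : X → ℕ → ℕ) → ∑ₗ xs (λ x → ∑ m (f x)) ≡ ∑ m (λ i → ∑ₗ xs (λ x → f x i))
∑ₗ-∑-swap []       m f = sym (∑-zero m (λ _ _ → refl))
∑ₗ-∑-swap (x ∷ xs) m f = trans (cong (∑ m (f x) +_) (∑ₗ-∑-swap xs m f)) (sym (∑-+ m (f x) _))

is : ℕ → ℕ → Bool
is i p = p ≡ᵇ i

either : ℕ → ℕ → ℕ → Bool
either i j p = (p ≡ᵇ i) ∨ (p ≡ᵇ j)

either-count : ∀ {r i j} → i < r → j < r → i < j → count r (either i j) ≡ 2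
either-count {r} {i} {j} i<r j<r i<j = trans (∑-cong r (λ p _ → pointwise p)) (trans (∑-+ r _ _) (cong₂ _+_ (count-≡ᵇ i<r) (count-≡ᵇ j<r)))
  where
  pointwise : ∀ p → ⟦ either i j p ⟧ ≡ ⟦ p ≡ᵇ i ⟧ + ⟦ p ≡ᵇ j ⟧
  pointwise p with p ≟ i
  ... | yes refl rewrite ≡ᵇ-intro {p} refl | ≡ᵇ-false (<⇒≢ i<j) = refl
  ... | no p≢i rewrite ≡ᵇ-false p≢i = refl

count-< : ∀ r j → j ≤ r → count r (λ i → i <ᵇ j) ≡ j
count-< r       zero    _   = ∑-zero r (λ _ _ → refl)
count-< (suc r) (suc j) j<r = cong suc (count-< r j (s≤s⁻¹ j<r))

∑-id : ∀ r → ∑ r id ≡ r C 2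
∑-id zero    = refl
∑-id (suc r) = trans (∑-last r id) (trans (cong (_+ r) (∑-id r)) (trans (+-comm (r C 2) r)
  (trans (cong (_+ r C 2) (sym (nC1≡n r))) (nCk+nC[k+1]≡[n+1]C[k+1] r 1))))

pair-count : ∀ r → ∑ r (λ i → ∑ r λ j → ⟦ i <ᵇ j ⟧) ≡ r C 2
pair-count r = trans (∑-swap r r _) (trans (∑-cong r (λ j j<r → count-< r j (<⇒≤ j<r))) (∑-id r))

valuedIn : (ℕ → Bool) → Colouring r A → Bool
valuedIn Q = compatible (λ _ → Q)

within-values : ∀ (χ : Colouring r A) Q → All (λ c → Q (toℕ c) ≡ true) (values χ) → valuedIn Q χ ≡ true
within-values []       Q []       = refl
within-values (c ∷ χ)  Q (q ∷ qs) = ∧-intro q (within-values χ Q qs)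
within-values (skip χ) Q qs       = within-values χ Q qs

values-within : ∀ (χ : Colouring r A) Q → valuedIn Q χ ≡ true → All (λ c → Q (toℕ c) ≡ true) (values χ)
values-within []       Q e = []
values-within (c ∷ χ)  Q e = proj₁ (∧-true e) ∷ values-within χ Q (proj₂ (∧-true {Q (toℕ c)} e))
values-within (skip χ) Q e = values-within χ Q e

values-escape : ∀ (χ : Colouring r A) Q → valuedIn Q χ ≡ false → ∃[ c ] c ∈ₗ values χ × Q (toℕ c) ≡ false
values-escape (c ∷ χ) Q e with Q (toℕ c) in q
... | false = c , here refl , q
... | true  = let b , b∈ , Qb = values-escape χ Q e in b , there b∈ , Qb
values-escape (skip χ) Q e = values-escape χ Q e

colour∈values : ∀ (χ : Colouring r A) {i} (i∈A : i ∈ A) → colour χ i∈A ∈ₗ values χ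
colour∈values (c ∷ χ)  here        = here refl
colour∈values (c ∷ χ)  (there i∈A) = there (colour∈values χ i∈A)
colour∈values (skip χ) (there i∈A) = colour∈values χ i∈A

palette-list : Colouring r A → List (Fin r)
palette-list χ = List.deduplicate _≟ᶠ_ (values χ)

short-list : ∀ (xs : List X) → length xs ≤ 2 → ∀ {x y z} → x ∈ₗ xs → y ∈ₗ xs → z ∈ₗ xs → x ≢ y → y ≢ z → x ≢ z → ⊥
short-list (_ ∷ _ ∷ _ ∷ _) (s≤s (s≤s ()))
short-list (_ ∷ _) _ (here refl) (here refl) _ x≢y _ _ = x≢y refl
short-list (_ ∷ _) _ (here refl) _ (here refl) _ _ x≢z = x≢z refl
short-list (_ ∷ _) _ _ (here refl) (here refl) _ y≢z _ = y≢z refl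
short-list (_ ∷ _ ∷ []) _ (there (here refl)) (there (here refl)) _ x≢y _ _ = x≢y refl
short-list (_ ∷ _ ∷ []) _ (there (here refl)) _ (there (here refl)) _ _ x≢z = x≢z refl
short-list (_ ∷ _ ∷ []) _ _ (there (here refl)) (there (here refl)) _ y≢z _ = y≢z refl

two-coloured-free : ∀ (χ : Colouring r A) → Is2Colouring χ → RainbowFree χ
two-coloured-free χ two a a∈A b b∈A c c∈A _ (x≢y , y≢z , x≢z) =
  short-list (palette-list χ) two (member a∈A) (member b∈A) (member c∈A) x≢y y≢z x≢z
  where
  member : ∀ {i} (i∈A : i ∈ _) → colour χ i∈A ∈ₗ palette-list χ
  member i∈A = ∈-deduplicate⁺ _≟ᶠ_ (colour∈values χ i∈A)

two : Colouring r A → Bool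
two χ = length (palette-list χ) ≤ᵇ 2

Two : ∀ {n} r (A : Subset n) → ℕ
Two r A = ∑ₗ (colourings r A) (λ χ → ⟦ two χ ⟧)

filter-split : ∀ {p q} {P : X → Set p} {Q : X → Set q} (P? : Decidable P) (Q? : Decidable Q) → (∀ x → Q x → P x) →
  ∀ L → length (List.filter P? L) ≡ ∑ₗ L (λ x → ⟦ does (Q? x) ⟧) + length (List.filter (λ x → ¬? (Q? x)) (List.filter P? L))
filter-split P? Q? Q⇒P []      = refl
filter-split P? Q? Q⇒P (x ∷ L) with P? x
... | no ¬p with Q? x
...   | yes q = contradiction (Q⇒P x q) ¬p
...   | no _  = filter-split P? Q? Q⇒P L
filter-split P? Q? Q⇒P (x ∷ L) | yes _ with Q? x
... | yes _ = cong suc (filter-split P? Q? Q⇒P L)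
... | no _  = trans (cong suc (filter-split P? Q? Q⇒P L)) (sym (+-suc _ _))

g-split : ∀ {n} r (A : Subset n) → g r A ≡ Two r A + length (multicoloured r A)
g-split r A = filter-split rainbowFree? is2Colouring? two-coloured-free (colourings r A)

-- On a nonempty domain this is 1 for a colouring with exactly two colours, `r - 1` for a constant
-- one, and 0 for all others.
pairs : ∀ {r n} {A : Subset n} → Colouring r A → ℕ
pairs {r} χ = ∑ r λ i → ∑ r λ j → ⟦ i <ᵇ j ⟧ * ⟦ valuedIn (either i j) χ ⟧

constants : ∀ {r n} {A : Subset n} → Colouring r A → ℕ
constants {r} χ = ∑ r λ i → ⟦ valuedIn (is i) χ ⟧

∑-pairs : ∀ {n} r (A : Subset n) → ∑ₗ (colourings r A) pairs ≡ (r C 2) * 2 ^ ∣ A ∣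
∑-pairs r A = begin-equality
  ∑ₗ (colourings r A) (λ χ → ∑ r λ i → ∑ r λ j → ⟦ i <ᵇ j ⟧ * ⟦ valuedIn (either i j) χ ⟧)
    ≡⟨ trans (∑ₗ-∑-swap (colourings r A) r _) (∑-cong r (λ i _ → trans (∑ₗ-∑-swap (colourings r A) r _)
         (∑-cong r (λ j _ → ∑ₗ-* (colourings r A) ⟦ i <ᵇ j ⟧ _)))) ⟩
  ∑ r (λ i → ∑ r λ j → ⟦ i <ᵇ j ⟧ * compatible-count r A (λ _ → either i j))
    ≡⟨ ∑-cong r (λ i i<r → ∑-cong r (λ j j<r → value i<r j<r)) ⟩
  ∑ r (λ i → ∑ r λ j → ⟦ i <ᵇ j ⟧ * 2 ^ ∣ A ∣)
    ≡⟨ trans (∑-cong r (λ i _ → ∑-*ʳ r _ (2 ^ ∣ A ∣))) (∑-*ʳ r _ (2 ^ ∣ A ∣)) ⟩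
  ∑ r (λ i → ∑ r λ j → ⟦ i <ᵇ j ⟧) * 2 ^ ∣ A ∣
    ≡⟨ cong (_* 2 ^ ∣ A ∣) (pair-count r) ⟩
  (r C 2) * 2 ^ ∣ A ∣ ∎
  where
  value : ∀ {i j} → i < r → j < r → ⟦ i <ᵇ j ⟧ * compatible-count r A (λ _ → either i j) ≡ ⟦ i <ᵇ j ⟧ * 2 ^ ∣ A ∣
  value {i} {j} i<r j<r with i <ᵇ j in e
  ... | false = refl
  ... | true  = cong (_+ 0) (compatible-count-exact r 2 A _ (λ _ → either-count i<r j<r (<ᵇ-elim i j e)))

∑-constants : ∀ {n} r (A : Subset n) → ∑ₗ (colourings r A) constants ≡ r
∑-constants r A = begin-equality
  ∑ₗ (colourings r A) (λ χ → ∑ r λ i → ⟦ valuedIn (is i) χ ⟧)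
    ≡⟨ ∑ₗ-∑-swap (colourings r A) r _ ⟩
  ∑ r (λ i → compatible-count r A (λ _ → is i))
    ≡⟨ ∑-cong r (λ i i<r → trans (compatible-count-exact r 1 A _ (λ _ → count-≡ᵇ i<r)) (^-zeroˡ ∣ A ∣)) ⟩
  ∑ r (λ _ → 1)
    ≡⟨ ∑-1 r ⟩
  r ∎

all-in-palette : ∀ (χ : Colouring r A) Q → All (λ c → Q (toℕ c) ≡ true) (palette-list χ) → valuedIn Q χ ≡ true
all-in-palette χ Q all = within-values χ Q (All.tabulate (λ c∈ → All.lookup all (∈-deduplicate⁺ _≟ᶠ_ c∈)))

pair-term : ∀ {r n} {A : Subset n} (χ : Colouring r A) i j → i < r → j < r → i < j → valuedIn (either i j) χ ≡ true → 1 ≤ pairs χ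
pair-term {r} χ i j i<r j<r i<j e = begin
  1
    ≡⟨ cong₂ (λ a b → ⟦ a ⟧ * ⟦ b ⟧) (<ᵇ-intro i<j) e ⟨
  ⟦ i <ᵇ j ⟧ * ⟦ valuedIn (either i j) χ ⟧
    ≤⟨ ∑-term r (λ j → ⟦ i <ᵇ j ⟧ * ⟦ valuedIn (either i j) χ ⟧) j j<r ⟩
  ∑ r (λ j → ⟦ i <ᵇ j ⟧ * ⟦ valuedIn (either i j) χ ⟧)
    ≤⟨ ∑-term r (λ i → ∑ r λ j → ⟦ i <ᵇ j ⟧ * ⟦ valuedIn (either i j) χ ⟧) i i<r ⟩
  pairs χ ∎

pair-of : ∀ (χ : Colouring r A) i j → i < r → j < r → i ≢ j →
  All (λ c → either i j (toℕ c) ≡ true) (palette-list χ) → 1 ≤ pairs χ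
pair-of χ i j i<r j<r i≢j all with <-cmp i j
... | tri< i<j _ _ = pair-term χ i j i<r j<r i<j (all-in-palette χ _ all)
... | tri≈ _ i≡j _ = contradiction i≡j i≢j
... | tri> _ _ j<i = pair-term χ j i j<r i<r j<i (all-in-palette χ _ (All.map (λ {c} e → trans (∨-comm (toℕ c ≡ᵇ j) (toℕ c ≡ᵇ i)) e) all))

two≤pairs : ∀ {r n} {A : Subset n} → 2 ≤ r → (χ : Colouring r A) → ⟦ two χ ⟧ ≤ pairs χ
two≤pairs {r} 2≤r χ with two χ in e
... | false = z≤n
... | true = cases (palette-list χ) (deduplicate-! _≟ᶠ_ (values χ)) (≤ᵇ-elim _ 2 e) (pair-of χ)
  where
  another : ∀ i → ∃[ j ] j < r × i ≢ j
  another zero    = 1 , 2≤r , λ ()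
  another (suc i) = 0 , ≤-trans (s≤s z≤n) 2≤r , λ ()
  cases : ∀ xs → Unique xs → length xs ≤ 2 →
    (∀ i j → i < r → j < r → i ≢ j → All (λ c → either i j (toℕ c) ≡ true) xs → 1 ≤ pairs χ) → 1 ≤ pairs χ
  cases []           _ _ found = found 0 1 (≤-trans (s≤s z≤n) 2≤r) 2≤r (λ ()) []
  cases (a ∷ [])     _ _ found = let j , j<r , a≢j = another (toℕ a)
    in found (toℕ a) j (toℕ<n a) j<r a≢j (∨-introˡ _ (≡ᵇ-intro {toℕ a} refl) ∷ [])
  cases (a ∷ b ∷ []) ((a≢b ∷ []) ∷ _) _ found = found (toℕ a) (toℕ b) (toℕ<n a) (toℕ<n b) (a≢b ∘ toℕ-injective)
    (∨-introˡ _ (≡ᵇ-intro {toℕ a} refl) ∷ ∨-introʳ (toℕ b ≡ᵇ toℕ a) (≡ᵇ-intro {toℕ b} refl) ∷ [])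
  cases (_ ∷ _ ∷ _ ∷ _) _ (s≤s (s≤s ())) found

Two-≤ : ∀ {n} r (A : Subset n) → 2 ≤ r → Two r A ≤ (r C 2) * 2 ^ ∣ A ∣
Two-≤ r A 2≤r = ≤-trans (∑ₗ-mono {xs = colourings r A} (All.tabulate (λ {χ} _ → two≤pairs 2≤r χ))) (≤-reflexive (∑-pairs r A))

not-two : ∀ (χ : Colouring r A) → two χ ≡ false → ∀ i j → valuedIn (either i j) χ ≡ false
not-two χ e i j with valuedIn (either i j) χ in c
... | false = refl
... | true with outside-pair (palette-list χ) (deduplicate-! _≟ᶠ_ (values χ)) (≰⇒> (λ h → true≢false (≤ᵇ-intro h) e)) i j
...   | c′ , c′∈ , c′≢i , c′≢j with ∨-true (All.lookup (values-within χ (either i j) c) (∈-deduplicate⁻ _≟ᶠ_ (values χ) c′∈))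
...     | inj₁ c≡i = contradiction (≡ᵇ-elim (toℕ c′) i c≡i) c′≢i
...     | inj₂ c≡j = contradiction (≡ᵇ-elim (toℕ c′) j c≡j) c′≢j

is⇒either : ∀ (χ : Colouring r A) i → valuedIn (is i) χ ≡ true → valuedIn (either i i) χ ≡ true
is⇒either χ i e = within-values χ (either i i) (All.map (λ {c} q → ∨-introˡ (toℕ c ≡ᵇ i) q) (values-within χ (is i) e))

-- The other colour of a pair through `a` is above or below `a`; with `a` itself these are distinct
-- elements below `r`.
pairs-through : ∀ r a → a < r → ∑ r (λ i → ∑ r λ j → ⟦ i <ᵇ j ⟧ * ⟦ either i j a ⟧) + 1 ≤ r
pairs-through r a a<r = begin
  ∑ r (λ i → ∑ r λ j → ⟦ i <ᵇ j ⟧ * ⟦ either i j a ⟧) + 1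
    ≤⟨ +-mono-≤ (∑-mono r (λ i _ → ∑-mono r (λ j _ → pointwise i j))) (≤-reflexive (sym (count-≡ᵇ a<r))) ⟩
  ∑ r (λ i → ∑ r λ j → ⟦ i ≡ᵇ a ⟧ * ⟦ a <ᵇ j ⟧ + ⟦ j ≡ᵇ a ⟧ * ⟦ i <ᵇ a ⟧) + count r (λ j → j ≡ᵇ a)
    ≡⟨ cong (_+ count r (λ j → j ≡ᵇ a)) (trans (∑-cong r (λ i _ → ∑-+ r _ _)) (trans (∑-+ r _ _) (cong₂ _+_
         (trans (∑-cong r (λ i _ → ∑-* r ⟦ i ≡ᵇ a ⟧ _)) (once (count r (λ j → a <ᵇ j))))
         (∑-cong r (λ i _ → once ⟦ i <ᵇ a ⟧))))) ⟩
  count r (λ j → a <ᵇ j) + count r (λ i → i <ᵇ a) + count r (λ j → j ≡ᵇ a)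
    ≡⟨ trans (∑-+ r _ _) (cong (_+ count r (λ j → j ≡ᵇ a)) (∑-+ r _ _)) ⟨
  ∑ r (λ j → ⟦ a <ᵇ j ⟧ + ⟦ j <ᵇ a ⟧ + ⟦ j ≡ᵇ a ⟧)
    ≤⟨ ∑-bound r 1 (λ j _ → trichotomy j) ⟩
  r * 1
    ≡⟨ *-identityʳ r ⟩
  r ∎
  where
  once : ∀ c → ∑ r (λ j → ⟦ j ≡ᵇ a ⟧ * c) ≡ c
  once c = trans (∑-*ʳ r _ c) (trans (cong (_* c) (count-≡ᵇ a<r)) (*-identityˡ c))
  <ᵇ-false : ∀ {m n} → n ≤ m → (m <ᵇ n) ≡ false
  <ᵇ-false {m} {n} n≤m with m <ᵇ n in e
  ... | false = refl
  ... | true  = contradiction (<ᵇ-elim m n e) (≤⇒≯ n≤m)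
  trichotomy : ∀ j → ⟦ a <ᵇ j ⟧ + ⟦ j <ᵇ a ⟧ + ⟦ j ≡ᵇ a ⟧ ≤ 1
  trichotomy j with <-cmp a j
  ... | tri< a<j a≢j _ rewrite <ᵇ-intro a<j | <ᵇ-false (<⇒≤ a<j) | ≡ᵇ-false {j} {a} (a≢j ∘ sym) = ≤-refl
  ... | tri≈ _ refl _ rewrite <ᵇ-false (≤-refl {a}) = ⟦⟧≤1 _
  ... | tri> _ a≢j j<a rewrite <ᵇ-intro j<a | <ᵇ-false (<⇒≤ j<a) | ≡ᵇ-false {j} {a} (a≢j ∘ sym) = ≤-refl
  pointwise : ∀ i j → ⟦ i <ᵇ j ⟧ * ⟦ either i j a ⟧ ≤ ⟦ i ≡ᵇ a ⟧ * ⟦ a <ᵇ j ⟧ + ⟦ j ≡ᵇ a ⟧ * ⟦ i <ᵇ a ⟧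
  pointwise i j with a ≟ i | a ≟ j
  ... | yes refl | _ rewrite ≡ᵇ-intro {a} refl = left ⟦ i <ᵇ j ⟧ (⟦ j ≡ᵇ i ⟧ * ⟦ i <ᵇ i ⟧)
    where
    left : ∀ x y → x * 1 ≤ 1 * x + y
    left x y = ≤-trans (≤-reflexive (*-comm x 1)) (m≤m+n (1 * x) y)
  ... | no a≢i | yes refl rewrite ≡ᵇ-intro {a} refl | ≡ᵇ-false a≢i = right ⟦ i <ᵇ j ⟧ (⟦ i ≡ᵇ j ⟧ * ⟦ j <ᵇ j ⟧)
    where
    right : ∀ x y → x * 1 ≤ y + 1 * x
    right x y = ≤-trans (≤-reflexive (*-comm x 1)) (m≤n+m (1 * x) y)
  ... | no a≢i | no a≢j rewrite ≡ᵇ-false a≢i | ≡ᵇ-false a≢j = ≤-trans (≤-reflexive (*-zeroʳ ⟦ i <ᵇ j ⟧)) z≤n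

single-pair : ∀ r (f : ℕ → ℕ → ℕ) lo hi → (∀ i j → f i j ≤ ⟦ i ≡ᵇ lo ⟧ * ⟦ j ≡ᵇ hi ⟧) → ∑ r (λ i → ∑ r (f i)) ≤ 1
single-pair r f lo hi h = begin
  ∑ r (λ i → ∑ r (f i))
    ≤⟨ ∑-mono r (λ i _ → ∑-mono r (λ j _ → h i j)) ⟩
  ∑ r (λ i → ∑ r λ j → ⟦ i ≡ᵇ lo ⟧ * ⟦ j ≡ᵇ hi ⟧)
    ≡⟨ ∑-cong r (λ i _ → ∑-* r ⟦ i ≡ᵇ lo ⟧ _) ⟩
  ∑ r (λ i → ⟦ i ≡ᵇ lo ⟧ * count r (λ j → j ≡ᵇ hi))
    ≤⟨ ∑-mono r (λ i _ → ≤-trans (*-monoʳ-≤ ⟦ i ≡ᵇ lo ⟧ (count-≡ᵇ-≤ r hi)) (≤-reflexive (*-identityʳ _))) ⟩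
  count r (λ i → i ≡ᵇ lo)
    ≤⟨ count-≡ᵇ-≤ r lo ⟩
  1 ∎

determined : ∀ {i j a b} → i < j → a < b → either i j a ≡ true → either i j b ≡ true → i ≡ a × j ≡ b
determined {i} {j} {a} {b} i<j a<b ea eb with ∨-true {a ≡ᵇ i} ea | ∨-true {b ≡ᵇ i} eb
... | inj₁ x | inj₂ y = sym (≡ᵇ-elim a i x) , sym (≡ᵇ-elim b j y)
... | inj₁ x | inj₁ y = contradiction (trans (≡ᵇ-elim a i x) (sym (≡ᵇ-elim b i y))) (<⇒≢ a<b)
... | inj₂ x | inj₂ y = contradiction (trans (≡ᵇ-elim a j x) (sym (≡ᵇ-elim b j y))) (<⇒≢ a<b)
... | inj₂ x | inj₁ y = contradiction (<-trans a<b (subst₂ _<_ (sym (≡ᵇ-elim b i y)) (sym (≡ᵇ-elim a j x)) i<j)) (<-irrefl refl)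

pairs-two-values : ∀ {r n} {A : Subset n} (χ : Colouring r A) {a b : Fin r} → a ∈ₗ values χ → b ∈ₗ values χ → toℕ a < toℕ b → pairs χ ≤ 1
pairs-two-values {r} χ {a} {b} a∈ b∈ a<b = single-pair r _ (toℕ a) (toℕ b) pointwise
  where
  pointwise : ∀ i j → ⟦ i <ᵇ j ⟧ * ⟦ valuedIn (either i j) χ ⟧ ≤ ⟦ i ≡ᵇ toℕ a ⟧ * ⟦ j ≡ᵇ toℕ b ⟧
  pointwise i j with i <ᵇ j in i<j | valuedIn (either i j) χ in c
  ... | false | _     = z≤n
  ... | true  | false = z≤n
  ... | true  | true with determined {i} {j} (<ᵇ-elim i j i<j) a<b (All.lookup (values-within χ _ c) a∈) (All.lookup (values-within χ _ c) b∈)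
  ...   | i≡ , j≡ = ≤-reflexive (sym (cong₂ (λ x y → ⟦ x ⟧ * ⟦ y ⟧) (≡ᵇ-intro i≡) (≡ᵇ-intro j≡)))

-- For a constant colouring both sides are `r + 1`, for one with exactly two colours both are 1, and
-- otherwise both vanish. The cons form excludes the empty colouring, whose values lie in every
-- pair.
pairs≤two : ∀ {r n} {A : Subset n} (c : Fin r) (χ : Colouring r A) → 2 ≤ r → let χ⁺ = c Colouring.∷ χ in
  pairs χ⁺ + 2 * constants χ⁺ ≤ ⟦ two χ⁺ ⟧ + r * constants χ⁺
pairs≤two {r} c χ 2≤r with two (c Colouring.∷ χ) in e
... | false = ≤-trans (≤-reflexive (cong₂ (λ x y → x + 2 * y) no-pairs no-constants)) z≤n
  where
  χ⁺ = c Colouring.∷ χ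
  no-pairs : pairs χ⁺ ≡ 0
  no-pairs = ∑-zero r (λ i _ → ∑-zero r (λ j _ → trans (cong (λ b → ⟦ i <ᵇ j ⟧ * ⟦ b ⟧) (not-two χ⁺ e i j)) (*-zeroʳ ⟦ i <ᵇ j ⟧)))
  no-constants : constants χ⁺ ≡ 0
  no-constants = ∑-zero r (λ i _ → zero′ i)
    where
    zero′ : ∀ i → ⟦ valuedIn (is i) χ⁺ ⟧ ≡ 0
    zero′ i with valuedIn (is i) χ⁺ in ci
    ... | false = refl
    ... | true  = ⊥-elim (true≢false (is⇒either χ⁺ i ci) (not-two χ⁺ e i i))
... | true with valuedIn (is (toℕ c)) (c Colouring.∷ χ) in const
...   | true = finish r (pairs χ⁺) (constants χ⁺) 2≤r few (≤-trans (≤-reflexive (sym (cong ⟦_⟧ const)))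
                 (∑-term r (λ i → ⟦ valuedIn (is i) χ⁺ ⟧) (toℕ c) (toℕ<n c)))
  where
  χ⁺ = c Colouring.∷ χ
  few : pairs χ⁺ + 1 ≤ r
  few = ≤-trans (+-monoˡ-≤ 1 (∑-mono r (λ i _ → ∑-mono r (λ j _ → *-monoʳ-≤ ⟦ i <ᵇ j ⟧ (⟦⟧-mono (λ h →
    All.lookup (values-within χ⁺ (either i j) h) (here refl))))))) (pairs-through r (toℕ c) (toℕ<n c))
  finish : ∀ r p k → 2 ≤ r → p + 1 ≤ r → 1 ≤ k → p + 2 * k ≤ 1 + r * k
  finish r p (suc k) 2≤r h _ = lin 0 (h ⊕ (*-monoˡ-≤ k 2≤r)) (identity r p k)
    where
    identity : ∀ r p k → p + 2 * suc k + (r + r * k) + 0 ≡ 1 + r * suc k + (p + 1 + 2 * k)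
    identity = solve-∀
...   | false = +-mono-≤ one (*-monoˡ-≤ (constants χ⁺) 2≤r)
  where
  χ⁺ = c Colouring.∷ χ
  one : pairs χ⁺ ≤ 1
  one with values-escape χ⁺ (is (toℕ c)) const
  ... | b , b∈ , b≢c with <-cmp (toℕ b) (toℕ c)
  ...   | tri< b<c _ _ = pairs-two-values χ⁺ b∈ (here refl) b<c
  ...   | tri≈ _ b≡c _ = ⊥-elim (true≢false (≡ᵇ-intro b≡c) b≢c)
  ...   | tri> _ _ c<b = pairs-two-values χ⁺ (here refl) b∈ c<b

Two-≥ : ∀ r n → 2 ≤ r → 1 ≤ n → (r C 2) * 2 ^ n + 2 * r ≤ Two r (⊤ {n}) + r * r
Two-≥ r (suc n) 2≤r _ = begin
  (r C 2) * 2 ^ suc n + 2 * r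
    ≡⟨ cong₂ _+_ (trans (∑-pairs r Z) (cong (λ m → (r C 2) * 2 ^ m) (∣⊤∣≡n (suc n)))) (cong (2 *_) (∑-constants r Z)) ⟨
  ∑ₗ L pairs + 2 * ∑ₗ L constants
    ≡⟨ trans (∑ₗ-+ L _ _) (cong (∑ₗ L pairs +_) (∑ₗ-* L 2 _)) ⟨
  ∑ₗ L (λ χ → pairs χ + 2 * constants χ)
    ≤⟨ ∑ₗ-mono {xs = L} (All.tabulate (λ { {c ∷ χ} _ → pairs≤two c χ 2≤r })) ⟩
  ∑ₗ L (λ χ → ⟦ two χ ⟧ + r * constants χ)
    ≡⟨ trans (∑ₗ-+ L _ _) (cong (Two r Z +_) (∑ₗ-* L r _)) ⟩
  Two r Z + r * ∑ₗ L constants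
    ≡⟨ cong (λ k → Two r Z + r * k) (∑-constants r Z) ⟩
  Two r Z + r * r ∎
  where
  Z = ⊤ {suc n}
  L = colourings r Z

-- Deduction of the bounds

*-^ : ∀ a b t → (a * b) ^ t ≡ a ^ t * b ^ t
*-^ a b zero    = refl
*-^ a b (suc t) = trans (cong (a * b *_) (*-^ a b t)) (shuffle a b (a ^ t) (b ^ t))
  where
  shuffle : ∀ a b x y → a * b * (x * y) ≡ a * x * (b * y)
  shuffle = solve-∀

-- A saving `f` of at least `n / (2 * K)` beats `n / (36 log₂ n)` as soon as `log₂ n ≥ K`, which is
-- the hypothesis `2 ^ K ≤ n`.
log-bound : ∀ {T n K f s t} → 1 ≤ K → 2 ^ K ≤ n → n ≤ 2 * (f * K) → T * 2 ^ f ≤ 2 ^ n →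
  n ^ (36 * s) ≤ 2 ^ (n * t) → T ^ t * 2 ^ s ≤ (2 ^ n) ^ t
log-bound {T} {n} {K} {f} {s} {t} 1≤K 2^K≤n n≤2fK rare small = begin
  T ^ t * 2 ^ s ≤⟨ *-monoʳ-≤ (T ^ t) (^-monoʳ-≤ 2 s≤ft) ⟩
  T ^ t * 2 ^ (f * t) ≡⟨ cong (T ^ t *_) (^-*-assoc 2 f t) ⟨
  T ^ t * (2 ^ f) ^ t ≡⟨ *-^ T (2 ^ f) t ⟨
  (T * 2 ^ f) ^ t ≤⟨ ^-monoˡ-≤ t rare ⟩
  (2 ^ n) ^ t ∎
  where
  exponents : K * (36 * s) ≤ n * t
  exponents = ≮⇒≥ λ lt → <⇒≱ (^-monoʳ-< 2 (s≤s (s≤s z≤n)) lt) (begin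
    2 ^ (K * (36 * s)) ≡⟨ ^-*-assoc 2 K (36 * s) ⟨
    (2 ^ K) ^ (36 * s) ≤⟨ ^-monoˡ-≤ (36 * s) 2^K≤n ⟩
    n ^ (36 * s) ≤⟨ small ⟩
    2 ^ (n * t) ∎)
  s≤ft : s ≤ f * t
  s≤ft = *-cancelˡ-≤ (2 * K) {{>-nonZero (*-mono-≤ {1} {2} (s≤s z≤n) 1≤K)}}
    (combine K n f s t exponents n≤2fK)
    where
    combine : ∀ K n f s t → K * (36 * s) ≤ n * t → n ≤ 2 * (f * K) → 2 * K * s ≤ 2 * K * (f * t)
    combine K n f s t h₁ h₂ = lin (34 * (K * s)) (h₁ ⊕ (*-monoˡ-≤ t h₂)) (identity K n f s t)
      where
      identity : ∀ K n f s t → 2 * K * s + (n * t + 2 * (f * K) * t) + 34 * (K * s) ≡ 2 * K * (f * t) + (K * (36 * s) + n * t)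
      identity = solve-∀

floor-double : ∀ n K → 1 ≤ K → K ≤ n → ∃[ f ] f * K ≤ n × n ≤ 2 * (f * K)
floor-double n K 1≤K K≤n = n / K , m/n*n≤m n K , (begin
  n ≡⟨ m≡m%n+[m/n]*n n K ⟩
  n % K + n / K * K ≤⟨ +-monoˡ-≤ (n / K * K) (<⇒≤ (m%n<n n K)) ⟩
  K + n / K * K ≤⟨ +-monoˡ-≤ (n / K * K) (m≤n*m K (n / K) {{>-nonZero (m≥n⇒m/n>0 K≤n)}}) ⟩
  n / K * K + n / K * K ≡⟨ cong (n / K * K +_) (+-identityʳ (n / K * K)) ⟨
  2 * (n / K * K) ∎)
  where
  instance
    K≢0 : NonZero K
    K≢0 = >-nonZero 1≤K

3≤rC2 : ∀ r → 3 ≤ r → 3 ≤ r C 2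
3≤rC2 r 3≤r = ≤-trans (∑-prefix id 3≤r) (≤-reflexive (∑-id r))

module Consequences (r K N : ℕ) (3≤r : 3 ≤ r) (R : Rare r K N) where

  open Rare R

  2≤r : 2 ≤ r
  2≤r = <⇒≤ 3≤r

  N₁ : ℕ
  -- `2 ^ K` gives `log₂ n ≥ K`, `2 * K` admits `f = 2` in `rare`, and `4 * (r * r) + 1` puts
  -- `r * r` below a quarter of `2 ^ n`.
  N₁ = N + (2 ^ K + (2 * K + (4 * (r * r) + 1)))

  multi : ∀ {n} → Subset n → ℕ
  multi A = length (multicoloured r A)

  module _ (n : ℕ) (N₁≤n : N₁ ≤ n) where

    N≤n : N ≤ n
    N≤n = ≤-trans (m≤m+n N _) N₁≤n

    tail≤n : 2 ^ K + (2 * K + (4 * (r * r) + 1)) ≤ n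
    tail≤n = ≤-trans (m≤n+m _ N) N₁≤n

    2^K≤n : 2 ^ K ≤ n
    2^K≤n = ≤-trans (m≤m+n (2 ^ K) _) tail≤n

    2K≤n : 2 * K ≤ n
    2K≤n = ≤-trans (m≤m+n (2 * K) _) (≤-trans (m≤n+m _ (2 ^ K)) tail≤n)

    4r²<n : 4 * (r * r) + 1 ≤ n
    4r²<n = ≤-trans (m≤n+m _ (2 * K)) (≤-trans (m≤n+m _ (2 ^ K)) tail≤n)

    1≤n : 1 ≤ n
    1≤n = ≤-trans (m≤n+m 1 (4 * (r * r))) 4r²<n

    4r²<2^n : 4 * (r * r) + 1 ≤ 2 ^ n
    4r²<2^n = ≤-trans 4r²<n (<⇒≤ (n<2^n n))

    g⊤ : g r (⊤ {n}) ≡ Two r (⊤ {n}) + multi (⊤ {n})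
    g⊤ = g-split r (⊤ {n})

    lower : (r C 2) * 2 ^ n + 2 * r ≤ gℤ r n + r * r
    lower = ≤-trans (Two-≥ r n 2≤r 1≤n) (+-monoˡ-≤ (r * r) (≤-trans (m≤m+n _ _) (≤-reflexive (sym g⊤))))

    excess : gℤ r n ∸ (r C 2) * 2 ^ n ≤ multi (⊤ {n})
    excess = m≤n+o⇒m∸n≤o _ _ (≤-trans (≤-reflexive g⊤) (+-monoˡ-≤ (multi (⊤ {n})) (≤-trans (Two-≤ r (⊤ {n}) 2≤r)
      (≤-reflexive (cong (λ m → (r C 2) * 2 ^ m) (∣⊤∣≡n n))))))

    upper : gℤ r n ≤ (r C 2) * 2 ^ n +2^[- n /36log₂]·2^ n
    upper s t small =
      let f , fK≤n , n≤2fK = floor-double n K 1≤K (≤-trans (m≤m+n K _) 2K≤n)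
      in log-bound {K = K} {f} {s} {t} 1≤K 2^K≤n n≤2fK (≤-trans (*-monoˡ-≤ (2 ^ f) excess) (rare n N≤n ⊤ f fK≤n)) small

    -- Losing one point halves the main term at least, a loss of at least half of `2 ^ n`. The
    -- colourings of `A` with three or more colours return at most a quarter, and `r * r` is less
    -- than another quarter.
    proper : ∀ (A : Subset n) → A ⊂ ⊤ → g r A < gℤ r n
    proper A A⊂⊤ = combine (r C 2) (2 ^ n) (2 ^ ∣ A ∣) (multi A) (r * r) r (g r A) (gℤ r n)
      (≤-trans (s≤s z≤n) (3≤rC2 r 3≤r)) (^-monoʳ-≤ 2 (≤-trans (p⊂q⇒∣p∣<∣q∣ A⊂⊤) (≤-reflexive (∣⊤∣≡n n))))
      (≤-trans (≤-reflexive (*-comm 4 (multi A))) (rare n N≤n A 2 2K≤n)) 4r²<2^n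
      (≤-trans (≤-reflexive (g-split r A)) (+-monoˡ-≤ (multi A) (Two-≤ r A 2≤r))) lower
      where
      combine : ∀ c x y t s r g g′ → 1 ≤ c → 2 * y ≤ x → 4 * t ≤ x → 4 * s + 1 ≤ x → g ≤ c * y + t → c * x + 2 * r ≤ g′ + s → g < g′
      combine (suc c) x y t s r g g′ _ h₁ h₂ h₃ h₄ h₅ = *-cancelˡ-< 4 g g′
        (lin (2 * c * x + 8 * r) ((2 * suc c) ⊛ h₁ ⊕ h₂ ⊕ h₃ ⊕ 4 ⊛ h₄ ⊕ 4 ⊛ h₅)
          (identity c x y t s r g g′))
        where
        identity : ∀ c x y t s r g g′ →
          suc (4 * g) + (2 * suc c * x + (x + (x + (4 * (suc c * y + t) + 4 * (g′ + s))))) + (2 * c * x + 8 * r)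
          ≡ 4 * g′ + (2 * suc c * (2 * y) + (4 * t + (4 * s + 1 + (4 * g + 4 * (suc c * x + 2 * r)))))
        identity = solve-∀

    2^n<g : 2 ^ n < gℤ r n
    2^n<g = combine (r C 2) (2 ^ n) (r * r) r (gℤ r n) (≤-trans (s≤s (s≤s z≤n)) (3≤rC2 r 3≤r)) 4r²<2^n lower
      where
      combine : ∀ c x s r g → 2 ≤ c → 4 * s + 1 ≤ x → c * x + 2 * r ≤ g + s → x < g
      combine (suc (suc c)) x s r g _ h₁ h₂ = lin (c * x + 2 * r + 3 * s) (h₁ ⊕ h₂) (identity c x s r g)
        where
        identity : ∀ c x s r g → suc x + (x + (g + s)) + (c * x + 2 * r + 3 * s) ≡ g + (4 * s + 1 + (suc (suc c) * x + 2 * r))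
        identity = solve-∀
      combine (suc zero) x s r g (s≤s ())

  -- The rarity bound with `f = k` already gives a factor `2 ^ k > k`, and the remaining `2 ^ n` is
  -- below `gℤ r n`.
  negligible : ∀ k n → N₁ + k * K ≤ n → k * gℤ≥3 r n < gℤ r n
  negligible k n le = ≤-<-trans (≤-trans (≤-reflexive (*-comm k (multi (⊤ {n})))) (≤-trans (*-monoʳ-≤ (multi (⊤ {n})) (<⇒≤ (n<2^n k)))
    (rare n (N≤n n N₁≤n) ⊤ k (≤-trans (m≤n+m (k * K) N₁) le)))) (2^n<g n N₁≤n)
    where
    N₁≤n : N₁ ≤ n
    N₁≤n = ≤-trans (m≤m+n N₁ (k * K)) le

open import Data.Integer.Base as ℤ using (+_)
import Data.Integer.Properties as ℤₚ

difference-≤ : ∀ a b c d → a + c ≤ d + b → (+ a ℤ.- + b ℤ.+ + c) ℤ.≤ + d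
difference-≤ a b c d le = subst₂ ℤ._≤_
  (sym (trans (cong (ℤ._+ + c) (ℤₚ.m-n≡m⊖n a b)) (ℤₚ.distribˡ-⊖-+-pos c a b)))
  (trans (ℤₚ.⊖-≥ (m≤n+m b d)) (cong +_ (m+n∸n≡m d b)))
  (ℤₚ.⊖-monoˡ-≤ b le)

corollary1p5 : ∀ r → r ≥ 3 →
    (∃[ N ] ∀ n → n ≥ N →
    ((+ ((r C 2) * 2 ^ n) ℤ.- + (r ^ 2) ℤ.+ + (2 * r)) ℤ.≤ + gℤ r n)
    × (gℤ r n ≤ (r C 2) * 2 ^ n +2^[- n /36log₂]·2^ n)
    × (∀ (A : Subset n) → A ⊂ ⊤ → g r A < gℤ r n))
    × (∀ k → ∃[ M ] ∀ n → n ≥ M → k * gℤ≥3 r n < gℤ r n)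
corollary1p5 r 3≤r =
  let K , N , rare = multicoloured-rare r (<⇒≤ (<⇒≤ 3≤r))
      open Consequences r K N 3≤r rare
  in ( N₁ , λ n N₁≤n →
           difference-≤ ((r C 2) * 2 ^ n) (r ^ 2) (2 * r) (gℤ r n)
             (subst (λ s → (r C 2) * 2 ^ n + 2 * r ≤ gℤ r n + s) (cong (r *_) (sym (*-identityʳ r))) (lower n N₁≤n))
         , upper n N₁≤n
         , proper n N₁≤n )
   , λ k → N₁ + k * K , negligible k
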